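{- Let $f_{n,k}$ be the total weight of meanders with catastrophes of length $n$ going from altitude $0$ to altitude $k$, and let $F(z,u)=\sum_{k\ge0}F_k(z)u^k=\sum_{n,k\ge0}f_{n,k}u^kz^n$. Then $F(z,u)$ is algebraic and \[ F(z,u)=D(z)\,M(z,u)=D(z)\,\frac{\prod_{i=1}^c\big(u-u_i(z)\big)}{u^c\big(1-zP(u)\big)}, \] \[ F_k(z)=D(z)\,M_k(z)=D(z)\,\frac{1}{p_d z}\sum_{\ell=1}^d v_\ell^{ -k-1}\prod_{\substack{1\le j\le d\\ j\neq \ell}}\frac{1}{v_j-v_\ell}\qquad (k\ge 0), \] where $D(z)=\frac{1}{1-Q(z)}$ is the generating function of excursions (with catastrophes) ending with a catastrophe (including the empty path), $Q(z)=zq\big(M(z)-E(z)-\sum_{j>0,\,-j\in\mathcal J}M_j(z)\big)$, and $u_1(z),\dots,u_c(z)$ and $v_1(z),\dots,v_d(z)$ are the small and the large roots of the kernel equation $1-zP(u)=0$.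
   Context: Fix integers $c,d\ge1$ and weights $p_{ -c},\dots,p_d$ (non-negative reals) with $p_{ -c}\neq0$, $p_d\neq 0$. The jump set is $\mathcal J=\{i\in\{ -c,\dots,d\}: p_i\neq 0\}$ and the jump polynomial is $P(u)=\sum_{i=-c}^d p_iu^i$. A catastrophe is a step from an altitude $h>0$ with $-h\notin\mathcal J$ directly to altitude $0$; each catastrophe has weight $q>0$. A path of length $n$ starts at altitude $0$ and makes $n$ steps, each being either a jump $i\in\mathcal J$ (weight $p_i$, changing the altitude by $i$) or a catastrophe; its weight is the product of the weights of its steps. A meander (with catastrophes) is such a path never going below altitude $0$; an excursion is a meander ending at altitude $0$. Let $m_{n,k}$ be the total weight of meanders without any catastrophe of length $n$ ending at altitude $k$, $M(z,u)=\sum_{n,k\ge0}m_{n,k}z^nu^k$, $M_k(z)=[u^k]M(z,u)$, $M(z)=M(z,1)$, $E(z)=M_0(z)$. The kernel equation $1-zP(u)=0$ has $c$ solutions $u_1(z),\dots,u_c(z)$ with $u_i(z)\to0$ as $z\to0$ (small roots) and $d$ solutions $v_1(z),\dots,v_d(z)$ with $|v_i(z)|\to\infty$ as $z\to0$ (large roots).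
   Formalization: The factors 1/(v_j − v_l) in the formula for F_k are corrected to 1/(v_l − v_j): as printed it is false for even d (d=2, k=0 gives −1 instead of F_0(0)=1). Reals are any ordered field with decidable equality (excluded middle gives it for ℝ); roots are Puiseux series. -}

module Defs where

open import Level using (Level; _⊔_) renaming (suc to lsuc)
open import Algebra.Bundles using (CommutativeRing; RawRing)
open import Algebra.Definitions using (Invertible)
import Algebra.Definitions.RawSemiring as SemiringOps
open import Algebra.Morphism.Structures using (module RingMorphisms)
open import Data.Fin.Base as Fin using (Fin; toℕ; fromℕ)
import Data.Fin.Properties as Fin
open import Data.Integer.Base as ℤ using (ℤ; +_; -[1+_]; _⊖_)
import Data.Integer.Properties as ℤ
open import Data.List.Base
  using (List; []; _∷_; [_]; _++_; map; filter; foldr; allFin; applyUpTo; cartesianProductWith; last)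
import Data.List.Relation.Unary.All as List
open import Data.List.Relation.Unary.All using (All)
import Data.Maybe.Relation.Unary.All as Maybe
open import Data.Nat.Base as ℕ using (ℕ; zero; suc; _∸_; NonZero)
open import Data.Nat.Divisibility using (_∣?_; divides)
open import Data.Product.Base using (Σ-syntax; ∃-syntax; ∃; _×_; _,_; proj₁)
open import Data.Sum.Base using (_⊎_)
open import Data.Unit.Base using (⊤)
open import Data.Empty using (⊥)
open import Relation.Binary.Definitions using (Decidable)
open import Relation.Binary.PropositionalEquality using (_≡_; _≢_)
open import Relation.Binary.Structures using (IsTotalOrder)
open import Relation.Nullary using (¬_; Dec; yes; no; ¬?; _×-dec_; _→-dec_)

private variable
  a b ℓ ℓ₁ ℓ₂ ℓ₃ : Level

------------------------------------------------------------------------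
-- Fields

-- Equality is decidable, as it is classically for ℝ and ℂ; membership in
-- the jump set 𝒥 is decided with it.
record Field a ℓ : Set (lsuc (a ⊔ ℓ)) where
  field
    commutativeRing : CommutativeRing a ℓ
  open CommutativeRing commutativeRing public
  field
    _≟_        : Decidable _≈_
    1≉0        : ¬ 1# ≈ 0#
    invertible : ∀ x → ¬ x ≈ 0# → Invertible _≈_ 1# _*_ x

-- Intended instance: ℝ.  Completeness plays no role.
record OrderedField a ℓ₁ ℓ₂ : Set (lsuc (a ⊔ ℓ₁ ⊔ ℓ₂)) where
  infix 4 _≤_
  field
    isField : Field a ℓ₁
  open Field isField public
  field
    _≤_          : Carrier → Carrier → Set ℓ₂
    isTotalOrder : IsTotalOrder _≈_ _≤_
    +-monoˡ-≤    : ∀ z {x y} → x ≤ y → x + z ≤ y + z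
    *-nonneg     : ∀ {x y} → 0# ≤ x → 0# ≤ y → 0# ≤ x * y

-- Intended instance: ℂ over ℝ, whose Puiseux series contain all the roots
-- of the kernel.
record FieldExtension (R : OrderedField a ℓ₁ ℓ₂) b ℓ₃ : Set (a ⊔ ℓ₁ ⊔ lsuc (b ⊔ ℓ₃)) where
  private module R = OrderedField R
  field
    isField : Field b ℓ₃
  open Field isField public
  field
    embed          : R.Carrier → Carrier
    isHomomorphism : RingMorphisms.IsRingHomomorphism R.rawRing rawRing embed

------------------------------------------------------------------------
-- Formal series

module RingOps (A : RawRing a ℓ) where
  open RawRing A public
  open SemiringOps rawSemiring public using (sum; product; _^_)

  infixl 6 _-_
  _-_ : Carrier → Carrier → Carrier
  x - y = x + - y

  Unit : Carrier → Set (a ⊔ ℓ)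
  Unit = Invertible _≈_ 1# _*_

  infix 9 _⁻¹
  _⁻¹ : ∀ {x} → Unit x → Carrier
  _⁻¹ = proj₁

  -- Integer power of x, the second argument being the inverse of x.
  power : Carrier → Carrier → ℤ → Carrier
  power x x⁻¹ (+ n)    = x ^ n
  power x x⁻¹ -[1+ n ] = x⁻¹ ^ suc n

  ∏≢ : ∀ {n} (i : Fin n) → ((j : Fin n) → j ≢ i → Carrier) → Carrier
  ∏≢ i f = product λ j → factor j (j Fin.≟ i)
    where
    factor : ∀ j → Dec (j ≡ i) → Carrier
    factor j (yes _)  = 1#
    factor j (no j≢i) = f j j≢i

module _ (A : RawRing a ℓ) where
  open RingOps A

  constant : Carrier → ℕ → Carrier
  constant x zero    = x
  constant x (suc n) = 0#

  variable′ : ℕ → Carrier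
  variable′ 1 = 1#
  variable′ _ = 0#

  powerSeries : RawRing a ℓ
  powerSeries = record
    { Carrier = ℕ → Carrier
    ; _≈_     = λ f g → ∀ n → f n ≈ g n
    ; _+_     = λ f g n → f n + g n
    ; _*_     = λ f g n → sum {suc n} λ i → f (toℕ i) * g (n ∸ toℕ i)
    ; -_      = λ f n → - f n
    ; 0#      = λ _ → 0#
    ; 1#      = constant 1#
    }

  shift : ℕ → (ℕ → Carrier) → ℕ → Carrier
  shift zero    f n       = f n
  shift (suc m) f zero    = 0#
  shift (suc m) f (suc n) = shift m f n

infix 5 _/X^_

-- f /X^ m is the Laurent series X⁻ᵐ f(X); the representation is not unique,
-- f need not have a non-zero constant term.
record Laurent (A : Set a) : Set a where
  constructor _/X^_
  field
    numerator : ℕ → A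
    pole      : ℕ

module _ (A : RawRing a ℓ) where
  private
    module A = RawRing A
    open RawRing (powerSeries A)

  laurentSeries : RawRing a ℓ
  laurentSeries = record
    { Carrier = Laurent A.Carrier
    ; _≈_     = λ { (f /X^ m) (g /X^ n) → shift A n f ≈ shift A m g }
    ; _+_     = λ { (f /X^ m) (g /X^ n) → (shift A n f + shift A m g) /X^ (m ℕ.+ n) }
    ; _*_     = λ { (f /X^ m) (g /X^ n) → (f * g) /X^ (m ℕ.+ n) }
    ; -_      = λ { (f /X^ m) → (- f) /X^ m }
    ; 0#      = 0# /X^ 0
    ; 1#      = 1# /X^ 0
    }

  -- The series tends to 0, respectively to ∞ in absolute value, as X → 0.
  TendsTo0 TendsTo∞ : Laurent A.Carrier → Set ℓ
  TendsTo0 (f /X^ m) = ∀ i → i ℕ.≤ m → f i A.≈ A.0#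
  TendsTo∞ (f /X^ m) = ∃[ i ] i ℕ.< m × ¬ f i A.≈ A.0#

  -- f(z) as a series in t, where z = tᵉ.
  ramify : ℕ → (ℕ → A.Carrier) → (ℕ → A.Carrier)
  ramify e f n with e ∣? n
  ... | yes (divides m _) = f m
  ... | no  _             = A.0#

-- Algebraicity over the fraction field of A[z,u] of a series Σₖ Gₖ(z) uᵏ: a non-zero polynomial
-- with coefficients in A[z,u] annihilates it.
module _ (A : RawRing a ℓ) where
  private
    module A = RawRing A
    open RingOps (powerSeries (powerSeries A))

  IsPolynomial : Carrier → Set ℓ
  IsPolynomial G = ∃[ b ] ∀ k n → b ℕ.≤ k ⊎ b ℕ.≤ n → G k n A.≈ A.0#

  Algebraic : Carrier → Set (a ⊔ ℓ)
  Algebraic G =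
    ∃[ N ] Σ[ Φ ∈ (Fin (suc N) → Carrier) ]
      (∀ l → IsPolynomial (Φ l)) ×
      (∃[ l ] ¬ Φ l ≈ 0#) ×
      sum (λ l → Φ l * G ^ toℕ l) ≈ 0#

------------------------------------------------------------------------
-- Paths with catastrophes

record Weights (R : OrderedField a ℓ₁ ℓ₂) : Set (a ⊔ ℓ₁ ⊔ ℓ₂) where
  open OrderedField R
  field
    c d   : ℕ
    1≤c   : 1 ℕ.≤ c
    1≤d   : 1 ℕ.≤ d
    -- p i is the weight of the jump toℕ i - c.
    p     : Fin (suc (c ℕ.+ d)) → Carrier
    0≤p   : ∀ i → 0# ≤ p i
    p₋c≉0 : ¬ p Fin.zero ≈ 0#
    p-d≉0 : ¬ p (fromℕ (c ℕ.+ d)) ≈ 0#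
    q     : Carrier
    0≤q   : 0# ≤ q
    q≉0   : ¬ q ≈ 0#

  p-d : Carrier
  p-d = p (fromℕ (c ℕ.+ d))

  jumpSize : Fin (suc (c ℕ.+ d)) → ℤ
  jumpSize i = toℕ i ⊖ c

  _∈𝒥 : ℤ → Set ℓ₁
  j ∈𝒥 = ∃[ i ] jumpSize i ≡ j × ¬ p i ≈ 0#

  _∈𝒥? : ∀ j → Dec (j ∈𝒥)
  j ∈𝒥? = Fin.any? λ i → (jumpSize i ℤ.≟ j) ×-dec ¬? (p i ≟ 0#)

module Paths (R : OrderedField a ℓ₁ ℓ₂) (W : Weights R) where
  open OrderedField R
  open Weights W

  data Step : Set where
    jump        : Fin (suc (c ℕ.+ d)) → Step
    catastrophe : Step

  weight : Step → Carrier
  weight (jump i)    = p i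
  weight catastrophe = q

  target : Step → ℤ → ℤ
  target (jump i)    h = h ℤ.+ jumpSize i
  target catastrophe h = + 0

  Allowed : Step → ℤ → Set ℓ₁
  Allowed (jump i)    h = jumpSize i ∈𝒥
  Allowed catastrophe h = (+ 0 ℤ.< h) × ¬ (ℤ.- h) ∈𝒥

  allowed? : ∀ s h → Dec (Allowed s h)
  allowed? (jump i)    h = jumpSize i ∈𝒥?
  allowed? catastrophe h = (+ 0 ℤ.<? h) ×-dec ¬? ((ℤ.- h) ∈𝒥?)

  -- Meander k h w: w is a meander from altitude h to altitude k.
  data Meander (k : ℤ) : ℤ → List Step → Set ℓ₁ where
    []  : Meander k k []
    _∷_ : ∀ {h s w} → Allowed s h × + 0 ℤ.≤ target s h →
          Meander k (target s h) w → Meander k h (s ∷ w)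

  meander? : ∀ k h w → Dec (Meander k h w)
  meander? k h [] with k ℤ.≟ h
  ... | yes _≡_.refl = yes []
  ... | no k≢h       = no λ { [] → k≢h _≡_.refl }
  meander? k h (s ∷ w) with allowed? s h ×-dec (+ 0 ℤ.≤? target s h) | meander? k (target s h) w
  ... | yes x | yes y = yes (x ∷ y)
  ... | no ¬x | _     = no λ { (x ∷ _) → ¬x x }
  ... | yes _ | no ¬y = no λ { (_ ∷ y) → ¬y y }

  IsJump IsCatastrophe : Step → Set
  IsJump (jump _)           = ⊤
  IsJump catastrophe        = ⊥
  IsCatastrophe (jump _)    = ⊥
  IsCatastrophe catastrophe = ⊤

  isJump? : ∀ s → Dec (IsJump s)
  isJump? (jump _)    = yes _
  isJump? catastrophe = no λ ()

  isCatastrophe? : ∀ s → Dec (IsCatastrophe s)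
  isCatastrophe? (jump _)    = no λ ()
  isCatastrophe? catastrophe = yes _

  words : ℕ → List (List Step)
  words zero    = [] ∷ []
  words (suc n) = cartesianProductWith _∷_ (map jump (allFin _) ++ [ catastrophe ]) (words n)

  totalWeight : List (List Step) → Carrier
  totalWeight ws = foldr _+_ 0# (map (λ w → foldr _*_ 1# (map weight w)) ws)

  private
    module R  = RingOps rawRing
    module Rz = RingOps (powerSeries rawRing)

  -- Bivariate series are indexed by the exponent of u first, so that the
  -- coefficient of uᵏ is itself a series in z.
  F M : ℕ → ℕ → Carrier
  F k n = totalWeight (filter (meander? (+ k) (+ 0)) (words n))
  M k n = totalWeight (filter (λ w → meander? (+ k) (+ 0) w ×-dec List.all? isJump? w) (words n))

  -- M(z,1): a path of length n ends at altitude at most n d.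
  M₁ : ℕ → Carrier
  M₁ n = R.sum {suc (n ℕ.* d)} λ k → M (toℕ k) n

  E : ℕ → Carrier
  E = M 0

  -- Maybe.All makes the empty path qualify.
  D : ℕ → Carrier
  D n = totalWeight
    (filter (λ w → meander? (+ 0) (+ 0) w ×-dec Maybe.dec isCatastrophe? (last w)) (words n))

  Q : ℕ → Carrier
  Q = variable′ rawRing Rz.* constant rawRing q Rz.*
      (M₁ Rz.- E Rz.- foldr Rz._+_ Rz.0# (map M (filter (λ j → (ℤ.- + j) ∈𝒥?) (applyUpTo suc c))))

------------------------------------------------------------------------
-- The kernel

-- A finite family of Puiseux series in z has a common ramification index e,
-- so that it consists of Laurent series in t, where z = tᵉ.
module Kernel (R : OrderedField a ℓ₁ ℓ₂) (C : FieldExtension R b ℓ₃) (W : Weights R) (e : ℕ) where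
  private
    module R = OrderedField R
    module C = FieldExtension C
  open Weights W

  -- C((t)) and C((t))((u)).
  puiseux puiseux[u] : RawRing b ℓ₃
  puiseux    = laurentSeries C.rawRing
  puiseux[u] = laurentSeries puiseux

  private
    module L  = RingOps puiseux
    module Lu = RingOps puiseux[u]

  ι : (ℕ → R.Carrier) → L.Carrier
  ι f = ramify C.rawRing e (λ n → C.embed (f n)) /X^ 0

  ιᵤ : (ℕ → ℕ → R.Carrier) → Lu.Carrier
  ιᵤ G = (λ k → ι (G k)) /X^ 0

  scalar : R.Carrier → L.Carrier
  scalar x = ι (constant R.rawRing x)

  z : L.Carrier
  z = ι (variable′ R.rawRing)

  constᵤ : L.Carrier → Lu.Carrier
  constᵤ x = constant puiseux x /X^ 0

  u u⁻¹ : Lu.Carrier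
  u   = variable′ puiseux /X^ 0
  u⁻¹ = constant puiseux L.1# /X^ 1

  -- 1 - z P(w) at an element w of C((t)) with inverse w⁻¹, and at u.
  kernelAt : L.Carrier → L.Carrier → L.Carrier
  kernelAt w w⁻¹ = L.1# L.- z L.* L.sum λ i → scalar (p i) L.* L.power w w⁻¹ (jumpSize i)

  kernel : Lu.Carrier
  kernel = Lu.1# Lu.- constᵤ z Lu.* Lu.sum λ i → constᵤ (scalar (p i)) Lu.* Lu.power u u⁻¹ (jumpSize i)

  record IsKernelRoot (w : L.Carrier) : Set (b ⊔ ℓ₃) where
    field
      unit : L.Unit w
      root : kernelAt w (unit L.⁻¹) L.≈ L.0#

  record Roots : Set (b ⊔ ℓ₃) where
    field
      small          : Fin c → L.Carrier
      small-root     : ∀ i → IsKernelRoot (small i)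
      small-0        : ∀ i → TendsTo0 C.rawRing (small i)
      small-distinct : ∀ i j → small i L.≈ small j → i ≡ j
      large          : Fin d → L.Carrier
      large-root     : ∀ l → IsKernelRoot (large l)
      large-∞        : ∀ l → TendsTo∞ C.rawRing (large l)
      large-distinct : ∀ l j → large l L.≈ large j → l ≡ j

    large-power : Fin d → ℤ → L.Carrier
    large-power l = L.power (large l) (IsKernelRoot.unit (large-root l) L.⁻¹)

-- Cutting a path at its first catastrophe gives F = M + Q F and D = 1 + Q D, hence
-- F = D M and D (1 - Q) = 1.
--
-- Kernel method.  With K(u) = uᶜ (1 - z P(u)), removing the last jump shows that K M is
-- monic of degree c in u.  If w is a small root, the coefficient of uʲ in K M / (w - u) is
-- the truncation of (K M)(w) divided by wʲ⁺¹; since K / (w - u) is a polynomial, these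
-- coefficients have bounded poles, so (K M)(w) is divisible by every power of t and
-- vanishes.  Hence K M = ∏ (u - uᵢ), and M is the only series with bounded poles for which
-- K M is monic of degree c.  By Lagrange interpolation the partial fractions in the large
-- roots have both properties.
--
-- Algebraicity.  The elements z w, for w in a finite family of roots, generate a finite
-- algebra over A[z,u] in which, up to powers of z, F is a quotient; fraction-free
-- elimination on the rank + 1 monomials of degree rank in its numerator and denominator
-- gives the polynomial.  The same elimination makes a non-zero element x of such an
-- algebra invertible, because the lowest coefficient of a relation between the powers of
-- x is a multiple of x.  This inverts v_l - v_j, of which only v_l ≠ v_j is known, without
-- Markov's principle.

module Submission where

open import Defs
open import Algebra.Bundles using (CommutativeRing; RawRing)
import Algebra.Morphism.RingMonomorphism as RingMonomorphism
open import Algebra.Morphism.Structures using (IsRingMonomorphism; IsRingHomomorphism)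
import Algebra.Properties.CommutativeMonoid.Sum as CommutativeMonoidSum
import Algebra.Properties.CommutativeSemigroup as CommutativeSemigroupProperties
import Algebra.Properties.Ring as RingProperties
import Algebra.Properties.Semiring.Exp as Exp
import Algebra.Properties.Semiring.Mult as Mult
import Algebra.Properties.Semiring.Sum as Sum
import Algebra.Solver.Ring as RingSolver
import Algebra.Solver.Ring.AlmostCommutativeRing as ACR
open import Algebra.Structures using (IsCommutativeRing)
open import Data.Empty using (⊥-elim)
open import Data.Fin.Base as Fin using (Fin; toℕ; fromℕ; inject₁; punchIn; punchOut; combine; remQuot; _↑ˡ_; _↑ʳ_)
import Data.Fin.Properties as Fin
open import Data.Integer.Base as ℤ using (ℤ; +_; -[1+_]; _⊖_)
import Data.Integer.Properties as ℤ
open import Data.List.Base using (List; []; _∷_; [_]; _++_; map; filter; foldr; tabulate; applyUpTo; cartesianProductWith; last)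
import Data.List.Properties as List
open import Data.List.Relation.Unary.All as List using (All; []; _∷_)
open import Data.Maybe.Base using (Maybe; just; nothing)
import Data.Maybe.Relation.Unary.All as Maybe
import Data.Maybe.Relation.Unary.Any as MaybeAny
open import Data.Nat.Base as ℕ using (ℕ; zero; suc; _∸_; z≤n; s≤s; NonZero)
open import Data.Nat.Divisibility using (_∣_; _∣?_; divides; ∣m+n∣m⇒∣n; ∣-refl; ∣⇒≤)
import Data.Nat.Properties as ℕ
open import Data.Product.Base using (Σ-syntax; ∃-syntax; _×_; _,_; proj₁; proj₂)
open import Data.Sum.Base using (_⊎_; inj₁; inj₂)
open import Data.Unit.Base using (tt)
open import Data.Vec.Functional as Vector using (removeAt; insertAt)
import Data.Vec.Functional.Properties as Vector
open import Function.Base using (_∘_; id)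
open import Level using (_⊔_; Lift; lift) renaming (suc to lsuc)
import Relation.Binary.Reasoning.Setoid as SetoidReasoning
open import Relation.Binary.PropositionalEquality as ≡ using (_≡_; _≢_)
open import Relation.Nullary using (¬_; Dec; yes; no; ¬?; contradiction; _×-dec_)
open import Relation.Unary using (Pred; Decidable; _≐_)

-- Commutative rings, power series, Laurent series

-- Its substitute is tightness: a Laurent series that is not a unit is zero. Zero tests are made
-- only on coefficients and on polynomials, where the search is finite; every inverse in the
-- conclusion has to be constructed from a known non-zero coefficient or from an algebraic relation.
--
-- That F is a quotient of elements of one finite algebra is not immediate, since Q contains M(z,1),
-- which is not a coefficient of M. The last-jump equation at u = 1 expresses (1 - z P(1)) M(z,1)
-- through M_0, ..., M_(c-1), and these are solved successively from the coefficients of K M = ∏ (u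
-- - uᵢ), dividing only by z p₋c. The algebra must therefore be closed under taking coefficients in
-- u.
--
-- The factor z in z w and the prefactor 1 / (p_d z) have one origin: K has leading coefficient -p_d
-- z in u.

-- The coefficient (m , n) stands for m - n: the stdlib has no ring solver over an
-- abstract commutative ring that can cancel.
module RingTools {a ℓ} (R : CommutativeRing a ℓ) where
  open CommutativeRing R public
  open RingProperties ring public
  open Mult semiring using (×-homo-+; ×1-homo-*) renaming (_×_ to _·_)
  open Sum semiring public
  open Exp semiring public
  open CommutativeSemigroupProperties +-commutativeSemigroup public using ()
    renaming (interchange to +-interchange; x∙yz≈y∙xz to x+yz≈y+xz)
  open CommutativeSemigroupProperties *-commutativeSemigroup public using ()
    renaming (interchange to *-interchange; x∙yz≈y∙xz to x*yz≈y*xz)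
  open RingOps rawRing public using (product; Unit; _⁻¹; power; ∏≢)
  open SetoidReasoning setoid

  private
    ℤ-pairs : RawRing _ _
    ℤ-pairs = record
      { Carrier = ℕ × ℕ
      ; _≈_     = _≡_
      ; _+_     = λ { (m , n) (p , q) → m ℕ.+ p , n ℕ.+ q }
      ; _*_     = λ { (m , n) (p , q) → m ℕ.* p ℕ.+ n ℕ.* q , m ℕ.* q ℕ.+ n ℕ.* p }
      ; -_      = λ { (m , n) → n , m }
      ; 0#      = 0 , 0
      ; 1#      = 1 , 0
      }

    almostCommutativeRing = ACR.fromCommutativeRing R

    value ⟦_⟧ : ℕ × ℕ → Carrier
    value (m , n) = m · 1# - n · 1#

    -- The constants 0 and 1 must evaluate definitionally to 0# and 1#.
    ⟦ 0 , 0 ⟧ = 0#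
    ⟦ 1 , 0 ⟧ = 1#
    ⟦ x ⟧     = value x

    value-1 : 1# ≈ value (1 , 0)
    value-1 = sym (trans (+-congˡ -0#≈0#) (trans (+-identityʳ _) (+-identityʳ _)))

    ⟦⟧-value : ∀ x → ⟦ x ⟧ ≈ value x
    ⟦⟧-value (0 , 0)           = sym (-‿inverseʳ 0#)
    ⟦⟧-value (1 , 0)           = value-1
    ⟦⟧-value (0 , suc n)       = refl
    ⟦⟧-value (1 , suc n)       = refl
    ⟦⟧-value (suc (suc m) , n) = refl

    value-+ : ∀ x y → value (proj₁ x ℕ.+ proj₁ y , proj₂ x ℕ.+ proj₂ y) ≈ value x + value y
    value-+ (m , n) (p , q) = begin
      (m ℕ.+ p) · 1# - (n ℕ.+ q) · 1#
        ≈⟨ +-cong (×-homo-+ 1# m p) (-‿cong (×-homo-+ 1# n q)) ⟩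
      (m · 1# + p · 1#) - (n · 1# + q · 1#)
        ≈⟨ +-congˡ (-‿+-comm _ _) ⟨
      (m · 1# + p · 1#) + (- (n · 1#) + - (q · 1#))
        ≈⟨ +-interchange _ _ _ _ ⟩
      value (m , n) + value (p , q) ∎

    difference-* : ∀ u v x y → (u - v) * (x - y) ≈ (u * x + v * y) - (u * y + v * x)
    difference-* u v x y = begin
      (u - v) * (x - y)
        ≈⟨ x[y-z]≈xy-xz _ _ _ ⟩
      (u - v) * x - (u - v) * y
        ≈⟨ +-cong ([y-z]x≈yx-zx _ _ _) (-‿cong ([y-z]x≈yx-zx _ _ _)) ⟩
      (u * x - v * x) - (u * y - v * y)
        ≈⟨ +-congˡ (⁻¹-anti-homo-// _ _) ⟩
      (u * x - v * x) + (v * y - u * y)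
        ≈⟨ +-interchange _ _ _ _ ⟩
      (u * x + v * y) + (- (v * x) - u * y)
        ≈⟨ +-congˡ (trans (+-comm _ _) (-‿+-comm _ _)) ⟩
      (u * x + v * y) - (u * y + v * x) ∎

    value-* : ∀ x y → value (RawRing._*_ ℤ-pairs x y) ≈ value x * value y
    value-* (m , n) (p , q) = begin
      (m ℕ.* p ℕ.+ n ℕ.* q) · 1# - (m ℕ.* q ℕ.+ n ℕ.* p) · 1#
        ≈⟨ +-cong (homo m p n q) (-‿cong (homo m q n p)) ⟩
      (m · 1# * p · 1# + n · 1# * q · 1#) - (m · 1# * q · 1# + n · 1# * p · 1#)
        ≈⟨ difference-* _ _ _ _ ⟨
      value (m , n) * value (p , q) ∎
      where
      homo : ∀ m p n q → (m ℕ.* p ℕ.+ n ℕ.* q) · 1# ≈ m · 1# * p · 1# + n · 1# * q · 1#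
      homo m p n q = trans (×-homo-+ 1# (m ℕ.* p) (n ℕ.* q)) (+-cong (×1-homo-* m p) (×1-homo-* n q))

    homomorphism : ℤ-pairs ACR.-Raw-AlmostCommutative⟶ almostCommutativeRing
    homomorphism = record
      { ⟦_⟧    = ⟦_⟧
      ; +-homo = λ x y → trans (⟦⟧-value (x +ᵖ y)) (trans (value-+ x y) (sym (+-cong (⟦⟧-value x) (⟦⟧-value y))))
      ; *-homo = λ x y → trans (⟦⟧-value (x *ᵖ y)) (trans (value-* x y) (sym (*-cong (⟦⟧-value x) (⟦⟧-value y))))
      ; -‿homo = λ x → trans (⟦⟧-value (proj₂ x , proj₁ x)) (trans (sym (⁻¹-anti-homo-// _ _)) (-‿cong (sym (⟦⟧-value x))))
      ; 0-homo = refl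
      ; 1-homo = refl
      }
      where open RawRing ℤ-pairs renaming (_+_ to _+ᵖ_; _*_ to _*ᵖ_) using ()

    value-cong : ∀ m n p q → m ℕ.+ q ≡ p ℕ.+ n → value (m , n) ≈ value (p , q)
    value-cong m n p q m+q≡p+n = begin
      m · 1# - n · 1#
        ≈⟨ +-identityʳ _ ⟨
      (m · 1# - n · 1#) + 0#
        ≈⟨ +-congˡ (-‿inverseʳ (q · 1#)) ⟨
      (m · 1# - n · 1#) + (q · 1# - q · 1#)
        ≈⟨ +-interchange _ _ _ _ ⟩
      (m · 1# + q · 1#) + (- (n · 1#) - q · 1#)
        ≈⟨ +-cong (trans (sym (×-homo-+ 1# m q)) (trans (reflexive (≡.cong (_· 1#) m+q≡p+n))
             (×-homo-+ 1# p n))) (+-comm _ _) ⟩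
      (p · 1# + n · 1#) + (- (q · 1#) - n · 1#)
        ≈⟨ +-interchange _ _ _ _ ⟩
      (p · 1# - q · 1#) + (n · 1# - n · 1#)
        ≈⟨ +-congˡ (-‿inverseʳ (n · 1#)) ⟩
      (p · 1# - q · 1#) + 0#
        ≈⟨ +-identityʳ _ ⟩
      p · 1# - q · 1# ∎

    -- Pairs are not normalised, so the represented integers are compared by cross addition;
    -- syntactic equality would not recognise 1 - 1 as 0.
    coefficients≟ : ∀ x y → Maybe (⟦ x ⟧ ≈ ⟦ y ⟧)
    coefficients≟ x y with proj₁ x ℕ.+ proj₂ y ℕ.≟ proj₁ y ℕ.+ proj₂ x
    ... | no _  = nothing
    ... | yes p = just (trans (⟦⟧-value x) (trans (value-cong (proj₁ x) (proj₂ x) (proj₁ y) (proj₂ y) p)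
                        (sym (⟦⟧-value y))))

  open RingSolver ℤ-pairs almostCommutativeRing homomorphism coefficients≟ public
    using (solve; _:=_; _:+_; _:*_; _:-_; :-_; con; Polynomial)

  :0 :1 : ∀ {n} → Polynomial n
  :0 = con (0 , 0)
  :1 = con (1 , 0)

  module Product = CommutativeMonoidSum *-commutativeMonoid

  sum-cong : ∀ {n} {f g : Fin n → Carrier} → (∀ i → f i ≈ g i) → sum f ≈ sum g
  sum-cong = sum-cong-≋

  sum-0 : ∀ {n} {f : Fin n → Carrier} → (∀ i → f i ≈ 0#) → sum f ≈ 0#
  sum-0 {n} f≈0 = trans (sum-cong f≈0) (sum-replicate-zero n)

  sum-neg : ∀ {n} (f : Fin n → Carrier) → sum (λ i → - f i) ≈ - sum f
  sum-neg {zero}  f = sym -0#≈0#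
  sum-neg {suc n} f = trans (+-congˡ (sum-neg (f ∘ Fin.suc))) (-‿+-comm _ _)

  sum-last : ∀ n (f : ℕ → Carrier) →
    sum {suc n} (f ∘ toℕ) ≈ sum {n} (f ∘ toℕ) + f n
  sum-last zero    f = +-comm _ _
  sum-last (suc n) f = trans (+-congˡ (sum-last n (f ∘ suc))) (sym (+-assoc _ _ _))

  ^-distrib-* : ∀ x y n → (x * y) ^ n ≈ x ^ n * y ^ n
  ^-distrib-* x y zero    = sym (*-identityˡ 1#)
  ^-distrib-* x y (suc n) = trans (*-congˡ (^-distrib-* x y n)) (*-interchange _ _ _ _)

  1^n≈1 : ∀ n → 1# ^ n ≈ 1#
  1^n≈1 zero    = refl
  1^n≈1 (suc n) = trans (*-identityˡ _) (1^n≈1 n)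

  unit : ∀ {x} y → x * y ≈ 1# → Unit x
  unit y xy≈1 = y , trans (*-comm _ _) xy≈1 , xy≈1

  inverseˡ : ∀ {x} (u : Unit x) → u ⁻¹ * x ≈ 1#
  inverseˡ (_ , p , _) = p

  inverseʳ : ∀ {x} (u : Unit x) → x * u ⁻¹ ≈ 1#
  inverseʳ (_ , _ , p) = p

  Unit-cong : ∀ {x y} → x ≈ y → Unit x → Unit y
  Unit-cong x≈y u = unit (u ⁻¹) (trans (*-congʳ (sym x≈y)) (inverseʳ u))

  Unit-1 : Unit 1#
  Unit-1 = unit 1# (*-identityˡ 1#)

  Unit-* : ∀ {x y} → Unit x → Unit y → Unit (x * y)
  Unit-* u v = unit (u ⁻¹ * v ⁻¹)
    (trans (*-interchange _ _ _ _) (trans (*-cong (inverseʳ u) (inverseʳ v)) (*-identityˡ 1#)))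

  Unit-^ : ∀ {x} → Unit x → ∀ n → Unit (x ^ n)
  Unit-^ u zero    = Unit-1
  Unit-^ u (suc n) = Unit-* u (Unit-^ u n)

  Unit-neg : ∀ {x} → Unit x → Unit (- x)
  Unit-neg {x} u = unit (- u ⁻¹) (trans (solve 2 (λ x y → :- x :* :- y := x :* y) refl x (u ⁻¹)) (inverseʳ u))

  Unit-factorˡ : ∀ {x y} → Unit (x * y) → Unit x
  Unit-factorˡ u = unit _ (trans (sym (*-assoc _ _ _)) (inverseʳ u))

  Unit-factorʳ : ∀ {x y} → Unit (x * y) → Unit y
  Unit-factorʳ u = Unit-factorˡ (Unit-cong (*-comm _ _) u)

  Unit-cancel : ∀ {x} → Unit x → ∀ {y z} → x * y ≈ x * z → y ≈ z
  Unit-cancel {x} u {y} {z} xy≈xz = begin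
    y                ≈⟨ *-identityˡ y ⟨
    1# * y           ≈⟨ *-congʳ (inverseˡ u) ⟨
    u ⁻¹ * x * y     ≈⟨ *-assoc _ _ _ ⟩
    u ⁻¹ * (x * y)   ≈⟨ *-congˡ xy≈xz ⟩
    u ⁻¹ * (x * z)   ≈⟨ *-assoc _ _ _ ⟨
    u ⁻¹ * x * z     ≈⟨ *-congʳ (inverseˡ u) ⟩
    1# * z           ≈⟨ *-identityˡ z ⟩
    z ∎

  Unit-cancel-0 : ∀ {x} → Unit x → ∀ {y} → x * y ≈ 0# → y ≈ 0#
  Unit-cancel-0 {x} u xy≈0 = Unit-cancel u (trans xy≈0 (sym (zeroʳ x)))

  product-cong : ∀ {n} {f g : Fin n → Carrier} → (∀ i → f i ≈ g i) → product f ≈ product g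
  product-cong = Product.sum-cong-≋

  x-y≈0⇒x≈y : ∀ {x y} → x - y ≈ 0# → x ≈ y
  x-y≈0⇒x≈y = x∙y⁻¹≈ε⇒x≈y _ _

-- The ring of power series

module PowerSeries {a ℓ} (R : CommutativeRing a ℓ) where
  open RingTools R
  open SetoidReasoning setoid
  private
    raw = powerSeries rawRing
    module P = RawRing raw

  tail : (ℕ → Carrier) → ℕ → Carrier
  tail f n = f (suc n)

  private
    term : (f g : ℕ → Carrier) (n : ℕ) → Fin (suc n) → Carrier
    term f g n i = f (toℕ i) * g (n ∸ toℕ i)

    *-cong′ : ∀ {f g h k} → f P.≈ g → h P.≈ k → (f P.* h) P.≈ (g P.* k)
    *-cong′ p q n = sum-cong {suc n} λ i → *-cong (p (toℕ i)) (q (n ∸ toℕ i))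

    distribʳ′ : ∀ f g h → ((g P.+ h) P.* f) P.≈ ((g P.* f) P.+ (h P.* f))
    distribʳ′ f g h n = trans
      (sum-cong {suc n} λ i → distribʳ (f (n ∸ toℕ i)) (g (toℕ i)) (h (toℕ i)))
      (∑-distrib-+ {suc n} (term g f n) (term h f n))

    scale-* : ∀ x f g → ((λ n → x * f n) P.* g) P.≈ (λ n → x * (f P.* g) n)
    scale-* x f g n = trans
      (sum-cong {suc n} λ i → *-assoc x (f (toℕ i)) (g (n ∸ toℕ i)))
      (sym (*-distribˡ-sum {suc n} x (term f g n)))

    -- Peeling `f 0` off one side and `g 0` off the other leaves the product of the two tails, two
    -- degrees lower; hence the two base cases. This avoids reversing a finite sum.
    comm′ : ∀ f g n → (f P.* g) n ≈ (g P.* f) n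
    comm′ f g zero          = +-congʳ (*-comm _ _)
    comm′ f g (suc zero)    = solve 4 (λ a b c d → a :* d :+ (b :* c :+ :0) := c :* b :+ (d :* a :+ :0)) refl
      (f 0) (f 1) (g 0) (g 1)
    comm′ f g (suc (suc n)) = begin
      f 0 * g (suc (suc n)) + (tail f P.* g) (suc n)
        ≈⟨ +-congˡ (comm′ (tail f) g (suc n)) ⟩
      f 0 * g (suc (suc n)) + (g 0 * f (suc (suc n)) + (tail g P.* tail f) n)
        ≈⟨ x+yz≈y+xz _ _ _ ⟩
      g 0 * f (suc (suc n)) + (f 0 * g (suc (suc n)) + (tail g P.* tail f) n)
        ≈⟨ +-congˡ (+-congˡ (comm′ (tail g) (tail f) n)) ⟩
      g 0 * f (suc (suc n)) + (f P.* tail g) (suc n)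
        ≈⟨ +-congˡ (comm′ f (tail g) (suc n)) ⟩
      (g P.* f) (suc (suc n)) ∎

    -- Induction on the degree, through the identity tail (f * g) = f 0 · tail g + tail f * g, which
    -- holds by definition.
    assoc′ : ∀ f g h n → ((f P.* g) P.* h) n ≈ (f P.* (g P.* h)) n
    assoc′ f g h zero    = solve 3 (λ a b c → (a :* b :+ :0) :* c :+ :0 := a :* (b :* c :+ :0) :+ :0) refl
      (f 0) (g 0) (h 0)
    assoc′ f g h (suc n) = begin
      (f 0 * g 0 + 0#) * h (suc n) + (tail (f P.* g) P.* h) n
        ≈⟨ +-congˡ (distribʳ′ h (λ k → f 0 * g (suc k)) (tail f P.* g) n) ⟩
      (f 0 * g 0 + 0#) * h (suc n) + (((λ k → f 0 * tail g k) P.* h) n + ((tail f P.* g) P.* h) n)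
        ≈⟨ +-congˡ (+-cong (scale-* (f 0) (tail g) h n) (assoc′ (tail f) g h n)) ⟩
      (f 0 * g 0 + 0#) * h (suc n) + (f 0 * (tail g P.* h) n + (tail f P.* (g P.* h)) n)
        ≈⟨ solve 5 (λ a b c d e → (a :* b :+ :0) :* c :+ (a :* d :+ e) := a :* (b :* c :+ d) :+ e) refl
             (f 0) (g 0) (h (suc n)) _ _ ⟩
      (f P.* (g P.* h)) (suc n) ∎

    identityˡ′ : ∀ f n → (P.1# P.* f) n ≈ f n
    identityˡ′ f n = trans (+-cong (*-identityˡ _) (sum-0 {n} λ i → zeroˡ (f (n ∸ suc (toℕ i))))) (+-identityʳ _)

    isCommutativeRing′ : IsCommutativeRing P._≈_ P._+_ P._*_ P.-_ P.0# P.1#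
    isCommutativeRing′ = record
      { isRing = record
        { +-isAbelianGroup = record
          { isGroup = record
            { isMonoid = record
              { isSemigroup = record
                { isMagma = record
                  { isEquivalence = record
                    { refl  = λ n → refl
                    ; sym   = λ p n → sym (p n)
                    ; trans = λ p q n → trans (p n) (q n)
                    }
                  ; ∙-cong = λ p q n → +-cong (p n) (q n)
                  }
                ; assoc = λ f g h n → +-assoc _ _ _
                }
              ; identity = (λ f n → +-identityˡ _) , (λ f n → +-identityʳ _)
              }
            ; inverse = (λ f n → -‿inverseˡ _) , (λ f n → -‿inverseʳ _)
            ; ⁻¹-cong = λ p n → -‿cong (p n)
            }
          ; comm = λ f g n → +-comm _ _
          }
        ; *-cong     = *-cong′
        ; *-assoc    = assoc′
        ; *-identity = identityˡ′ , λ f n → trans (comm′ f P.1# n) (identityˡ′ f n)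
        ; distrib    = (λ f g h n → trans (comm′ f (g P.+ h) n) (trans (distribʳ′ f g h n) (+-cong (comm′ g f n) (comm′ h f n))))
                     , distribʳ′
        }
      ; *-comm = comm′
      }

  powerSeriesRing : CommutativeRing a ℓ
  powerSeriesRing = record { isCommutativeRing = isCommutativeRing′ }

  private module PT = RingTools powerSeriesRing

  constant-* : ∀ x f n → (constant rawRing x P.* f) n ≈ x * f n
  constant-* x f n = trans (+-congˡ (sum-0 {n} λ i → zeroˡ (f (n ∸ suc (toℕ i))))) (+-identityʳ _)

  constant-homo-* : ∀ x y → constant rawRing (x * y) P.≈ (constant rawRing x P.* constant rawRing y)
  constant-homo-* x y zero    = sym (+-identityʳ _)
  constant-homo-* x y (suc n) = sym (trans (constant-* x (constant rawRing y) (suc n)) (zeroʳ x))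

  constant-cong : ∀ {x y} → x ≈ y → constant rawRing x P.≈ constant rawRing y
  constant-cong x≈y zero    = x≈y
  constant-cong x≈y (suc n) = refl

  constant-homo-+ : ∀ x y → constant rawRing (x + y) P.≈ (constant rawRing x P.+ constant rawRing y)
  constant-homo-+ x y zero    = refl
  constant-homo-+ x y (suc n) = sym (+-identityʳ _)

  sum-coefficient : ∀ {m} (f : Fin m → ℕ → Carrier) n → PT.sum f n ≈ sum (λ i → f i n)
  sum-coefficient {zero}  f n = refl
  sum-coefficient {suc m} f n = +-congˡ (sum-coefficient (f ∘ Fin.suc) n)

  *-cong-≤ : ∀ f {g h} n → (∀ i → i ℕ.≤ n → g i ≈ h i) → (f P.* g) n ≈ (f P.* h) n
  *-cong-≤ f n g≈h = sum-cong {suc n} λ i → *-congˡ {f (toℕ i)} (g≈h _ (ℕ.m∸n≤m n (toℕ i)))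

  -- approx k agrees with the inverse of f below degree k.
  private
    module _ (f : ℕ → Carrier) (b : Carrier) where
      approx : ℕ → ℕ → Carrier
      approx zero    n       = 0#
      approx (suc k) zero    = b
      approx (suc k) (suc n) = - (b * (tail f P.* approx k) n)

      approx-stable : ∀ k l {n} → n ℕ.< k → n ℕ.< l → approx k n ≈ approx l n
      approx-stable (suc k) (suc l) {zero}  _         _         = refl
      approx-stable (suc k) (suc l) {suc n} (s≤s n<k) (s≤s n<l) = -‿cong (*-congˡ (*-cong-≤ (tail f) n
        λ i i≤n → approx-stable k l (ℕ.≤-<-trans i≤n n<k) (ℕ.≤-<-trans i≤n n<l)))

  powerSeries-unit : ∀ {f} → Unit (f 0) → PT.Unit f
  powerSeries-unit {f} u = PT.unit inv proof
    where
    b = u ⁻¹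
    inv : ℕ → Carrier
    -- Each coefficient depends on all earlier ones, so `approx` recurses on fuel; by
    -- `approx-stable` any fuel above the degree gives the same value.
    inv n = approx f b (suc n) n
    proof : (f P.* inv) P.≈ P.1#
    proof zero    = trans (+-identityʳ _) (inverseʳ u)
    proof (suc n) = begin
      f 0 * - (b * (tail f P.* approx f b (suc n)) n) + (tail f P.* inv) n
        ≈⟨ +-congˡ (*-cong-≤ (tail f) n λ i i≤n → approx-stable f b (suc i) (suc n) (ℕ.n<1+n i) (s≤s i≤n)) ⟩
      f 0 * - (b * y) + y
        ≈⟨ solve 3 (λ a b y → a :* :- (b :* y) :+ y := (:1 :- a :* b) :* y) refl (f 0) b y ⟩
      (1# - f 0 * b) * y
        ≈⟨ *-congʳ (x≈y⇒x∙y⁻¹≈ε (sym (inverseʳ u))) ⟩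
      0# * y
        ≈⟨ zeroˡ y ⟩
      0# ∎
      where y = (tail f P.* approx f b (suc n)) n

  X : ℕ → Carrier
  X = variable′ rawRing

  _↑_ : (ℕ → Carrier) → ℕ → ℕ → Carrier
  f ↑ m = shift rawRing m f

  ↑-cong : ∀ m {f g} → f P.≈ g → (f ↑ m) P.≈ (g ↑ m)
  ↑-cong zero    p n       = p n
  ↑-cong (suc m) p zero    = refl
  ↑-cong (suc m) p (suc n) = ↑-cong m p n

  ↑-injective : ∀ m {f g} → (f ↑ m) P.≈ (g ↑ m) → f P.≈ g
  ↑-injective zero    p = p
  ↑-injective (suc m) p = ↑-injective m (p ∘ suc)

  X* : ∀ f → (X P.* f) P.≈ (f ↑ 1)
  X* f zero    = trans (+-identityʳ _) (zeroˡ _)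
  X* f (suc n) = trans (+-cong (zeroˡ _) (trans
    (*-cong′ {tail X} {P.1#} {f} {f} tail-X (λ _ → refl) n) (identityˡ′ f n))) (+-identityˡ _)
    where
    tail-X : tail X P.≈ P.1#
    tail-X zero    = refl
    tail-X (suc n) = refl

  ↑≈X^* : ∀ m f → (f ↑ m) P.≈ ((X PT.^ m) P.* f)
  ↑≈X^* zero    f = PT.sym (PT.*-identityˡ f)
  ↑≈X^* (suc m) f = PT.trans step (PT.trans (PT.sym (X* _)) (PT.sym (PT.*-assoc X (X PT.^ m) f)))
    where
    step : (f ↑ suc m) P.≈ (((X PT.^ m) P.* f) ↑ 1)
    step zero    = refl
    step (suc n) = ↑≈X^* m f n

  X^-cancel : ∀ m {f g} → ((X PT.^ m) P.* f) P.≈ ((X PT.^ m) P.* g) → f P.≈ g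
  X^-cancel m {f} {g} p = ↑-injective m (PT.trans (↑≈X^* m f) (PT.trans p (PT.sym (↑≈X^* m g))))

  ↑-< : ∀ m f {n} → n ℕ.< m → (f ↑ m) n ≈ 0#
  ↑-< (suc m) f {zero}  _         = refl
  ↑-< (suc m) f {suc n} (s≤s n<m) = ↑-< m f n<m

  ↑-+ : ∀ m f n → (f ↑ m) (m ℕ.+ n) ≡ f n
  ↑-+ zero    f n = ≡.refl
  ↑-+ (suc m) f n = ↑-+ m f n

  monomial : ℕ → ℕ → Carrier
  monomial m = P.1# ↑ m

  monomial-≡ : ∀ m → monomial m m ≈ 1#
  monomial-≡ zero    = refl
  monomial-≡ (suc m) = monomial-≡ m

  monomial-≢ : ∀ m n → m ≢ n → monomial m n ≈ 0#
  monomial-≢ zero    zero    m≢n = contradiction ≡.refl m≢n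
  monomial-≢ zero    (suc n) m≢n = refl
  monomial-≢ (suc m) zero    m≢n = refl
  monomial-≢ (suc m) (suc n) m≢n = monomial-≢ m n (m≢n ∘ ≡.cong suc)

  X^≈monomial : ∀ m → (X PT.^ m) P.≈ monomial m
  X^≈monomial m = PT.trans (PT.sym (PT.*-identityʳ (X PT.^ m))) (PT.sym (↑≈X^* m P.1#))

  leading : ∀ m f → (∀ i → i ℕ.< m → f i ≈ 0#) → f P.≈ ((λ i → f (m ℕ.+ i)) ↑ m)
  leading zero    f p n       = refl
  leading (suc m) f p zero    = p 0 (s≤s z≤n)
  leading (suc m) f p (suc n) = leading m (tail f) (λ i i<m → p (suc i) (s≤s i<m)) n

-- Fractions f / Xᵐ over an abstract ring; _↑ m is multiplication by Xᵐ.
module Fractions {a ℓ} (S : CommutativeRing a ℓ) where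
  open RingTools S
  open SetoidReasoning setoid

  module Localisation (X : Carrier) (_↑_ : Carrier → ℕ → Carrier)
    (↑≈X^* : ∀ m f → f ↑ m ≈ X ^ m * f)
    (X^-cancel : ∀ m {f g} → X ^ m * f ≈ X ^ m * g → f ≈ g) where

    fractions : RawRing a ℓ
    fractions = record
      { Carrier = Carrier × ℕ
      ; _≈_     = λ { (f , m) (g , n) → f ↑ n ≈ g ↑ m }
      ; _+_     = λ { (f , m) (g , n) → (f ↑ n) + (g ↑ m) , m ℕ.+ n }
      ; _*_     = λ { (f , m) (g , n) → f * g , m ℕ.+ n }
      ; -_      = λ { (f , m) → - f , m }
      ; 0#      = 0# , 0
      ; 1#      = 1# , 0
      }
    private module L = RawRing fractions

    X^_ : ℕ → Carrier
    X^ m = X ^ m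

    X^-+ : ∀ m n → X^ (m ℕ.+ n) ≈ X^ m * X^ n
    X^-+ = ^-homo-* X

    cross : ∀ {f m g n} → X^ n * f ≈ X^ m * g → (f , m) L.≈ (g , n)
    cross {f} {m} {g} {n} p = trans (↑≈X^* n f) (trans p (sym (↑≈X^* m g)))

    cross⁻¹ : ∀ {f m g n} → (f , m) L.≈ (g , n) → X^ n * f ≈ X^ m * g
    cross⁻¹ {f} {m} {g} {n} p = trans (sym (↑≈X^* n f)) (trans p (↑≈X^* m g))

    sum-numerator : ∀ f m g n → (f ↑ n) + (g ↑ m) ≈ X^ n * f + X^ m * g
    sum-numerator f m g n = +-cong (↑≈X^* n f) (↑≈X^* m g)

    cross-+ : ∀ f m g n {h k} → X^ k * (X^ n * f + X^ m * g) ≈ X^ m * X^ n * h →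
      ((f , m) L.+ (g , n)) L.≈ (h , k)
    cross-+ f m g n {h} {k} p = cross {(f ↑ n) + (g ↑ m)} {m ℕ.+ n} {h} {k} (begin
      X^ k * ((f ↑ n) + (g ↑ m)) ≈⟨ *-congˡ (sum-numerator f m g n) ⟩
      X^ k * (X^ n * f + X^ m * g)   ≈⟨ p ⟩
      X^ m * X^ n * h                ≈⟨ *-congʳ (X^-+ m n) ⟨
      X^ (m ℕ.+ n) * h ∎)

    L-refl : ∀ {x} → x L.≈ x
    L-refl {f , m} = refl

    L-sym : ∀ {x y} → x L.≈ y → y L.≈ x
    L-sym {f , m} {g , n} p = sym p

    -- The cross-multiplied equations are combined up to the middle denominator, which is then
    -- cancelled: here X has to be a non-zero-divisor.
    L-trans : ∀ {x y z} → x L.≈ y → y L.≈ z → x L.≈ z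
    L-trans {f , m} {g , n} {h , k} p q = cross {f} {m} {h} {k} (X^-cancel n (begin
      X^ n * (X^ k * f) ≈⟨ x*yz≈y*xz _ _ _ ⟩
      X^ k * (X^ n * f) ≈⟨ *-congˡ (cross⁻¹ {f} {m} {g} {n} p) ⟩
      X^ k * (X^ m * g) ≈⟨ x*yz≈y*xz _ _ _ ⟩
      X^ m * (X^ k * g) ≈⟨ *-congˡ (cross⁻¹ {g} {n} {h} {k} q) ⟩
      X^ m * (X^ n * h) ≈⟨ x*yz≈y*xz _ _ _ ⟩
      X^ n * (X^ m * h) ∎))

    +-cong′ : ∀ {x y z w} → x L.≈ y → z L.≈ w → (x L.+ z) L.≈ (y L.+ w)
    +-cong′ {f , m} {f′ , m′} {g , n} {g′ , n′} p q =
      cross-+ f m g n {(f′ ↑ n′) + (g′ ↑ m′)} {m′ ℕ.+ n′} (begin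
        X^ (m′ ℕ.+ n′) * (X^ n * f + X^ m * g)
          ≈⟨ *-congʳ (X^-+ m′ n′) ⟩
        X^ m′ * X^ n′ * (X^ n * f + X^ m * g)
          ≈⟨ solve 6 (λ a b c d f g → a :* b :* (d :* f :+ c :* g) := b :* d :* (a :* f) :+ a :* c :* (b :* g)) refl
               (X^ m′) (X^ n′) (X^ m) (X^ n) f g ⟩
        X^ n′ * X^ n * (X^ m′ * f) + X^ m′ * X^ m * (X^ n′ * g)
          ≈⟨ +-cong (*-congˡ (cross⁻¹ {f} {m} {f′} {m′} p)) (*-congˡ (cross⁻¹ {g} {n} {g′} {n′} q)) ⟩
        X^ n′ * X^ n * (X^ m * f′) + X^ m′ * X^ m * (X^ n * g′)
          ≈⟨ solve 6 (λ a b c d f g → b :* d :* (c :* f) :+ a :* c :* (d :* g) := c :* d :* (b :* f :+ a :* g)) refl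
               (X^ m′) (X^ n′) (X^ m) (X^ n) f′ g′ ⟩
        X^ m * X^ n * (X^ n′ * f′ + X^ m′ * g′)
          ≈⟨ *-congˡ (sum-numerator f′ m′ g′ n′) ⟨
        X^ m * X^ n * ((f′ ↑ n′) + (g′ ↑ m′)) ∎)

    *-cong′ : ∀ {x y z w} → x L.≈ y → z L.≈ w → (x L.* z) L.≈ (y L.* w)
    *-cong′ {f , m} {f′ , m′} {g , n} {g′ , n′} p q =
      cross {f * g} {m ℕ.+ n} {f′ * g′} {m′ ℕ.+ n′} (begin
        X^ (m′ ℕ.+ n′) * (f * g)      ≈⟨ *-congʳ (X^-+ m′ n′) ⟩
        X^ m′ * X^ n′ * (f * g)       ≈⟨ *-interchange _ _ _ _ ⟩
        X^ m′ * f * (X^ n′ * g)       ≈⟨ *-cong (cross⁻¹ {f} {m} {f′} {m′} p) (cross⁻¹ {g} {n} {g′} {n′} q) ⟩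
        X^ m * f′ * (X^ n * g′)       ≈⟨ *-interchange _ _ _ _ ⟩
        X^ m * X^ n * (f′ * g′)       ≈⟨ *-congʳ (X^-+ m n) ⟨
        X^ (m ℕ.+ n) * (f′ * g′) ∎)

    -‿cong′ : ∀ {x y} → x L.≈ y → (L.- x) L.≈ (L.- y)
    -‿cong′ {f , m} {g , n} p = cross { - f} {m} { - g} {n} (begin
      X^ n * - f   ≈⟨ -‿distribʳ-* _ _ ⟨
      - (X^ n * f) ≈⟨ -‿cong (cross⁻¹ {f} {m} {g} {n} p) ⟩
      - (X^ m * g) ≈⟨ -‿distribʳ-* _ _ ⟩
      X^ m * - g ∎)

    assoc-+ : ∀ x y z → ((x L.+ y) L.+ z) L.≈ (x L.+ (y L.+ z))
    assoc-+ (f , m) (g , n) (h , k) = cross-+ ((f ↑ n) + (g ↑ m)) (m ℕ.+ n) h k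
      {(f ↑ (n ℕ.+ k)) + (((g ↑ k) + (h ↑ n)) ↑ m)} {m ℕ.+ (n ℕ.+ k)} (begin
      X^ (m ℕ.+ (n ℕ.+ k)) * (X^ k * ((f ↑ n) + (g ↑ m)) + X^ (m ℕ.+ n) * h)
        ≈⟨ *-cong (trans (X^-+ m (n ℕ.+ k)) (*-congˡ (X^-+ n k)))
             (+-cong (*-congˡ (sum-numerator f m g n)) (*-congʳ (X^-+ m n))) ⟩
      X^ m * (X^ n * X^ k) * (X^ k * (X^ n * f + X^ m * g) + X^ m * X^ n * h)
        ≈⟨ solve 6 (λ a b c f g h → a :* (b :* c) :* (c :* (b :* f :+ a :* g) :+ a :* b :* h) :=
             a :* b :* c :* (b :* c :* f :+ a :* (c :* g :+ b :* h))) refl (X^ m) (X^ n) (X^ k) f g h ⟩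
      X^ m * X^ n * X^ k * (X^ n * X^ k * f + X^ m * (X^ k * g + X^ n * h))
        ≈⟨ *-cong (*-congʳ (X^-+ m n)) (+-cong (*-congʳ (X^-+ n k)) (*-congˡ (sum-numerator g n h k))) ⟨
      X^ (m ℕ.+ n) * X^ k * (X^ (n ℕ.+ k) * f + X^ m * ((g ↑ k) + (h ↑ n)))
        ≈⟨ *-congˡ (sum-numerator f m ((g ↑ k) + (h ↑ n)) (n ℕ.+ k)) ⟨
      X^ (m ℕ.+ n) * X^ k * ((f ↑ (n ℕ.+ k)) + (((g ↑ k) + (h ↑ n)) ↑ m)) ∎)

    comm-+ : ∀ x y → (x L.+ y) L.≈ (y L.+ x)
    comm-+ (f , m) (g , n) = cross-+ f m g n {(g ↑ m) + (f ↑ n)} {n ℕ.+ m} (begin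
      X^ (n ℕ.+ m) * (X^ n * f + X^ m * g)
        ≈⟨ *-cong (trans (X^-+ n m) (*-comm _ _)) (+-comm _ _) ⟩
      X^ m * X^ n * (X^ m * g + X^ n * f)
        ≈⟨ *-congˡ (sum-numerator g n f m) ⟨
      X^ m * X^ n * ((g ↑ m) + (f ↑ n)) ∎)

    identity-+ : ∀ x → (L.0# L.+ x) L.≈ x
    identity-+ (f , m) = cross-+ 0# 0 f m {f} {m}
      (solve 2 (λ a f → a :* (a :* :0 :+ :1 :* f) := :1 :* a :* f) refl (X^ m) f)

    inverse-+ : ∀ x → ((L.- x) L.+ x) L.≈ L.0#
    inverse-+ (f , m) = cross-+ (- f) m f m {0#} {0}
      (solve 2 (λ a f → :1 :* (a :* :- f :+ a :* f) := a :* a :* :0) refl (X^ m) f)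

    assoc-* : ∀ x y z → ((x L.* y) L.* z) L.≈ (x L.* (y L.* z))
    assoc-* (f , m) (g , n) (h , k) = cross {f * g * h} {m ℕ.+ n ℕ.+ k} {f * (g * h)} {m ℕ.+ (n ℕ.+ k)}
      (*-cong (reflexive (≡.cong X^_ (≡.sym (ℕ.+-assoc m n k)))) (*-assoc f g h))

    comm-* : ∀ x y → (x L.* y) L.≈ (y L.* x)
    comm-* (f , m) (g , n) = cross {f * g} {m ℕ.+ n} {g * f} {n ℕ.+ m}
      (*-cong (reflexive (≡.cong X^_ (ℕ.+-comm n m))) (*-comm f g))

    identity-* : ∀ x → (L.1# L.* x) L.≈ x
    identity-* (f , m) = cross {1# * f} {m} {f} {m} (*-congˡ (*-identityˡ f))

    distribʳ-* : ∀ x y z → ((y L.+ z) L.* x) L.≈ ((y L.* x) L.+ (z L.* x))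
    distribʳ-* (f , m) (g , n) (h , k) =
      L-sym {((g , n) L.* (f , m)) L.+ ((h , k) L.* (f , m))} {((g , n) L.+ (h , k)) L.* (f , m)}
      (cross-+ (g * f) (n ℕ.+ m) (h * f) (k ℕ.+ m) {((g ↑ k) + (h ↑ n)) * f} {n ℕ.+ k ℕ.+ m} (begin
        X^ (n ℕ.+ k ℕ.+ m) * (X^ (k ℕ.+ m) * (g * f) + X^ (n ℕ.+ m) * (h * f))
          ≈⟨ *-cong (trans (X^-+ (n ℕ.+ k) m) (*-congʳ (X^-+ n k))) (+-cong (*-congʳ (X^-+ k m)) (*-congʳ (X^-+ n m))) ⟩
        X^ n * X^ k * X^ m * (X^ k * X^ m * (g * f) + X^ n * X^ m * (h * f))
          ≈⟨ solve 6 (λ a b c f g h → b :* c :* a :* (c :* a :* (g :* f) :+ b :* a :* (h :* f)) :=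
               b :* a :* (c :* a) :* ((c :* g :+ b :* h) :* f)) refl (X^ m) (X^ n) (X^ k) f g h ⟩
        X^ n * X^ m * (X^ k * X^ m) * ((X^ k * g + X^ n * h) * f)
          ≈⟨ *-cong (*-cong (X^-+ n m) (X^-+ k m)) (*-congʳ (sum-numerator g n h k)) ⟨
        X^ (n ℕ.+ m) * X^ (k ℕ.+ m) * (((g ↑ k) + (h ↑ n)) * f) ∎))

    fractions-isCommutativeRing : IsCommutativeRing L._≈_ L._+_ L._*_ L.-_ L.0# L.1#
    fractions-isCommutativeRing = record
      { isRing = record
        { +-isAbelianGroup = record
          { isGroup = record
            { isMonoid = record
              { isSemigroup = record
                { isMagma = record
                  { isEquivalence = record
                    { refl  = λ {x} → L-refl {x}
                    ; sym   = λ {x} {y} → L-sym {x} {y}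
                    ; trans = λ {x} {y} {z} → L-trans {x} {y} {z}
                    }
                  ; ∙-cong = λ {x} {y} {z} {w} → +-cong′ {x} {y} {z} {w}
                  }
                ; assoc = assoc-+
                }
              ; identity = identity-+ , λ x → L-trans {x L.+ L.0#} {L.0# L.+ x} {x} (comm-+ x L.0#) (identity-+ x)
              }
            ; inverse = inverse-+ , λ x → L-trans {x L.+ (L.- x)} {(L.- x) L.+ x} {L.0#} (comm-+ x (L.- x)) (inverse-+ x)
            ; ⁻¹-cong = λ {x} {y} → -‿cong′ {x} {y}
            }
          ; comm = comm-+
          }
        ; *-cong     = λ {x} {y} {z} {w} → *-cong′ {x} {y} {z} {w}
        ; *-assoc    = assoc-*
        ; *-identity = identity-* , λ x → L-trans {x L.* L.1#} {L.1# L.* x} {x} (comm-* x L.1#) (identity-* x)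
        ; distrib    = (λ x y z → L-trans {x L.* (y L.+ z)} {(y L.+ z) L.* x} {(x L.* y) L.+ (x L.* z)}
                           (comm-* x (y L.+ z))
                           (L-trans {(y L.+ z) L.* x} {(y L.* x) L.+ (z L.* x)} {(x L.* y) L.+ (x L.* z)}
                             (distribʳ-* x y z)
                             (+-cong′ {y L.* x} {x L.* y} {z L.* x} {x L.* z} (comm-* y x) (comm-* z x))))
                     , distribʳ-*
        }
      ; *-comm = comm-*
      }


    fractionRing : CommutativeRing a ℓ
    fractionRing = record { isCommutativeRing = fractions-isCommutativeRing }

-- Laurent series as fractions

module LaurentSeries {a ℓ} (R : CommutativeRing a ℓ) where
  private
    module P = PowerSeries R
    module S = CommutativeRing P.powerSeriesRing
    module T = RingTools P.powerSeriesRing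
    raw = laurentSeries (CommutativeRing.rawRing R)
    open RawRing raw
    open Laurent

    X^-cancel : ∀ m {f g} → (P.X T.^ m) S.* f S.≈ (P.X T.^ m) S.* g → f S.≈ g
    X^-cancel m {f} {g} = P.X^-cancel m {f} {g}

    module F = Fractions.Localisation P.powerSeriesRing P.X P._↑_ P.↑≈X^* X^-cancel
    module FR = CommutativeRing F.fractionRing

    -- `Laurent` and the pairs of `Localisation` carry the same operations up to definitional
    -- equality, so the ring laws are transported along this renaming.
    toFraction : Carrier → FR.Carrier
    toFraction x = numerator x , pole x

    toFraction-monomorphism : IsRingMonomorphism raw FR.rawRing toFraction
    toFraction-monomorphism = record
      { isRingHomomorphism = record
        { isSemiringHomomorphism = record
          { isNearSemiringHomomorphism = record
            { +-isMonoidHomomorphism = record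
              { isMagmaHomomorphism = record
                { isRelHomomorphism = record { cong = id }
                ; homo = λ x y → FR.refl {toFraction (x + y)}
                }
              ; ε-homo = FR.refl {FR.0#}
              }
            ; *-homo = λ x y → FR.refl {toFraction (x * y)}
            }
          ; 1#-homo = FR.refl {FR.1#}
          }
        ; -‿homo = λ x → FR.refl {toFraction (- x)}
        }
      ; injective = id
      }

  laurentRing : CommutativeRing a ℓ
  laurentRing = record { isCommutativeRing =
    RingMonomorphism.isCommutativeRing toFraction-monomorphism FR.isCommutativeRing }

-- Polynomials over a tight ring

module Polynomials {a ℓ} (L : CommutativeRing a ℓ) where
  open RingTools L
  open SetoidReasoning setoid
  module P = PowerSeries L
  module PR = RingTools P.powerSeriesRing

  Series : Set a
  Series = ℕ → Carrier

  const : Carrier → Series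
  const = constant rawRing

  DegreeBelow : ℕ → Series → Set ℓ
  DegreeBelow n f = ∀ i → n ℕ.≤ i → f i ≈ 0#

  -- geometric v = 1 / (w - u) when v is the inverse of w.
  geometric : Carrier → Series
  geometric v k = v ^ suc k

  linear : Carrier → Series
  linear w = P.X PR.- const w

  linear-*-0 : ∀ w g → (linear w PR.* g) 0 ≈ - (w * g 0)
  linear-*-0 w g = solve 2 (λ w x → (:0 :- w) :* x :+ :0 := :- (w :* x)) refl w (g 0)

  linear-*-suc : ∀ w g i → (linear w PR.* g) (suc i) ≈ g i - w * g (suc i)
  linear-*-suc w g i = begin
    (linear w PR.* g) (suc i)
      ≈⟨ PR.[y-z]x≈yx-zx g P.X (const w) (suc i) ⟩
    (P.X PR.* g) (suc i) - (const w PR.* g) (suc i)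
      ≈⟨ +-cong (P.X* g (suc i)) (-‿cong (P.constant-* w g (suc i))) ⟩
    g i - w * g (suc i) ∎

  module _ {w v} (wv≈1 : w * v ≈ 1#) where

    linear-*-geometric : linear w PR.* geometric v PR.≈ PR.- PR.1#
    linear-*-geometric zero    = trans (linear-*-0 w (geometric v))
      (-‿cong (trans (*-congˡ (*-identityʳ v)) wv≈1))
    linear-*-geometric (suc i) = begin
      (linear w PR.* geometric v) (suc i)   ≈⟨ linear-*-suc w (geometric v) i ⟩
      v ^ suc i - w * (v * v ^ suc i)       ≈⟨ solve 3 (λ x w v → x :- w :* (v :* x) := (:1 :- w :* v) :* x) refl (v ^ suc i) w v ⟩
      (1# - w * v) * v ^ suc i              ≈⟨ *-congʳ (x≈y⇒x∙y⁻¹≈ε (sym wv≈1)) ⟩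
      0# * v ^ suc i                        ≈⟨ zeroˡ _ ⟩
      0#                                    ≈⟨ -0#≈0# ⟨
      - 0# ∎

    module _ (f : Series) where
      private
        q : Series
        q = f PR.* geometric v

      -- Among power series division by u - w is always exact, w being invertible. A zero of f at w
      -- only decides whether the quotient of a polynomial is again one; see `quotient-degree`.
      quotient : f PR.≈ linear w PR.* (PR.- q)
      quotient = PR.sym (PR.trans
        (PR.solve 3 (λ l f g → l PR.:* (PR.:- (f PR.:* g)) PR.:= PR.:- (f PR.:* (l PR.:* g))) (λ _ → refl) (linear w) f (geometric v))
        (PR.trans (PR.-‿cong (PR.*-congˡ {f} linear-*-geometric))
          (PR.solve 1 (λ f → PR.:- (f PR.:* (PR.:- PR.:1)) PR.:= f) (λ _ → refl) f)))

      quotient-0 : w * q 0 ≈ f 0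
      quotient-0 = begin
        w * q 0                        ≈⟨ solve 2 (λ w x → w :* x := :- (w :* (:- x))) refl w (q 0) ⟩
        - (w * - q 0)                  ≈⟨ linear-*-0 w (PR.- q) ⟨
        (linear w PR.* (PR.- q)) 0     ≈⟨ quotient 0 ⟨
        f 0 ∎

      -- Horner's recurrence for the division by w - u.
      quotient-suc : ∀ j → w * q (suc j) ≈ f (suc j) + q j
      quotient-suc j = begin
        w * q (suc j)
          ≈⟨ solve 3 (λ w x y → w :* x := ((:- y) :- w :* (:- x)) :+ y) refl w (q (suc j)) (q j) ⟩
        (- q j - w * - q (suc j)) + q j
          ≈⟨ +-congʳ (linear-*-suc w (PR.- q) j) ⟨
        (linear w PR.* (PR.- q)) (suc j) + q j
          ≈⟨ +-congʳ (quotient (suc j)) ⟨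
        f (suc j) + q j ∎

  -- A series has no value at x, so a truncation is evaluated; for polynomials `eval-extend` makes
  -- the choice of a large enough `n` immaterial.
  eval : ℕ → Series → Carrier → Carrier
  eval n f x = sum {n} λ i → f (toℕ i) * x ^ toℕ i

  eval-cong : ∀ n {f g} x → f PR.≈ g → eval n f x ≈ eval n g x
  eval-cong n x p = sum-cong {n} λ i → *-congʳ (p (toℕ i))

  eval-last : ∀ n f x → eval (suc n) f x ≈ eval n f x + f n * x ^ n
  eval-last n f x = sum-last n (λ i → f i * x ^ i)

  eval-suc : ∀ n f x → eval (suc n) f x ≈ f 0 + x * eval n (P.tail f) x
  eval-suc n f x = +-cong (*-identityʳ _) (sym (trans (*-distribˡ-sum {n} x _)
    (sum-cong {n} λ i → x*yz≈y*xz x (f (suc (toℕ i))) (x ^ toℕ i))))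

  eval-+ : ∀ n f g x → eval n (f PR.+ g) x ≈ eval n f x + eval n g x
  eval-+ n f g x = trans (sum-cong {n} λ i → distribʳ (x ^ toℕ i) (f (toℕ i)) (g (toℕ i))) (∑-distrib-+ {n} _ _)

  eval-neg : ∀ n f x → eval n (PR.- f) x ≈ - eval n f x
  eval-neg n f x = trans (sum-cong {n} λ i → sym (-‿distribˡ-* (f (toℕ i)) (x ^ toℕ i))) (sum-neg {n} _)

  eval-const* : ∀ n b f x → eval n (const b PR.* f) x ≈ b * eval n f x
  eval-const* n b f x = trans
    (sum-cong {n} λ i → trans (*-congʳ (P.constant-* b f (toℕ i))) (*-assoc b (f (toℕ i)) (x ^ toℕ i)))
    (sym (*-distribˡ-sum {n} b _))

  eval-0 : ∀ n x → eval n PR.0# x ≈ 0#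
  eval-0 n x = sum-0 {n} λ i → zeroˡ (x ^ toℕ i)

  eval-sum : ∀ n {m} (F : Fin m → Series) x → eval n (PR.sum F) x ≈ sum λ l → eval n (F l) x
  eval-sum n {zero}  F x = eval-0 n x
  eval-sum n {suc m} F x = trans (eval-+ n (F Fin.zero) (PR.sum (F ∘ Fin.suc)) x) (+-congˡ (eval-sum n (F ∘ Fin.suc) x))

  eval-extend : ∀ {n} f x → DegreeBelow n f → ∀ k → eval (k ℕ.+ n) f x ≈ eval n f x
  eval-extend f x p zero    = refl
  eval-extend {n} f x p (suc k) = begin
    eval (suc (k ℕ.+ n)) f x                       ≈⟨ eval-last (k ℕ.+ n) f x ⟩
    eval (k ℕ.+ n) f x + f (k ℕ.+ n) * x ^ (k ℕ.+ n) ≈⟨ +-cong (eval-extend f x p k) (trans (*-congʳ (p _ (ℕ.m≤n+m n k))) (zeroˡ _)) ⟩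
    eval n f x + 0#                                ≈⟨ +-identityʳ _ ⟩
    eval n f x ∎

  eval-extend-≤ : ∀ {n m} f x → DegreeBelow n f → n ℕ.≤ m → eval m f x ≈ eval n f x
  eval-extend-≤ {n} {m} f x p n≤m = trans (reflexive (≡.cong (λ k → eval k f x) (≡.sym (ℕ.m∸n+n≡m n≤m))))
    (eval-extend f x p (m ∸ n))

  eval-linear : ∀ n v g x → DegreeBelow n g → eval (suc n) (linear v PR.* g) x ≈ (x - v) * eval n g x
  eval-linear n v g x p = begin
    eval (suc n) (linear v PR.* g) x
      ≈⟨ eval-cong (suc n) x (PR.[y-z]x≈yx-zx g P.X (const v)) ⟩
    eval (suc n) (P.X PR.* g PR.- const v PR.* g) x
      ≈⟨ eval-+ (suc n) (P.X PR.* g) (PR.- (const v PR.* g)) x ⟩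
    eval (suc n) (P.X PR.* g) x + eval (suc n) (PR.- (const v PR.* g)) x
      ≈⟨ +-cong shifted (trans (eval-neg (suc n) (const v PR.* g) x) (-‿cong (eval-const* (suc n) v g x))) ⟩
    x * eval n g x - v * eval (suc n) g x
      ≈⟨ +-congˡ (-‿cong (*-congˡ (eval-extend g x p 1))) ⟩
    x * eval n g x - v * eval n g x
      ≈⟨ [y-z]x≈yx-zx _ _ _ ⟨
    (x - v) * eval n g x ∎
    where
    shifted : eval (suc n) (P.X PR.* g) x ≈ x * eval n g x
    shifted = begin
      eval (suc n) (P.X PR.* g) x                              ≈⟨ eval-suc n (P.X PR.* g) x ⟩
      (P.X PR.* g) 0 + x * eval n (P.tail (P.X PR.* g)) x      ≈⟨ +-cong (P.X* g 0) (*-congˡ (eval-cong n x (λ i → P.X* g (suc i)))) ⟩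
      0# + x * eval n g x                                      ≈⟨ +-identityˡ _ ⟩
      x * eval n g x ∎

  -- Both sides satisfy Horner's recurrence: `quotient-suc` times w^(j+1) adds the next term to the
  -- truncation.
  eval-geometric : ∀ {w v} → w * v ≈ 1# → ∀ f j → eval (suc j) f w ≈ w ^ suc j * (f PR.* geometric v) j
  eval-geometric {w} {v} wv≈1 f zero    = begin
    f 0 * 1# + 0#                  ≈⟨ solve 1 (λ x → x :* :1 :+ :0 := x) refl (f 0) ⟩
    f 0                            ≈⟨ quotient-0 wv≈1 f ⟨
    w * (f PR.* geometric v) 0     ≈⟨ *-congʳ (*-identityʳ w) ⟨
    w ^ 1 * (f PR.* geometric v) 0 ∎
  eval-geometric {w} {v} wv≈1 f (suc j) = begin
    eval (suc (suc j)) f w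
      ≈⟨ eval-last (suc j) f w ⟩
    eval (suc j) f w + f (suc j) * w ^ suc j
      ≈⟨ +-congʳ (eval-geometric wv≈1 f j) ⟩
    w ^ suc j * q j + f (suc j) * w ^ suc j
      ≈⟨ solve 3 (λ x y z → x :* y :+ z :* x := x :* (z :+ y)) refl (w ^ suc j) (q j) (f (suc j)) ⟩
    w ^ suc j * (f (suc j) + q j)
      ≈⟨ *-congˡ (quotient-suc wv≈1 f j) ⟨
    w ^ suc j * (w * q (suc j))
      ≈⟨ solve 3 (λ x w z → x :* (w :* z) := w :* x :* z) refl (w ^ suc j) w (q (suc j)) ⟩
    w ^ suc (suc j) * q (suc j) ∎
    where q = f PR.* geometric v

  -- From the degree of f on, the truncations at w are all equal to f(w) = 0, and by
  -- `eval-geometric` they are unit multiples of the coefficients of the quotient.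
  quotient-degree : ∀ {w v} → w * v ≈ 1# → ∀ {n} f → DegreeBelow (suc n) f → eval (suc n) f w ≈ 0# →
    DegreeBelow n (f PR.* geometric v)
  quotient-degree {w} {v} wv≈1 {n} f p f[w]≈0 j n≤j = Unit-cancel-0 (Unit-^ (unit v wv≈1) (suc j)) (begin
    w ^ suc j * (f PR.* geometric v) j ≈⟨ eval-geometric wv≈1 f j ⟨
    eval (suc j) f w                   ≈⟨ eval-extend-≤ f w p (s≤s n≤j) ⟩
    eval (suc n) f w                   ≈⟨ f[w]≈0 ⟩
    0# ∎)

  rootProduct : ∀ {n} → (Fin n → Carrier) → Series
  rootProduct w = PR.product (λ i → linear (w i))

  linear-degree : ∀ w {n} g → DegreeBelow n g → DegreeBelow (suc n) (linear w PR.* g)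
  linear-degree w g p (suc i) (s≤s n≤i) = begin
    (linear w PR.* g) (suc i) ≈⟨ linear-*-suc w g i ⟩
    g i - w * g (suc i)       ≈⟨ +-cong (p i n≤i) (-‿cong (*-congˡ (p (suc i) (ℕ.m≤n⇒m≤1+n n≤i)))) ⟩
    0# - w * 0#               ≈⟨ solve 1 (λ w → :0 :- w :* :0 := :0) refl w ⟩
    0# ∎

  rootProduct-degree : ∀ {n} (w : Fin n → Carrier) → DegreeBelow (suc n) (rootProduct w)
  rootProduct-degree {zero}  w (suc i) _ = refl
  rootProduct-degree {suc n} w = linear-degree (w Fin.zero) (rootProduct (w ∘ Fin.suc)) (rootProduct-degree (w ∘ Fin.suc))

  rootProduct-monic : ∀ {n} (w : Fin n → Carrier) → rootProduct w n ≈ 1#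
  rootProduct-monic {zero}  w = refl
  rootProduct-monic {suc n} w = begin
    (linear w₀ PR.* g) (suc n) ≈⟨ linear-*-suc w₀ g n ⟩
    g n - w₀ * g (suc n)       ≈⟨ +-cong (rootProduct-monic (w ∘ Fin.suc))
                                    (-‿cong (*-congˡ (rootProduct-degree (w ∘ Fin.suc) (suc n) ℕ.≤-refl))) ⟩
    1# - w₀ * 0#               ≈⟨ solve 1 (λ w → :1 :- w :* :0 := :1) refl w₀ ⟩
    1# ∎
    where
    w₀ = w Fin.zero
    g = rootProduct (w ∘ Fin.suc)

  eval-rootProduct : ∀ {n} (w : Fin n → Carrier) x → eval (suc n) (rootProduct w) x ≈ product (λ i → x - w i)
  eval-rootProduct {zero}  w x = solve 0 (:1 :* :1 :+ :0 := :1) refl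
  eval-rootProduct {suc n} w x = trans
    (eval-linear (suc n) (w Fin.zero) (rootProduct (w ∘ Fin.suc)) x (rootProduct-degree (w ∘ Fin.suc)))
    (*-congˡ (eval-rootProduct (w ∘ Fin.suc) x))

  product-0 : ∀ {n} (f : Fin n → Carrier) i → f i ≈ 0# → product f ≈ 0#
  product-0 f Fin.zero    p = trans (*-congʳ p) (zeroˡ _)
  product-0 f (Fin.suc i) p = trans (*-congˡ (product-0 (f ∘ Fin.suc) i p)) (zeroʳ _)

  eval-rootProduct-0 : ∀ {n} (w : Fin n → Carrier) i → eval (suc n) (rootProduct w) (w i) ≈ 0#
  eval-rootProduct-0 w i = trans (eval-rootProduct w (w i)) (product-0 (λ j → w i - w j) i (-‿inverseʳ (w i)))

  eval-monomial : ∀ n m x → m ℕ.< n → eval n (P.monomial m) x ≈ x ^ m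
  eval-monomial (suc n) zero    x _         = trans (+-cong (*-identityʳ 1#) (sum-0 {n} λ i → zeroˡ (x ^ suc (toℕ i)))) (+-identityʳ _)
  eval-monomial (suc n) (suc m) x (s≤s m<n) = trans (eval-suc n (P.monomial (suc m)) x)
    (trans (+-identityˡ _) (*-congˡ (eval-monomial n m x m<n)))

-- In a tight ring inequality to zero is, up to double negation, invertibility.
module TightRing {a ℓ} (L : CommutativeRing a ℓ)
  (tight : ∀ x → ¬ RingOps.Unit (CommutativeRing.rawRing L) x → CommutativeRing._≈_ L x (CommutativeRing.0# L)) where
  open RingTools L
  open Polynomials L
  open SetoidReasoning setoid

  -- If y were a unit, x would vanish; so y is not a unit, and tightness applies.
  no-zero-divisors : ∀ {x y} → x * y ≈ 0# → ¬ x ≈ 0# → y ≈ 0#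
  no-zero-divisors {x} {y} xy≈0 x≉0 = tight y λ u → x≉0 (Unit-cancel-0 u (trans (*-comm y x) xy≈0))

  -- The bound on the number of roots. Dividing by u - w₀ lowers the degree, and the other roots
  -- pass to the quotient because w i - w₀ is not 0. Invertible roots make the division possible by
  -- a geometric series.
  vanish : ∀ n (w : Fin n → Carrier) → (∀ i → Unit (w i)) → (∀ i j → w i ≈ w j → i ≡ j) →
    ∀ f → DegreeBelow n f → (∀ i → eval n f (w i) ≈ 0#) → f PR.≈ PR.0#
  vanish zero    w units distinct f p f[w]≈0 i = p i z≤n
  vanish (suc n) w units distinct f p f[w]≈0 = PR.trans (quotient w₀v≈1 f)
    (PR.trans (PR.*-congˡ {linear w₀} {q} {PR.0#} q≈0) (PR.zeroʳ (linear w₀)))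
    where
    w₀ = w Fin.zero
    v = units Fin.zero ⁻¹
    w₀v≈1 = inverseʳ (units Fin.zero)
    q = PR.- (f PR.* geometric v)
    q-degree : DegreeBelow n q
    q-degree j n≤j = trans (-‿cong (quotient-degree w₀v≈1 f p (f[w]≈0 Fin.zero) j n≤j)) -0#≈0#
    q≈0 : q PR.≈ PR.0#
    q≈0 = vanish n (w ∘ Fin.suc) (units ∘ Fin.suc) (λ i j e → Fin.suc-injective (distinct (Fin.suc i) (Fin.suc j) e))
      q q-degree λ i → no-zero-divisors
        (begin
          (w (Fin.suc i) - w₀) * eval n q (w (Fin.suc i))  ≈⟨ eval-linear n w₀ q (w (Fin.suc i)) q-degree ⟨
          eval (suc n) (linear w₀ PR.* q) (w (Fin.suc i))  ≈⟨ eval-cong (suc n) (w (Fin.suc i)) (quotient w₀v≈1 f) ⟨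
          eval (suc n) f (w (Fin.suc i))                   ≈⟨ f[w]≈0 (Fin.suc i) ⟩
          0# ∎)
        λ e → Fin.0≢1+n (≡.sym (distinct (Fin.suc i) Fin.zero (x-y≈0⇒x≈y e)))

  -- Lagrange interpolation and partial fractions

  module Lagrange {d} (v : Fin (suc d) → Carrier) (units : ∀ l → Unit (v l)) (distinct : ∀ l j → v l ≈ v j → l ≡ j)
    (c : Fin (suc d) → Carrier) (c-inverse : ∀ l → c l * product (λ j → v l - v (punchIn l j)) ≈ 1#) where

    -- Euler's sums, that is, the divided difference of uᵐ at the nodes v l; hence 0 for m < d and 1
    -- for m = d.
    moment : ℕ → Carrier
    moment m = sum λ l → c l * v l ^ m

    private
      basis : Fin (suc d) → Series
      basis l = rootProduct (v ∘ punchIn l)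

      basis-≢ : ∀ i l → l ≢ i → eval (suc d) (basis l) (v i) ≈ 0#
      basis-≢ i l l≢i = trans (eval-rootProduct (v ∘ punchIn l) (v i))
        (product-0 (λ j → v i - v (punchIn l j)) (punchOut l≢i)
          (trans (+-congˡ (-‿cong (reflexive (≡.cong v (Fin.punchIn-punchOut l≢i))))) (-‿inverseʳ (v i))))

      module _ (m : ℕ) (m≤d : m ℕ.≤ d) where
        b : Fin (suc d) → Carrier
        b l = c l * v l ^ m

        interpolant : Series
        interpolant = PR.sum λ l → const (b l) PR.* basis l

        difference : Series
        difference = P.monomial m PR.- interpolant

        interpolant-coefficient : ∀ n → interpolant n ≈ sum λ l → b l * basis l n
        interpolant-coefficient n = trans (P.sum-coefficient (λ l → const (b l) PR.* basis l) n)
          (sum-cong λ l → P.constant-* (b l) (basis l) n)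

        difference-degree : DegreeBelow (suc d) difference
        difference-degree i d<i = begin
          P.monomial m i - interpolant i
            ≈⟨ +-cong (P.monomial-≢ m i (ℕ.<⇒≢ (ℕ.≤-<-trans m≤d d<i))) (-‿cong (trans (interpolant-coefficient i)
                 (sum-0 λ l → trans (*-congˡ {b l} (rootProduct-degree (v ∘ punchIn l) i d<i)) (zeroʳ (b l))))) ⟩
          0# - 0#
            ≈⟨ -‿inverseʳ 0# ⟩
          0# ∎

        eval-interpolant : ∀ i → eval (suc d) interpolant (v i) ≈ v i ^ m
        eval-interpolant i = begin
          eval (suc d) interpolant (v i)
            ≈⟨ eval-sum (suc d) (λ l → const (b l) PR.* basis l) (v i) ⟩
          sum (λ l → eval (suc d) (const (b l) PR.* basis l) (v i))
            ≈⟨ sum-cong (λ l → eval-const* (suc d) (b l) (basis l) (v i)) ⟩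
          sum t
            ≈⟨ sum-remove {i = i} t ⟩
          t i + sum (removeAt t i)
            ≈⟨ +-cong diagonal (sum-0 λ k → trans
                 (*-congˡ (basis-≢ i (punchIn i k) (Fin.punchInᵢ≢i i k))) (zeroʳ _)) ⟩
          v i ^ m + 0#
            ≈⟨ +-identityʳ _ ⟩
          v i ^ m ∎
          where
          t : Fin (suc d) → Carrier
          t l = b l * eval (suc d) (basis l) (v i)
          diagonal : t i ≈ v i ^ m
          diagonal = begin
            c i * v i ^ m * eval (suc d) (basis i) (v i)
              ≈⟨ *-congˡ (eval-rootProduct (v ∘ punchIn i) (v i)) ⟩
            c i * v i ^ m * product (λ j → v i - v (punchIn i j))
              ≈⟨ solve 3 (λ x y z → x :* y :* z := y :* (x :* z)) refl (c i) (v i ^ m) _ ⟩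
            v i ^ m * (c i * product (λ j → v i - v (punchIn i j)))
              ≈⟨ *-congˡ (c-inverse i) ⟩
            v i ^ m * 1#
              ≈⟨ *-identityʳ _ ⟩
            v i ^ m ∎

        difference≈0 : difference PR.≈ PR.0#
        difference≈0 = vanish (suc d) v units distinct difference difference-degree λ i → begin
          eval (suc d) difference (v i)
            ≈⟨ trans (eval-+ (suc d) (P.monomial m) (PR.- interpolant) (v i)) (+-congˡ (eval-neg (suc d) interpolant (v i))) ⟩
          eval (suc d) (P.monomial m) (v i) - eval (suc d) interpolant (v i)
            ≈⟨ +-cong (eval-monomial (suc d) m (v i) (s≤s m≤d)) (-‿cong (eval-interpolant i)) ⟩
          v i ^ m - v i ^ m
            ≈⟨ -‿inverseʳ _ ⟩
          0# ∎

      -- Comparing coefficients of uᵈ in the interpolation of uᵐ.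
      moment≈monomial : ∀ m → m ℕ.≤ d → moment m ≈ P.monomial m d
      moment≈monomial m m≤d = begin
        sum (b m m≤d)
          ≈⟨ sum-cong (λ l → trans (*-congˡ {b m m≤d l} (rootProduct-monic (v ∘ punchIn l))) (*-identityʳ (b m m≤d l))) ⟨
        sum (λ l → b m m≤d l * basis l d)
          ≈⟨ interpolant-coefficient m m≤d d ⟨
        interpolant m m≤d d
          ≈⟨ x-y≈0⇒x≈y (difference≈0 m m≤d d) ⟨
        P.monomial m d ∎

    moment-< : ∀ m → m ℕ.< d → moment m ≈ 0#
    moment-< m m<d = trans (moment≈monomial m (ℕ.<⇒≤ m<d)) (P.monomial-≢ m d (ℕ.<⇒≢ m<d))

    moment-d : moment d ≈ 1#
    moment-d = trans (moment≈monomial d ℕ.≤-refl) (P.monomial-≡ d)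

    module PartialFractions (c₀ : ℕ) (K : Series) (K-degree : DegreeBelow (suc (suc d ℕ.+ c₀)) K)
      (K-roots : ∀ l → eval (suc (suc d ℕ.+ c₀)) K (v l) ≈ 0#) where
      private
        r = suc d ℕ.+ c₀
        q : Fin (suc d) → Series
        q l = K PR.* geometric (units l ⁻¹)

      -- This is the expansion of -1 / ∏ (u - v l), so its product with K should have degree r - (d
      -- + 1) = c₀ and leading coefficient -K r.
      partialFractions : Series
      partialFractions k = sum λ l → c l * geometric (units l ⁻¹) k

      private
        K*partialFractions : ∀ j → (K PR.* partialFractions) j ≈ sum λ l → c l * q l j
        K*partialFractions j = begin
          (K PR.* partialFractions) j
            ≈⟨ PR.*-congˡ {K} {partialFractions} {PR.sum λ l → const (c l) PR.* geometric (units l ⁻¹)} (λ k → sym (trans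
                 (P.sum-coefficient (λ l → const (c l) PR.* geometric (units l ⁻¹)) k)
                 (sum-cong λ l → P.constant-* (c l) (geometric (units l ⁻¹)) k))) j ⟩
          (K PR.* PR.sum (λ l → const (c l) PR.* geometric (units l ⁻¹))) j
            ≈⟨ PR.*-distribˡ-sum K (λ l → const (c l) PR.* geometric (units l ⁻¹)) j ⟩
          PR.sum (λ l → K PR.* (const (c l) PR.* geometric (units l ⁻¹))) j
            ≈⟨ P.sum-coefficient (λ l → K PR.* (const (c l) PR.* geometric (units l ⁻¹))) j ⟩
          sum (λ l → (K PR.* (const (c l) PR.* geometric (units l ⁻¹))) j)
            ≈⟨ sum-cong (λ l → trans
                 (PR.solve 3 (λ x y z → x PR.:* (y PR.:* z) PR.:= y PR.:* (x PR.:* z)) (λ _ → refl) K (const (c l)) (geometric (units l ⁻¹)) j)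
                 (P.constant-* (c l) (q l) j)) ⟩
          sum (λ l → c l * q l j) ∎

        q-step : ∀ l j → q l j ≈ v l * q l (suc j) - K (suc j)
        q-step l j = begin
          q l j                             ≈⟨ solve 2 (λ x y → x := (y :+ x) :- y) refl (q l j) (K (suc j)) ⟩
          (K (suc j) + q l j) - K (suc j)   ≈⟨ +-congʳ (quotient-suc (inverseʳ (units l)) K j) ⟨
          v l * q l (suc j) - K (suc j) ∎

        q-degree : ∀ l → DegreeBelow r (q l)
        q-degree l = quotient-degree (inverseʳ (units l)) K K-degree (K-roots l)

        -- `k` counts the distance of j from the top degree. Unrolling `q-step` upwards yields the
        -- moments m, ..., m + k with coefficients of K; as k + m ≤ d, all but the last have order
        -- below d and vanish. Index c₀ is the one with k = d, where the moment is 1.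
        weighted : ∀ k m j → k ℕ.+ m ℕ.≤ d → k ℕ.+ suc j ≡ r →
          sum (λ l → c l * v l ^ m * q l j) ≈ - (K r * moment (k ℕ.+ m))
        weighted zero m j _ ≡.refl = begin
          sum (λ l → c l * v l ^ m * q l j)
            ≈⟨ sum-cong (λ l → trans (*-congˡ (trans (q-step l j) (+-congʳ (trans (*-congˡ (q-degree l r ℕ.≤-refl)) (zeroʳ _)))))
                 (solve 2 (λ x k → x :* (:0 :- k) := :- k :* x) refl (c l * v l ^ m) (K r))) ⟩
          sum (λ l → - K r * (c l * v l ^ m))
            ≈⟨ *-distribˡ-sum (- K r) (λ l → c l * v l ^ m) ⟨
          - K r * moment m
            ≈⟨ -‿distribˡ-* _ _ ⟨
          - (K r * moment m) ∎
        weighted (suc k) m j k+m<d k+j≡r = begin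
          sum (λ l → c l * v l ^ m * q l j)
            ≈⟨ sum-cong (λ l → trans (*-congˡ (q-step l j))
                 (solve 5 (λ c x v y k → c :* x :* (v :* y :- k) := c :* (v :* x) :* y :+ (:- k) :* (c :* x)) refl
                   (c l) (v l ^ m) (v l) (q l (suc j)) (K (suc j)))) ⟩
          sum (λ l → c l * v l ^ suc m * q l (suc j) + - K (suc j) * (c l * v l ^ m))
            ≈⟨ ∑-distrib-+ (λ l → c l * v l ^ suc m * q l (suc j)) (λ l → - K (suc j) * (c l * v l ^ m)) ⟩
          sum (λ l → c l * v l ^ suc m * q l (suc j)) + sum (λ l → - K (suc j) * (c l * v l ^ m))
            ≈⟨ +-cong (weighted k (suc m) (suc j) (≡.subst (ℕ._≤ d) (≡.sym (ℕ.+-suc k m)) k+m<d)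
                         (≡.trans (ℕ.+-suc k (suc j)) k+j≡r))
                 (sym (*-distribˡ-sum (- K (suc j)) (λ l → c l * v l ^ m))) ⟩
          - (K r * moment (k ℕ.+ suc m)) + - K (suc j) * moment m
            ≈⟨ +-cong (-‿cong (*-congˡ (reflexive (≡.cong moment (ℕ.+-suc k m)))))
                 (trans (*-congˡ (moment-< m (ℕ.≤-<-trans (ℕ.m≤n+m m k) k+m<d))) (zeroʳ _)) ⟩
          - (K r * moment (suc k ℕ.+ m)) + 0#
            ≈⟨ +-identityʳ _ ⟩
          - (K r * moment (suc k ℕ.+ m)) ∎

        unweighted : ∀ k j → k ℕ.≤ d → k ℕ.+ suc j ≡ r → (K PR.* partialFractions) j ≈ - (K r * moment k)
        unweighted k j k≤d k+j≡r = begin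
          (K PR.* partialFractions) j           ≈⟨ K*partialFractions j ⟩
          sum (λ l → c l * q l j)               ≈⟨ sum-cong (λ l → *-congʳ {q l j} (sym (*-identityʳ (c l)))) ⟩
          sum (λ l → c l * v l ^ 0 * q l j)     ≈⟨ weighted k 0 j (≡.subst (ℕ._≤ d) (≡.sym (ℕ.+-identityʳ k)) k≤d) k+j≡r ⟩
          - (K r * moment (k ℕ.+ 0))            ≈⟨ -‿cong (*-congˡ (reflexive (≡.cong moment (ℕ.+-identityʳ k)))) ⟩
          - (K r * moment k) ∎

      K*partialFractions-c₀ : (K PR.* partialFractions) c₀ ≈ - K r
      K*partialFractions-c₀ = trans (unweighted d c₀ ℕ.≤-refl (ℕ.+-suc d c₀))
        (-‿cong (trans (*-congˡ moment-d) (*-identityʳ _)))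

      K*partialFractions-> : ∀ j → c₀ ℕ.< j → (K PR.* partialFractions) j ≈ 0#
      K*partialFractions-> j c₀<j with r ℕ.≤? j
      ... | yes r≤j = trans (K*partialFractions j) (sum-0 λ l → trans (*-congˡ {c l} (q-degree l j r≤j)) (zeroʳ (c l)))
      ... | no  r≰j = trans (unweighted (r ∸ suc j) j (ℕ.<⇒≤ small) (ℕ.m∸n+n≡m (ℕ.≰⇒> r≰j)))
        (trans (-‿cong (trans (*-congˡ (moment-< _ small)) (zeroʳ _))) -0#≈0#)
        where
        small : r ∸ suc j ℕ.< d
        small = ℕ.+-cancelʳ-< (suc j) _ _ (≡.subst (ℕ._< d ℕ.+ suc j) (≡.sym (ℕ.m∸n+n≡m (ℕ.≰⇒> r≰j)))
          (≡.subst (ℕ._< d ℕ.+ suc j) (ℕ.+-suc d c₀) (ℕ.+-monoʳ-< d (s≤s c₀<j))))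

-- The kernel method

-- Integral elements play the role of C[[t]] in C((t)).
record Valuation {a ℓ} (L : CommutativeRing a ℓ) p : Set (a ⊔ ℓ ⊔ lsuc p) where
  open RingTools L
  field
    Integral      : Carrier → Set p
    Integral-cong : ∀ {x y} → x ≈ y → Integral x → Integral y
    Integral-+    : ∀ {x y} → Integral x → Integral y → Integral (x + y)
    Integral-*    : ∀ {x y} → Integral x → Integral y → Integral (x * y)
    Integral-0    : Integral 0#
    Integral-1    : Integral 1#
    τ             : Carrier
    Integral-τ    : Integral τ
    Unit-τ        : Unit τ
    pole          : ∀ x → ∃[ b ] Integral (τ ^ b * x)
    separated     : ∀ x → (∀ n → ∃[ y ] Integral y × x ≈ τ ^ n * y) → x ≈ 0#

  Integral-^ : ∀ {x} → Integral x → ∀ n → Integral (x ^ n)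
  Integral-^ i zero    = Integral-1
  Integral-^ i (suc n) = Integral-* i (Integral-^ i n)

  Integral-sum : ∀ {n} (f : Fin n → Carrier) → (∀ i → Integral (f i)) → Integral (sum f)
  Integral-sum {zero}  f i = Integral-0
  Integral-sum {suc n} f i = Integral-+ (i Fin.zero) (Integral-sum (f ∘ Fin.suc) (i ∘ Fin.suc))

  pole-+ : ∀ {b x} k → Integral (τ ^ b * x) → Integral (τ ^ (k ℕ.+ b) * x)
  pole-+ {b} {x} zero    i = i
  pole-+ {b} {x} (suc k) i = Integral-cong (sym (*-assoc _ _ _)) (Integral-* Integral-τ (pole-+ {b} {x} k i))

  pole-+ʳ : ∀ {b x} k → Integral (τ ^ b * x) → Integral (τ ^ (b ℕ.+ k) * x)
  pole-+ʳ {b} {x} k i = ≡.subst (λ m → Integral (τ ^ m * x)) (ℕ.+-comm k b) (pole-+ {b} k i)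

  pole-finite : ∀ {n} (f : Fin n → Carrier) → ∃[ b ] ∀ i → Integral (τ ^ b * f i)
  pole-finite {zero}  f = 0 , λ ()
  pole-finite {suc n} f with pole (f Fin.zero) | pole-finite (f ∘ Fin.suc)
  ... | b , i | b′ , i′ = b ℕ.+ b′ , λ
    { Fin.zero    → pole-+ʳ {b} b′ i
    ; (Fin.suc j) → pole-+ {b′} b (i′ j) }

module KernelMethod {a ℓ p} (L : CommutativeRing a ℓ)
  (tight : ∀ x → ¬ RingOps.Unit (CommutativeRing.rawRing L) x → CommutativeRing._≈_ L x (CommutativeRing.0# L))
  (𝒱 : Valuation L p) where
  open RingTools L
  open Polynomials L
  open TightRing L tight
  open Valuation 𝒱
  open SetoidReasoning setoid

  Bounded : Series → Set p
  Bounded f = ∃[ b ] ∀ k → Integral (τ ^ b * f k)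

  Bounded-polynomial : ∀ {n f} → DegreeBelow n f → Bounded f
  Bounded-polynomial {n} {f} p = b , bound
    where
    finite = pole-finite {n} (f ∘ toℕ)
    b = proj₁ finite
    bound : ∀ k → Integral (τ ^ b * f k)
    bound k with k ℕ.<? n
    ... | yes k<n = ≡.subst (λ j → Integral (τ ^ b * f j)) (Fin.toℕ-fromℕ< k<n) (proj₂ finite (Fin.fromℕ< k<n))
    ... | no  k≮n = Integral-cong (sym (trans (*-congˡ (p k (ℕ.≮⇒≥ k≮n))) (zeroʳ _))) Integral-0

  Bounded-* : ∀ {f g} → Bounded f → Bounded g → Bounded (f PR.* g)
  Bounded-* {f} {g} (b , i) (b′ , i′) = b ℕ.+ b′ , λ k → Integral-cong
    (begin
      sum {suc k} (λ j → τ ^ b * f (toℕ j) * (τ ^ b′ * g (k ∸ toℕ j)))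
        ≈⟨ sum-cong {suc k} (λ j → trans (*-interchange (τ ^ b) (f (toℕ j)) (τ ^ b′) (g (k ∸ toℕ j)))
             (*-congʳ {f (toℕ j) * g (k ∸ toℕ j)} (sym (^-homo-* τ b b′)))) ⟩
      sum {suc k} (λ j → τ ^ (b ℕ.+ b′) * (f (toℕ j) * g (k ∸ toℕ j)))
        ≈⟨ *-distribˡ-sum {suc k} (τ ^ (b ℕ.+ b′)) (λ j → f (toℕ j) * g (k ∸ toℕ j)) ⟨
      τ ^ (b ℕ.+ b′) * (f PR.* g) k ∎)
    (Integral-sum {suc k} _ λ j → Integral-* (i (toℕ j)) (i′ (k ∸ toℕ j)))

  record SmallRoot (K : Series) (r : ℕ) (w : Carrier) : Set (a ⊔ ℓ ⊔ p) where
    field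
      invertible : Unit w
      w/τ        : Carrier
      integral   : Integral w/τ
      w≈         : w ≈ τ * w/τ
      root       : eval (suc r) K w ≈ 0#

  module _ {K : Series} {r} (K-degree : DegreeBelow (suc r) K) where

    -- The value N(w) is w^(j+1) times a coefficient of bounded pole of
    -- (K / (w - u)) X, for every j ≥ n, hence 0.
    kernel-method : ∀ {w} → SmallRoot K r w → ∀ {X} → Bounded X →
      ∀ {n} → DegreeBelow (suc n) (K PR.* X) → eval (suc n) (K PR.* X) w ≈ 0#
    kernel-method {w} small {X} X-bounded {n} N-degree = Unit-cancel-0 (Unit-^ Unit-τ b) (separated _ λ j →
      -- The coefficient of index j + n brings the factor τ^(j+n+1): j of these are the divisibility
      -- asked for, n + 1 remain in the integral cofactor, and τ^b clears the poles of `Q`.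
      τ * (w/τ ^ suc (j ℕ.+ n) * (τ ^ n * (τ ^ b * Q (j ℕ.+ n)))) ,
      Integral-* Integral-τ (Integral-* (Integral-^ integral (suc (j ℕ.+ n))) (Integral-* (Integral-^ Integral-τ n) (Q-bound (j ℕ.+ n)))) ,
      (begin
        τ ^ b * eval (suc n) N w
          ≈⟨ *-congˡ (eval-extend-≤ N w N-degree (s≤s (ℕ.m≤n+m n j))) ⟨
        τ ^ b * eval (suc (j ℕ.+ n)) N w
          ≈⟨ *-congˡ (eval-geometric wv≈1 N (j ℕ.+ n)) ⟩
        τ ^ b * (w ^ suc (j ℕ.+ n) * (N PR.* geometric v) (j ℕ.+ n))
          ≈⟨ *-congˡ (*-cong (trans (^-congˡ (suc (j ℕ.+ n)) w≈) (^-distrib-* τ w/τ (suc (j ℕ.+ n)))) (N*geometric (j ℕ.+ n))) ⟩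
        τ ^ b * (τ ^ suc (j ℕ.+ n) * w/τ ^ suc (j ℕ.+ n) * Q (j ℕ.+ n))
          ≈⟨ *-congˡ (*-congʳ (*-congʳ (*-congˡ (^-homo-* τ j n)))) ⟩
        τ ^ b * (τ * (τ ^ j * τ ^ n) * w/τ ^ suc (j ℕ.+ n) * Q (j ℕ.+ n))
          ≈⟨ solve 6 (λ b t j n w q → b :* (t :* (j :* n) :* w :* q) := j :* (t :* (w :* (n :* (b :* q))))) refl
               (τ ^ b) τ (τ ^ j) (τ ^ n) (w/τ ^ suc (j ℕ.+ n)) (Q (j ℕ.+ n)) ⟩
        τ ^ j * (τ * (w/τ ^ suc (j ℕ.+ n) * (τ ^ n * (τ ^ b * Q (j ℕ.+ n))))) ∎))
      where
      open SmallRoot small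
      v = invertible ⁻¹
      wv≈1 = inverseʳ invertible
      N Q : Series
      N = K PR.* X
      Q = (K PR.* geometric v) PR.* X
      Q-bounded : Bounded Q
      Q-bounded = Bounded-* {K PR.* geometric v} {X} (Bounded-polynomial (quotient-degree wv≈1 K K-degree root)) X-bounded
      b = proj₁ Q-bounded
      Q-bound = proj₂ Q-bounded
      N*geometric : N PR.* geometric v PR.≈ Q
      N*geometric = PR.solve 3 (λ k x g → (k PR.:* x) PR.:* g PR.:= (k PR.:* g) PR.:* x) (λ _ → refl) K X (geometric v)

    module _ {c} (w : Fin c → Carrier) (small : ∀ i → SmallRoot K r (w i)) (distinct : ∀ i j → w i ≈ w j → i ≡ j) where

      private
        units : ∀ i → Unit (w i)
        units i = SmallRoot.invertible (small i)

      -- Both sides are monic of degree c, so the difference has degree below c and yet vanishes at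
      -- c distinct points.
      kernel-factor : ∀ {X} → Bounded X → DegreeBelow (suc c) (K PR.* X) → (K PR.* X) c ≈ 1# →
        K PR.* X PR.≈ rootProduct w
      kernel-factor {X} X-bounded N-degree N-monic = λ k → x-y≈0⇒x≈y (difference≈0 k)
        where
        N = K PR.* X
        difference : Series
        difference = N PR.- rootProduct w
        degree : DegreeBelow c difference
        degree k c≤k with k ℕ.≟ c
        ... | yes ≡.refl = x≈y⇒x∙y⁻¹≈ε (trans N-monic (sym (rootProduct-monic w)))
        ... | no  k≢c    = x≈y⇒x∙y⁻¹≈ε (trans (N-degree k c<k) (sym (rootProduct-degree w k c<k)))
          where c<k = ℕ.≤∧≢⇒< c≤k (k≢c ∘ ≡.sym)
        difference≈0 : difference PR.≈ PR.0#
        difference≈0 = vanish c w units distinct difference degree λ i → begin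
          eval c difference (w i)
            ≈⟨ eval-extend difference (w i) degree 1 ⟨
          eval (suc c) difference (w i)
            ≈⟨ trans (eval-+ (suc c) N (PR.- rootProduct w) (w i)) (+-congˡ (eval-neg (suc c) (rootProduct w) (w i))) ⟩
          eval (suc c) N (w i) - eval (suc c) (rootProduct w) (w i)
            ≈⟨ +-cong (kernel-method (small i) X-bounded N-degree) (-‿cong (eval-rootProduct-0 w i)) ⟩
          0# - 0#
            ≈⟨ -‿inverseʳ 0# ⟩
          0# ∎

      -- Both products equal `rootProduct w`, and K can be cancelled as a power series in u once its
      -- constant term is a unit.
      kernel-unique : Unit (K 0) → ∀ {X Y} → Bounded X → Bounded Y →
        DegreeBelow (suc c) (K PR.* X) → (K PR.* X) c ≈ 1# → DegreeBelow (suc c) (K PR.* Y) → (K PR.* Y) c ≈ 1# →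
        X PR.≈ Y
      kernel-unique K₀-unit {X} {Y} X-bounded Y-bounded X-degree X-monic Y-degree Y-monic =
        PR.Unit-cancel {K} (P.powerSeries-unit {K} K₀-unit) {X} {Y}
          (PR.trans (kernel-factor {X} X-bounded X-degree X-monic) (PR.sym (kernel-factor {Y} Y-bounded Y-degree Y-monic)))

-- Laurent series over a field

module LaurentField {a ℓ} (𝔽 : Field a ℓ) where
  open Field 𝔽 using (commutativeRing; _≟_; invertible)
  private
    module F = RingTools commutativeRing
    module P = PowerSeries commutativeRing
    module T = RingTools P.powerSeriesRing
    raw = CommutativeRing.rawRing commutativeRing

  open PowerSeries commutativeRing using (X; _↑_) public
  laurentRing : CommutativeRing a ℓ
  laurentRing = LaurentSeries.laurentRing commutativeRing

  open RingTools laurentRing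

  cross : ∀ {f m g n} → (X T.^ n) T.* f T.≈ (X T.^ m) T.* g → (f /X^ m) ≈ (g /X^ n)
  cross {f} {m} {g} {n} p = T.trans (P.↑≈X^* n f) (T.trans p (T.sym (P.↑≈X^* m g)))

  cross⁻¹ : ∀ {f m g n} → (f /X^ m) ≈ (g /X^ n) → (X T.^ n) T.* f T.≈ (X T.^ m) T.* g
  cross⁻¹ {f} {m} {g} {n} p = T.trans (T.sym (P.↑≈X^* n f)) (T.trans p (P.↑≈X^* m g))

  ≈0 : ∀ {f m} → f T.≈ T.0# → (f /X^ m) ≈ 0#
  ≈0 {f} {m} p = cross {f} {m} {T.0#} {0}
    (T.trans (T.*-identityˡ f) (T.trans p (T.sym (T.zeroʳ (X T.^ m)))))

  least : ∀ f n → ¬ f n F.≈ F.0# → ∃[ k ] k ℕ.≤ n × ¬ f k F.≈ F.0# × (∀ i → i ℕ.< k → f i F.≈ F.0#)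
  least f zero    f₀≉0 = 0 , z≤n , f₀≉0 , λ i ()
  least f (suc n) fₙ≉0 with f 0 ≟ F.0#
  ... | no  f₀≉0 = 0 , z≤n , f₀≉0 , λ i ()
  ... | yes f₀≈0 with least (f ∘ suc) n fₙ≉0
  ...   | k , k≤n , fₖ≉0 , low = suc k , s≤s k≤n , fₖ≉0 , λ
          { zero    _         → f₀≈0
          ; (suc i) (s≤s i<k) → low i i<k }

  record Leading (f : ℕ → F.Carrier) (n : ℕ) : Set (a ⊔ ℓ) where
    field
      order   : ℕ
      order≤n : order ℕ.≤ n
      g g⁻¹   : ℕ → F.Carrier
      f≈      : f T.≈ (X T.^ order) T.* g
      inverse : g T.* g⁻¹ T.≈ T.1#

  leading : ∀ f n → ¬ f n F.≈ F.0# → Leading f n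
  leading f n fₙ≉0 with least f n fₙ≉0
  ... | k , k≤n , fₖ≉0 , low = record
    { order = k ; order≤n = k≤n ; g = g ; g⁻¹ = proj₁ unit-g
    ; f≈ = T.trans (P.leading k f low) (P.↑≈X^* k g)
    ; inverse = T.inverseʳ {g} unit-g }
    where
    g = λ i → f (k ℕ.+ i)
    unit-g : T.Unit g
    unit-g = P.powerSeries-unit {g} (invertible (g 0)
      (≡.subst (λ j → ¬ f j F.≈ F.0#) (≡.sym (ℕ.+-identityʳ k)) fₖ≉0))


  -- The known non-zero coefficient bounds the search for the lowest one. Writing f = X^order g, the
  -- inverse of f / Xᵐ is Xᵐ g⁻¹ / X^order.
  coefficient-unit : ∀ f m n → ¬ f n F.≈ F.0# → Unit (f /X^ m)
  coefficient-unit f m n fₙ≉0 = unit (((X T.^ m) T.* g⁻¹) /X^ order)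
    (cross {f T.* ((X T.^ m) T.* g⁻¹)} {m ℕ.+ order} {T.1#} {0} (T.trans
      (T.*-congˡ {T.1#} (T.*-congʳ {(X T.^ m) T.* g⁻¹} f≈))
      (T.trans (T.solve 4 (λ k g m h → T.:1 T.:* ((k T.:* g) T.:* (m T.:* h)) T.:= (m T.:* k) T.:* (g T.:* h)) T.refl
          (X T.^ order) g (X T.^ m) g⁻¹)
        (T.*-cong {(X T.^ m) T.* (X T.^ order)} {X T.^ (m ℕ.+ order)} (T.sym (T.^-homo-* X m order)) inverse))))
    where open Leading (leading f n fₙ≉0)

  -- Any non-zero coefficient would make x a unit, and coefficients can be compared with 0.
  tight : ∀ x → ¬ Unit x → x ≈ 0#
  tight (f /X^ m) ¬unit = ≈0 {f} {m} λ n → stable n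
    where
    stable : ∀ n → f n F.≈ F.0#
    stable n with f n ≟ F.0#
    ... | yes p = p
    ... | no  p = ⊥-elim (¬unit (coefficient-unit f m n p))

  τ : Carrier
  τ = X /X^ 0

  τ^ : ∀ b → τ ^ b ≈ ((X T.^ b) /X^ 0)
  τ^ zero    = refl {1#}
  τ^ (suc b) = *-congˡ {τ} {τ ^ b} {(X T.^ b) /X^ 0} (τ^ b)

  -- Representations are not unique, and a series with a formal pole may still lie in C[[t]]; hence
  -- equality with some pole-free representative.
  Integral : Carrier → Set (a ⊔ ℓ)
  Integral x = ∃[ g ] x ≈ (g /X^ 0)

  τ^* : ∀ b f m → τ ^ b * (f /X^ m) ≈ (((X T.^ b) T.* f) /X^ m)
  τ^* b f m = *-congʳ {f /X^ m} {τ ^ b} {(X T.^ b) /X^ 0} (τ^ b)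

  valuation : Valuation laurentRing (a ⊔ ℓ)
  valuation = record
    { Integral      = Integral
    ; Integral-cong = λ { {x} {y} x≈y (g , x≈g) → g , trans {y} {x} {g /X^ 0} (sym {x} {y} x≈y) x≈g }
    ; Integral-+    = λ { {x} {y} (g , x≈g) (h , y≈h) → g T.+ h , +-cong {x} {g /X^ 0} {y} {h /X^ 0} x≈g y≈h }
    ; Integral-*    = λ { {x} {y} (g , x≈g) (h , y≈h) → g T.* h , *-cong {x} {g /X^ 0} {y} {h /X^ 0} x≈g y≈h }
    ; Integral-0    = T.0# , refl {0#}
    ; Integral-1    = T.1# , refl {1#}
    ; τ             = τ
    ; Integral-τ    = X , refl {τ}
    ; Unit-τ        = coefficient-unit X 0 1 (Field.1≉0 𝔽)
    ; pole          = λ { (f /X^ m) → m , f , trans {τ ^ m * (f /X^ m)} {((X T.^ m) T.* f) /X^ m} {f /X^ 0} (τ^* m f m)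
                        (cross {(X T.^ m) T.* f} {m} {f} {0} (T.*-identityˡ _)) }
    ; separated     = λ { (f /X^ m) approximations → ≈0 {f} {m} λ i → vanishes f m i (approximations (suc i)) }
    }
    where
    -- Divisibility by τ^(i+1) pushes f to X^(i+1) Xᵐ g, whose coefficient of index i is 0.
    vanishes : ∀ f m i → ∃[ y ] Integral y × (f /X^ m) ≈ τ ^ suc i * y → f i F.≈ F.0#
    vanishes f m i (y , (g , y≈g) , x≈) = F.trans (f≈ i) (P.↑-< (suc i) ((X T.^ m) T.* g) (ℕ.n<1+n i))
      where
      x≈′ : (f /X^ m) ≈ (((X T.^ suc i) T.* g) /X^ 0)
      x≈′ = trans {f /X^ m} {τ ^ suc i * y} {((X T.^ suc i) T.* g) /X^ 0} x≈
        (*-cong {τ ^ suc i} {(X T.^ suc i) /X^ 0} {y} {g /X^ 0} (τ^ (suc i)) y≈g)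
      f≈ : f T.≈ (((X T.^ m) T.* g) ↑ suc i)
      f≈ = T.trans (T.sym (T.*-identityˡ f)) (T.trans (cross⁻¹ {f} {m} {(X T.^ suc i) T.* g} {0} x≈′)
        (T.trans (T.x*yz≈y*xz (X T.^ m) (X T.^ suc i) g) (T.sym (P.↑≈X^* (suc i) ((X T.^ m) T.* g)))))

  small : ∀ x → TendsTo0 raw x → ∃[ y ] Integral y × x ≈ τ * y
  small (f /X^ m) low = (g /X^ 0) , (g , refl {g /X^ 0}) , cross {f} {m} {X T.* g} {0}
    (T.trans (T.*-identityˡ f) (T.trans (P.leading (suc m) f λ i i≤m → low i (ℕ.≤-pred i≤m))
      (T.trans (P.↑≈X^* (suc m) g) (T.trans (T.*-assoc X (X T.^ m) g) (T.x*yz≈y*xz X (X T.^ m) g)))))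
    where g = λ i → f (suc m ℕ.+ i)

  -- A non-zero coefficient below index m bounds the order of f by m, so 1 / x is X^(m - order) g⁻¹,
  -- without pole; y equals it by uniqueness of inverses.
  inverse-integral : ∀ x → TendsTo∞ raw x → ∀ {y} → x * y ≈ 1# → Integral y
  inverse-integral x@(f /X^ m) (i , i<m , fᵢ≉0) {y} xy≈1 = (X T.^ j) T.* g⁻¹ ,
    Unit-cancel {x} (unit {x} y xy≈1) {y} {z} (trans {x * y} {1#} {x * z} xy≈1 (sym {x * z} {1#} xz≈1))
    where
    open Leading (leading f i fᵢ≉0)
    j = m ∸ order
    z = ((X T.^ j) T.* g⁻¹) /X^ 0
    k+j≡m : order ℕ.+ j ≡ m
    k+j≡m = ℕ.m+[n∸m]≡n (ℕ.≤-trans order≤n (ℕ.<⇒≤ i<m))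
    xz≈1 : x * z ≈ 1#
    xz≈1 = cross {f T.* ((X T.^ j) T.* g⁻¹)} {m ℕ.+ 0} {T.1#} {0} (T.trans
      (T.*-congˡ {T.1#} (T.*-congʳ {(X T.^ j) T.* g⁻¹} f≈))
      (T.trans (T.solve 4 (λ k g m h → T.:1 T.:* ((k T.:* g) T.:* (m T.:* h)) T.:= (k T.:* m) T.:* (g T.:* h)) T.refl
          (X T.^ order) g (X T.^ j) g⁻¹)
        (T.*-cong {(X T.^ order) T.* (X T.^ j)} {X T.^ (m ℕ.+ 0)}
          (T.trans (T.sym (T.^-homo-* X order j)) (T.reflexive (≡.cong (X T.^_) (≡.trans k+j≡m (≡.sym (ℕ.+-identityʳ m))))))
          inverse)))

-- Elimination and finite algebras

module Homomorphism {a ℓ b ℓ₂} (R : CommutativeRing a ℓ) (S : CommutativeRing b ℓ₂) where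
  private
    module R = RingTools R
    module S = RingTools S

  ringHomomorphism : (φ : R.Carrier → S.Carrier) →
    (∀ {x y} → x R.≈ y → φ x S.≈ φ y) →
    (∀ x y → φ (x R.+ y) S.≈ φ x S.+ φ y) →
    (∀ x y → φ (x R.* y) S.≈ φ x S.* φ y) →
    φ R.1# S.≈ S.1# → IsRingHomomorphism R.rawRing S.rawRing φ
  ringHomomorphism φ φ-cong φ-+ φ-* φ-1 = record
    { isSemiringHomomorphism = record
      { isNearSemiringHomomorphism = record
        { +-isMonoidHomomorphism = record
          { isMagmaHomomorphism = record
            { isRelHomomorphism = record { cong = φ-cong }
            ; homo = φ-+
            }
          ; ε-homo = φ-0
          }
        ; *-homo = φ-*
        }
      ; 1#-homo = φ-1
      }
    ; -‿homo = λ x → S.+-inverseˡ-unique (φ (R.- x)) (φ x)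
        (S.trans (S.sym (φ-+ (R.- x) x)) (S.trans (φ-cong (R.-‿inverseˡ x)) φ-0))
    }
    where
    φ-0 : φ R.0# S.≈ S.0#
    φ-0 = S.x+x≈x⇒x≈0 (φ R.0#) (S.trans (S.sym (φ-+ R.0# R.0#)) (φ-cong (R.+-identityˡ R.0#)))

  module Properties {φ : R.Carrier → S.Carrier} (hom : IsRingHomomorphism R.rawRing S.rawRing φ) where
    open IsRingHomomorphism hom public using ()
      renaming (⟦⟧-cong to φ-cong; +-homo to φ-+; *-homo to φ-*; 0#-homo to φ-0; 1#-homo to φ-1; -‿homo to φ-neg)

    φ-sum : ∀ {n} (f : Fin n → R.Carrier) → φ (R.sum f) S.≈ S.sum (λ i → φ (f i))
    φ-sum {zero}  f = φ-0
    φ-sum {suc n} f = S.trans (φ-+ (f Fin.zero) (R.sum (f ∘ Fin.suc))) (S.+-congˡ (φ-sum (f ∘ Fin.suc)))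

    φ-product : ∀ {n} (f : Fin n → R.Carrier) → φ (R.product f) S.≈ S.product (λ i → φ (f i))
    φ-product {zero}  f = φ-1
    φ-product {suc n} f = S.trans (φ-* (f Fin.zero) (R.product (f ∘ Fin.suc))) (S.*-congˡ (φ-product (f ∘ Fin.suc)))

    φ-^ : ∀ x n → φ (x R.^ n) S.≈ φ x S.^ n
    φ-^ x zero    = φ-1
    φ-^ x (suc n) = S.trans (φ-* x (x R.^ n)) (S.*-congˡ (φ-^ x n))

    φ-minus : ∀ x y → φ (x R.- y) S.≈ φ x S.- φ y
    φ-minus x y = S.trans (φ-+ x (R.- y)) (S.+-congˡ (φ-neg y))

    φ-Unit : ∀ {x} → R.Unit x → S.Unit (φ x)
    φ-Unit {x} u = S.unit (φ (u R.⁻¹)) (S.trans (S.sym (φ-* x (u R.⁻¹))) (S.trans (φ-cong (R.inverseʳ u)) φ-1))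

-- A subring with decidable zero inside a domain. The instance is A[z,u] inside A[[z]][[u]]:
-- elimination has to test pivots, which is possible for polynomials but not for arbitrary series.
record DecidableSubdomain {a ℓ} (S : CommutativeRing a ℓ) p : Set (a ⊔ ℓ ⊔ lsuc p) where
  open CommutativeRing S
  field
    Member        : Carrier → Set p
    Member-+      : ∀ {x y} → Member x → Member y → Member (x + y)
    Member-*      : ∀ {x y} → Member x → Member y → Member (x * y)
    Member-neg    : ∀ {x} → Member x → Member (- x)
    Member-0      : Member 0#
    Member-1      : Member 1#
    zero?         : ∀ {x} → Member x → Dec (x ≈ 0#)
    1≉0           : ¬ 1# ≈ 0#
    cancel        : ∀ {x y} → x * y ≈ 0# → ¬ x ≈ 0# → y ≈ 0#

  open RingTools S using (sum)

  Member-sum : ∀ {n} (f : Fin n → Carrier) → (∀ i → Member (f i)) → Member (sum f)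
  Member-sum {zero}  f m = Member-0
  Member-sum {suc n} f m = Member-+ (m Fin.zero) (Member-sum (f ∘ Fin.suc) (m ∘ Fin.suc))

-- Linear dependence by elimination

module Elimination {a ℓ p} (S : CommutativeRing a ℓ) (𝒟 : DecidableSubdomain S p) where
  open RingTools S
  open DecidableSubdomain 𝒟
  open SetoidReasoning setoid

  Relation : ∀ {n m} → (Fin n → Fin m → Carrier) → Set (a ⊔ ℓ ⊔ p)
  Relation {n} A = Σ[ λs ∈ (Fin n → Carrier) ] (∀ i → Member (λs i)) × (∃[ l ] ¬ λs l ≈ 0#) ×
    (∀ j → sum (λ i → λs i * A i j) ≈ 0#)

  -- Fraction-free Gaussian elimination.
  dependent : ∀ n (A : Fin (suc n) → Fin n → Carrier) → (∀ i j → Member (A i j)) → Relation A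
  dependent zero    A A-member = (λ _ → 1#) , (λ _ → Member-1) , (Fin.zero , 1≉0) , λ ()
  dependent (suc n) A A-member with Fin.any? (λ i → ¬? (zero? (A-member i Fin.zero)))
  ... | yes (i₀ , pivot≉0) = λs , λs-member , (punchIn i₀ (proj₁ nonzero) , λs≉0) , relation
    where
    pivot = A i₀ Fin.zero
    A′ : Fin (suc n) → Fin n → Carrier
    A′ k j = pivot * A (punchIn i₀ k) (Fin.suc j) - A (punchIn i₀ k) Fin.zero * A i₀ (Fin.suc j)
    rec = dependent n A′ λ k j → Member-+ (Member-* (A-member _ _) (A-member _ _)) (Member-neg (Member-* (A-member _ _) (A-member _ _)))
    μ = proj₁ rec
    μ-member = proj₁ (proj₂ rec)
    nonzero = proj₁ (proj₂ (proj₂ rec))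
    μ-relation = proj₂ (proj₂ (proj₂ rec))
    column : Fin (suc n) → Carrier
    column k = A (punchIn i₀ k) Fin.zero
    -- The other rows are scaled by the pivot, as it has no inverse among the members; the
    -- coefficient of the pivot row is then forced by column 0.
    head = - sum (λ k → μ k * column k)
    rest : Fin (suc n) → Carrier
    rest k = pivot * μ k
    λs : Fin (suc (suc n)) → Carrier
    λs = insertAt rest i₀ head
    λs-head : λs i₀ ≡ head
    λs-head = Vector.insertAt-lookup rest i₀ head
    λs-rest : ∀ k → λs (punchIn i₀ k) ≡ rest k
    λs-rest = Vector.insertAt-punchIn rest i₀ head
    λs-member : ∀ i → Member (λs i)
    λs-member i with i₀ Fin.≟ i
    ... | yes ≡.refl = ≡.subst Member (≡.sym λs-head) (Member-neg (Member-sum _ λ k → Member-* (μ-member k) (A-member (punchIn i₀ k) Fin.zero)))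
    ... | no  i₀≢i   = ≡.subst (Member ∘ λs) (Fin.punchIn-punchOut i₀≢i)
      (≡.subst Member (≡.sym (λs-rest (punchOut i₀≢i))) (Member-* (A-member _ _) (μ-member _)))
    λs≉0 : ¬ λs (punchIn i₀ (proj₁ nonzero)) ≈ 0#
    λs≉0 e = proj₂ nonzero (cancel (trans (reflexive (≡.sym (λs-rest (proj₁ nonzero)))) e) pivot≉0)
    split : ∀ j → sum (λ i → λs i * A i j) ≈ head * A i₀ j + sum (λ k → rest k * A (punchIn i₀ k) j)
    split j = trans (sum-remove {i = i₀} (λ i → λs i * A i j)) (+-cong (*-congʳ (reflexive λs-head))
      (sum-cong λ k → *-congʳ {A (punchIn i₀ k) j} (reflexive (λs-rest k))))
    relation : ∀ j → sum (λ i → λs i * A i j) ≈ 0#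
    relation Fin.zero    = begin
      sum (λ i → λs i * A i Fin.zero)
        ≈⟨ split Fin.zero ⟩
      head * pivot + sum (λ k → rest k * column k)
        ≈⟨ +-congˡ (trans (sum-cong λ k → *-assoc pivot (μ k) (column k)) (sym (*-distribˡ-sum pivot (λ k → μ k * column k)))) ⟩
      head * pivot + pivot * sum (λ k → μ k * column k)
        ≈⟨ solve 2 (λ s p → (:- s) :* p :+ p :* s := :0) refl (sum (λ k → μ k * column k)) pivot ⟩
      0# ∎
    relation (Fin.suc j) = begin
      sum (λ i → λs i * A i (Fin.suc j))
        ≈⟨ split (Fin.suc j) ⟩
      head * b + sum (λ k → rest k * A (punchIn i₀ k) (Fin.suc j))
        ≈⟨ +-congʳ (trans (sym (-‿distribˡ-* _ b)) (trans (-‿cong (*-distribʳ-sum b (λ k → μ k * column k)))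
             (sym (sum-neg (λ k → μ k * column k * b))))) ⟩
      sum (λ k → - (μ k * column k * b)) + sum (λ k → rest k * A (punchIn i₀ k) (Fin.suc j))
        ≈⟨ ∑-distrib-+ (λ k → - (μ k * column k * b)) (λ k → rest k * A (punchIn i₀ k) (Fin.suc j)) ⟨
      sum (λ k → - (μ k * column k * b) + rest k * A (punchIn i₀ k) (Fin.suc j))
        ≈⟨ sum-cong (λ k → solve 5 (λ m c b p x → :- (m :* c :* b) :+ p :* m :* x := m :* (p :* x :- c :* b)) refl
             (μ k) (column k) b pivot (A (punchIn i₀ k) (Fin.suc j))) ⟩
      sum (λ k → μ k * A′ k j)
        ≈⟨ μ-relation j ⟩
      0# ∎
      where b = A i₀ (Fin.suc j)
  -- Column 0 vanishes, so it is dropped together with row 0, and the rows still exceed the columns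
  -- by one.
  ... | no column≈0 = (0# Vector.∷ μ) , λs-member , (Fin.suc (proj₁ nonzero) , proj₂ nonzero) , relation
    where
    rec = dependent n (λ i j → A (Fin.suc i) (Fin.suc j)) λ i j → A-member _ _
    μ = proj₁ rec
    μ-member = proj₁ (proj₂ rec)
    nonzero = proj₁ (proj₂ (proj₂ rec))
    λs-member : ∀ i → Member ((0# Vector.∷ μ) i)
    λs-member Fin.zero    = Member-0
    λs-member (Fin.suc i) = μ-member i
    zeros : ∀ i → A i Fin.zero ≈ 0#
    zeros i with zero? (A-member i Fin.zero)
    ... | yes p = p
    ... | no  p = ⊥-elim (column≈0 (i , p))
    relation : ∀ j → sum (λ i → (0# Vector.∷ μ) i * A i j) ≈ 0#
    relation Fin.zero    = sum-0 {f = λ i → (0# Vector.∷ μ) i * A i Fin.zero} λ i → trans (*-congˡ {(0# Vector.∷ μ) i} (zeros i)) (zeroʳ ((0# Vector.∷ μ) i))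
    relation (Fin.suc j) = trans (+-cong (zeroˡ _) (proj₂ (proj₂ (proj₂ rec)) j)) (+-identityˡ 0#)

-- Finite algebras over the subdomain

module FiniteAlgebras {a ℓ b ℓ₂ p} (S : CommutativeRing a ℓ) (𝒟 : DecidableSubdomain S p) (Ω : CommutativeRing b ℓ₂)
  {φ : CommutativeRing.Carrier S → CommutativeRing.Carrier Ω}
  (φ-hom : IsRingHomomorphism (CommutativeRing.rawRing S) (CommutativeRing.rawRing Ω) φ) where
  private module S = RingTools S
  open RingTools Ω
  open DecidableSubdomain 𝒟
  open Homomorphism.Properties S Ω φ-hom
  open SetoidReasoning setoid

  -- Meant for the maps that send a series in u to its coefficient of uʲ, regarded as a constant
  -- series. The algebra is kept closed under them so that the coefficients of K M in u stay in it
  -- along with K M.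
  record Operator : Set (a ⊔ p ⊔ b ⊔ ℓ₂) where
    field
      E        : Carrier → Carrier
      E-cong   : ∀ {x y} → x ≈ y → E x ≈ E y
      E-+      : ∀ x y → E (x + y) ≈ E x + E y
      E-0      : E 0# ≈ 0#
      E-φ      : ∀ {x} → Member x → ∃[ y ] Member y × E (φ x) ≈ φ y

    E-sum : ∀ {n} (f : Fin n → Carrier) → E (sum f) ≈ sum (λ i → E (f i))
    E-sum {zero}  f = E-0
    E-sum {suc n} f = trans (E-+ (f Fin.zero) (sum (f ∘ Fin.suc))) (+-congˡ (E-sum (f ∘ Fin.suc)))

  open Operator

  -- Linearity over y; for coefficient extraction it holds when y is constant in u.
  CommutesWith : Operator → Carrier → Set (b ⊔ ℓ₂)
  CommutesWith D y = ∀ x → E D (x * y) ≈ E D x * y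

  CommutesWith-^ : ∀ D {y} → CommutesWith D y → ∀ n x → E D (x * y ^ n) ≈ E D x * y ^ n
  CommutesWith-^ D {y} comm zero    x = trans (E-cong D (*-identityʳ x)) (sym (*-identityʳ (E D x)))
  CommutesWith-^ D {y} comm (suc n) x = begin
    E D (x * (y * y ^ n))   ≈⟨ E-cong D (sym (*-assoc x y (y ^ n))) ⟩
    E D (x * y * y ^ n)     ≈⟨ CommutesWith-^ D comm n (x * y) ⟩
    E D (x * y) * y ^ n     ≈⟨ *-congʳ (comm x) ⟩
    E D x * y * y ^ n       ≈⟨ *-assoc _ _ _ ⟩
    E D x * (y * y ^ n) ∎

  sum-↑ : ∀ m n (f : Fin (m ℕ.+ n) → Carrier) → sum f ≈ sum (λ i → f (i ↑ˡ n)) + sum (λ j → f (m ↑ʳ j))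
  sum-↑ zero    n f = sym (+-identityˡ _)
  sum-↑ (suc m) n f = trans (+-congˡ (sum-↑ m n (f ∘ Fin.suc))) (sym (+-assoc _ _ _))

  sum-combine : ∀ m n (f : Fin (m ℕ.* n) → Carrier) → sum f ≈ sum (λ i → sum (λ j → f (combine {m} {n} i j)))
  sum-combine zero    n f = refl
  sum-combine (suc m) n f = trans (sum-↑ n (m ℕ.* n) f) (+-congˡ (sum-combine m n (f ∘ (n ↑ʳ_))))

  -- Coordinates need not be unique nor the generators independent: elimination only requires that
  -- every element be some combination of `rank` fixed ones.
  record FiniteAlgebra (𝒪 : ℕ → Operator) : Set (a ⊔ b ⊔ ℓ₂ ⊔ lsuc (a ⊔ p ⊔ b ⊔ ℓ₂)) where
    field
      T        : Carrier → Set (a ⊔ p ⊔ b ⊔ ℓ₂)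
      T-cong   : ∀ {x y} → x ≈ y → T x → T y
      T-+      : ∀ {x y} → T x → T y → T (x + y)
      T-*      : ∀ {x y} → T x → T y → T (x * y)
      T-φ      : ∀ {x} → Member x → T (φ x)
      T-E      : ∀ j {x} → T x → T (E (𝒪 j) x)
      rank     : ℕ
      generator : Fin rank → Carrier
      coordinates : ∀ {x} → T x → Σ[ α ∈ (Fin rank → S.Carrier) ] (∀ i → Member (α i)) × x ≈ sum (λ i → φ (α i) * generator i)

    T-0 : T 0#
    T-0 = T-cong φ-0 (T-φ Member-0)

    T-1 : T 1#
    T-1 = T-cong φ-1 (T-φ Member-1)

    T-^ : ∀ {x} → T x → ∀ n → T (x ^ n)
    T-^ t zero    = T-1
    T-^ t (suc n) = T-* t (T-^ t n)

    -- There are rank + 1 monomials of degree rank in x and y.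
    homogeneous-relation : ∀ {x y} → T x → T y →
      Σ[ α ∈ (Fin (suc rank) → S.Carrier) ] (∀ i → Member (α i)) × (∃[ l ] ¬ α l S.≈ S.0#) ×
        sum (λ i → φ (α i) * (x ^ toℕ i * y ^ (rank ∸ toℕ i))) ≈ 0#
    homogeneous-relation {x} {y} x∈T y∈T = α , α-member , nonzero , (begin
      sum (λ i → φ (α i) * m i)
        ≈⟨ sum-cong (λ i → trans (*-congˡ {φ (α i)} (m≈ i)) (*-distribˡ-sum (φ (α i)) (λ j → φ (A i j) * generator j))) ⟩
      sum (λ i → sum (λ j → φ (α i) * (φ (A i j) * generator j)))
        ≈⟨ ∑-comm (λ i j → φ (α i) * (φ (A i j) * generator j)) ⟩
      sum (λ j → sum (λ i → φ (α i) * (φ (A i j) * generator j)))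
        ≈⟨ sum-0 (λ j → begin
          sum (λ i → φ (α i) * (φ (A i j) * generator j))
            ≈⟨ sum-cong (λ i → trans (sym (*-assoc (φ (α i)) (φ (A i j)) (generator j))) (*-congʳ {generator j} (sym (φ-* (α i) (A i j))))) ⟩
          sum (λ i → φ (α i S.* A i j) * generator j)
            ≈⟨ *-distribʳ-sum (generator j) (λ i → φ (α i S.* A i j)) ⟨
          sum (λ i → φ (α i S.* A i j)) * generator j
            ≈⟨ *-congʳ (trans (sym (φ-sum (λ i → α i S.* A i j))) (trans (φ-cong (relation j)) φ-0)) ⟩
          0# * generator j
            ≈⟨ zeroˡ _ ⟩
          0# ∎) ⟩
      0# ∎)
      where
      m : Fin (suc rank) → Carrier
      m i = x ^ toℕ i * y ^ (rank ∸ toℕ i)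
      c : ∀ i → Σ[ α ∈ (Fin rank → S.Carrier) ] (∀ j → Member (α j)) × m i ≈ sum (λ j → φ (α j) * generator j)
      c i = coordinates (T-* (T-^ x∈T (toℕ i)) (T-^ y∈T (rank ∸ toℕ i)))
      A : Fin (suc rank) → Fin rank → S.Carrier
      A i = proj₁ (c i)
      m≈ : ∀ i → m i ≈ sum (λ j → φ (A i j) * generator j)
      m≈ i = proj₂ (proj₂ (c i))
      elimination = Elimination.dependent S 𝒟 rank A (λ i → proj₁ (proj₂ (c i)))
      α = proj₁ elimination
      α-member = proj₁ (proj₂ elimination)
      nonzero = proj₁ (proj₂ (proj₂ elimination))
      relation = proj₂ (proj₂ (proj₂ elimination))

  module _ {𝒪 : ℕ → Operator} where

    base : FiniteAlgebra 𝒪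
    base = record
      { T           = λ x → ∃[ α ] Member α × Lift b (x ≈ φ α)
      ; T-cong      = λ { x≈y (α , m , lift x≈) → α , m , lift (trans (sym x≈y) x≈) }
      ; T-+         = λ { (α , m , lift x≈) (β , n , lift y≈) → α S.+ β , Member-+ m n , lift (trans (+-cong x≈ y≈) (sym (φ-+ α β))) }
      ; T-*         = λ { (α , m , lift x≈) (β , n , lift y≈) → α S.* β , Member-* m n , lift (trans (*-cong x≈ y≈) (sym (φ-* α β))) }
      ; T-φ         = λ {α} m → α , m , lift refl
      ; T-E         = λ { j (α , m , lift x≈) → let β , n , e = E-φ (𝒪 j) m in β , n , lift (trans (E-cong (𝒪 j) x≈) e) }
      ; rank        = 1
      ; generator   = λ _ → 1#
      ; coordinates = λ { (α , m , lift x≈) → (λ _ → α) , (λ _ → m) , trans x≈ (sym (trans (+-identityʳ _) (*-identityʳ _))) }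
      }

    module Extension (𝒜 : FiniteAlgebra 𝒪) (y : Carrier) (r : ℕ) (κ : Fin (suc r) → S.Carrier)
      (κ-member : ∀ i → Member (κ i)) (y-integral : y ^ suc r ≈ sum (λ i → φ (κ i) * y ^ toℕ i))
      (y-constant : ∀ j → CommutesWith (𝒪 j) y) where
      open FiniteAlgebra 𝒜

      polynomial : (Fin (suc r) → Carrier) → Carrier
      polynomial c = sum (λ i → c i * y ^ toℕ i)

      T′ : Carrier → Set (a ⊔ p ⊔ b ⊔ ℓ₂)
      T′ x = Σ[ c ∈ (Fin (suc r) → Carrier) ] (∀ i → T (c i)) × x ≈ polynomial c

      T′-cong : ∀ {x z} → x ≈ z → T′ x → T′ z
      T′-cong x≈z (c , c∈T , x≈) = c , c∈T , trans (sym x≈z) x≈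

      T′-+ : ∀ {x z} → T′ x → T′ z → T′ (x + z)
      T′-+ {x} {z} (c , c∈T , x≈) (d , d∈T , z≈) = (λ i → c i + d i) , (λ i → T-+ (c∈T i) (d∈T i)) , (begin
        x + z                                          ≈⟨ +-cong x≈ z≈ ⟩
        polynomial c + polynomial d                    ≈⟨ ∑-distrib-+ (λ i → c i * y ^ toℕ i) (λ i → d i * y ^ toℕ i) ⟨
        sum (λ i → c i * y ^ toℕ i + d i * y ^ toℕ i)  ≈⟨ sum-cong (λ i → sym (distribʳ (y ^ toℕ i) (c i) (d i))) ⟩
        polynomial (λ i → c i + d i) ∎)

      T′-scale : ∀ {s x} → T s → T′ x → T′ (s * x)
      T′-scale {s} {x} s∈T (c , c∈T , x≈) = (λ i → s * c i) , (λ i → T-* s∈T (c∈T i)) , (begin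
        s * x                              ≈⟨ *-congˡ x≈ ⟩
        s * polynomial c                   ≈⟨ *-distribˡ-sum s (λ i → c i * y ^ toℕ i) ⟩
        sum (λ i → s * (c i * y ^ toℕ i))  ≈⟨ sum-cong (λ i → sym (*-assoc s (c i) (y ^ toℕ i))) ⟩
        polynomial (λ i → s * c i) ∎)

      T⊆T′ : ∀ {x} → T x → T′ x
      T⊆T′ {x} x∈T = (x Vector.∷ λ _ → 0#) , (λ { Fin.zero → x∈T ; (Fin.suc i) → T-0 }) ,
        sym (trans (+-cong (*-identityʳ x) (sum-0 {r} λ i → zeroˡ (y ^ suc (toℕ i)))) (+-identityʳ x))

      -- Coefficients move up by one place, and the top one, now at y^(r+1), is folded back by
      -- `y-integral`.
      T′-y : ∀ {x} → T′ x → T′ (y * x)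
      T′-y {x} (c , c∈T , x≈) = T′-cong (sym y*x≈) (T′-+ (shifted , shifted∈T , refl) (T′-scale (c∈T (fromℕ r)) top))
        where
        shifted : Fin (suc r) → Carrier
        shifted = 0# Vector.∷ λ i → c (inject₁ i)
        shifted∈T : ∀ i → T (shifted i)
        shifted∈T Fin.zero    = T-0
        shifted∈T (Fin.suc i) = c∈T (inject₁ i)
        top : T′ (y ^ suc r)
        top = (λ i → φ (κ i)) , (λ i → T-φ (κ-member i)) , y-integral
        f : Fin (suc r) → Carrier
        f i = c i * (y * y ^ toℕ i)
        y*x≈ : y * x ≈ polynomial shifted + c (fromℕ r) * y ^ suc r
        y*x≈ = begin
          y * x
            ≈⟨ trans (*-congˡ x≈) (*-distribˡ-sum y (λ i → c i * y ^ toℕ i)) ⟩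
          sum (λ i → y * (c i * y ^ toℕ i))
            ≈⟨ sum-cong (λ i → x*yz≈y*xz y (c i) (y ^ toℕ i)) ⟩
          sum f
            ≈⟨ sum-init-last f ⟩
          sum {r} (λ i → f (inject₁ i)) + f (fromℕ r)
            ≈⟨ +-cong (trans (sum-cong {r} λ i → *-congˡ {c (inject₁ i)} (*-congˡ (reflexive (≡.cong (y ^_) (Fin.toℕ-inject₁ i)))))
                 (sym (trans (+-congʳ (zeroˡ 1#)) (+-identityˡ _))))
                 (*-congˡ (*-congˡ (reflexive (≡.cong (y ^_) (Fin.toℕ-fromℕ r))))) ⟩
          polynomial shifted + c (fromℕ r) * y ^ suc r ∎

      T′-y^ : ∀ n {x} → T′ x → T′ (y ^ n * x)
      T′-y^ zero    x∈T′ = T′-cong (sym (*-identityˡ _)) x∈T′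
      T′-y^ (suc n) x∈T′ = T′-cong (sym (*-assoc _ _ _)) (T′-y (T′-y^ n x∈T′))

      T′-sum : ∀ {n} (f : Fin n → Carrier) → (∀ i → T′ (f i)) → T′ (sum f)
      T′-sum {zero}  f t = T⊆T′ T-0
      T′-sum {suc n} f t = T′-+ (t Fin.zero) (T′-sum (f ∘ Fin.suc) (t ∘ Fin.suc))

      T′-* : ∀ {x z} → T′ x → T′ z → T′ (x * z)
      T′-* {x} {z} (c , c∈T , x≈) z∈T′ = T′-cong
        (sym (trans (*-congʳ x≈) (trans (*-distribʳ-sum z (λ i → c i * y ^ toℕ i)) (sum-cong λ i → *-assoc (c i) (y ^ toℕ i) z))))
        (T′-sum (λ i → c i * (y ^ toℕ i * z)) λ i → T′-scale (c∈T i) (T′-y^ (toℕ i) z∈T′))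

      -- The operators are linear over y and hence act on the coefficients alone.
      T′-E : ∀ j {x} → T′ x → T′ (E (𝒪 j) x)
      T′-E j (c , c∈T , x≈) = (λ i → E (𝒪 j) (c i)) , (λ i → T-E j (c∈T i)) ,
        trans (E-cong (𝒪 j) x≈) (trans (E-sum (𝒪 j) (λ i → c i * y ^ toℕ i))
          (sum-cong λ i → CommutesWith-^ (𝒪 j) (y-constant j) (toℕ i) (c i)))

      y∈T′ : T′ y
      y∈T′ = T′-cong (*-identityʳ y) (T′-y (T⊆T′ T-1))

      generator′ : Fin (suc r ℕ.* rank) → Carrier
      generator′ k = generator (proj₂ (remQuot {suc r} rank k)) * y ^ toℕ (proj₁ (remQuot {suc r} rank k))

      coordinates′ : ∀ {x} → T′ x → Σ[ α ∈ (Fin (suc r ℕ.* rank) → S.Carrier) ] (∀ i → Member (α i)) ×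
        x ≈ sum (λ i → φ (α i) * generator′ i)
      coordinates′ {x} (c , c∈T , x≈) = α , (λ k → proj₁ (proj₂ (coords (proj₁ (remQuot {suc r} rank k)))) (proj₂ (remQuot {suc r} rank k))) , (begin
        x
          ≈⟨ x≈ ⟩
        sum (λ i → c i * y ^ toℕ i)
          ≈⟨ sum-cong (λ i → trans (*-congʳ {y ^ toℕ i} (proj₂ (proj₂ (coords i))))
               (trans (*-distribʳ-sum (y ^ toℕ i) (λ j → φ (β i j) * generator j))
                 (sum-cong λ j → *-assoc (φ (β i j)) (generator j) (y ^ toℕ i)))) ⟩
        sum (λ i → sum (λ j → φ (β i j) * (generator j * y ^ toℕ i)))
          ≈⟨ sum-cong (λ i → sum-cong λ j → reflexive (≡.cong (λ { (i , j) → φ (β i j) * (generator j * y ^ toℕ i) })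
               (≡.sym (Fin.remQuot-combine {suc r} i j)))) ⟩
        sum (λ i → sum (λ j → φ (α (combine {suc r} i j)) * generator′ (combine {suc r} i j)))
          ≈⟨ sum-combine (suc r) rank (λ k → φ (α k) * generator′ k) ⟨
        sum (λ k → φ (α k) * generator′ k) ∎)
        where
        coords : ∀ i → Σ[ α ∈ (Fin rank → S.Carrier) ] (∀ j → Member (α j)) × c i ≈ sum (λ j → φ (α j) * generator j)
        coords i = coordinates (c∈T i)
        β : Fin (suc r) → Fin rank → S.Carrier
        β i = proj₁ (coords i)
        α : Fin (suc r ℕ.* rank) → S.Carrier
        α k = β (proj₁ (remQuot {suc r} rank k)) (proj₂ (remQuot {suc r} rank k))

      extension : FiniteAlgebra 𝒪
      extension = record
        { T = T′ ; T-cong = T′-cong ; T-+ = T′-+ ; T-* = T′-* ; T-φ = T⊆T′ ∘ T-φ ; T-E = T′-E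
        ; rank = suc r ℕ.* rank ; generator = generator′ ; coordinates = coordinates′ }

    record IntegralConstant (y : Carrier) : Set (a ⊔ p ⊔ b ⊔ ℓ₂) where
      field
        degree   : ℕ
        κ        : Fin (suc degree) → S.Carrier
        κ-member : ∀ i → Member (κ i)
        integral : y ^ suc degree ≈ sum (λ i → φ (κ i) * y ^ toℕ i)
        commutes : ∀ j → CommutesWith (𝒪 j) y

    adjoin : ∀ {n} (y : Fin n → Carrier) → (∀ i → IntegralConstant (y i)) →
      Σ[ 𝒜 ∈ FiniteAlgebra 𝒪 ] ∀ i → FiniteAlgebra.T 𝒜 (y i)
    adjoin {zero}  y y-integral = base , λ ()
    adjoin {suc n} y y-integral = extension , λ
      { Fin.zero    → y∈T′
      ; (Fin.suc i) → T⊆T′ (proj₂ rest i) }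
      where
      rest = adjoin (y ∘ Fin.suc) (y-integral ∘ Fin.suc)
      open IntegralConstant (y-integral Fin.zero)
      open Extension (proj₁ rest) (y Fin.zero) degree κ κ-member integral commutes

-- Polynomials and ramification

module _ {a ℓ} (R : CommutativeRing a ℓ) where
  open CommutativeRing R

  Stable : Set (a ⊔ ℓ)
  Stable = ∀ {x} → ¬ ¬ x ≈ 0# → x ≈ 0#

  Cancellative : Set (a ⊔ ℓ)
  Cancellative = ∀ {x y} → x * y ≈ 0# → ¬ x ≈ 0# → y ≈ 0#

-- Power series over a domain

module SeriesDomain {a ℓ} (R : CommutativeRing a ℓ) where
  open RingTools R
  private
    module P = PowerSeries R
    module T = RingTools P.powerSeriesRing

  stable-series : Stable R → Stable P.powerSeriesRing
  stable-series stable ¬¬f≈0 n = stable λ fₙ≉0 → ¬¬f≈0 λ f≈0 → fₙ≉0 (f≈0 n)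

  module _ (stable : Stable R) (cancel : Cancellative R) where

    -- The constant term of g vanishes by cancellation in the base ring, so g = X · tail g and f
    -- annihilates the tail as well.
    cancel-constant : ∀ {f} → ¬ f 0 ≈ 0# → ∀ n g → f T.* g T.≈ T.0# → g n ≈ 0#
    cancel-constant {f} f₀≉0 n g fg≈0 = go n
      where
      g₀≈0 : g 0 ≈ 0#
      g₀≈0 = cancel (trans (sym (+-identityʳ _)) (fg≈0 0)) f₀≉0
      g≈X : g T.≈ P.X T.* P.tail g
      g≈X zero    = trans g₀≈0 (sym (P.X* (P.tail g) 0))
      g≈X (suc n) = sym (P.X* (P.tail g) (suc n))
      X*f*tail : P.X T.* (f T.* P.tail g) T.≈ T.0#
      X*f*tail = T.trans (T.x*yz≈y*xz P.X f (P.tail g)) (T.trans (T.*-congˡ {f} (T.sym g≈X)) fg≈0)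
      f*tail : f T.* P.tail g T.≈ T.0#
      f*tail k = trans (sym (P.X* (f T.* P.tail g) (suc k))) (X*f*tail (suc k))
      go : ∀ n → g n ≈ 0#
      go zero    = g₀≈0
      go (suc n) = cancel-constant {f} f₀≉0 n (P.tail g) f*tail

    cancel-leading : ∀ {f} m → (∀ i → i ℕ.< m → f i ≈ 0#) → ¬ f m ≈ 0# → ∀ {g} → f T.* g T.≈ T.0# → g T.≈ T.0#
    cancel-leading {f} m low fₘ≉0 {g} fg≈0 n = cancel-constant {f′}
      (≡.subst (λ j → ¬ f j ≈ 0#) (≡.sym (ℕ.+-identityʳ m)) fₘ≉0) n g
      (P.X^-cancel m {f′ T.* g} {T.0#} (T.trans (T.sym (T.*-assoc (P.X T.^ m) f′ g))
        (T.trans (T.*-congʳ {g} (T.sym (T.trans (P.leading m f low) (P.↑≈X^* m f′)))) (T.trans fg≈0 (T.sym (T.zeroʳ (P.X T.^ m)))))))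
      where f′ = λ i → f (m ℕ.+ i)

    -- The lowest non-zero coefficient of f cannot be searched for without a bound. Stability allows
    -- assuming g n ≉ 0; then the coefficients of f vanish in turn, each by `cancel-leading`
    -- relative to those before it, against f ≉ 0.
    cancel-series : Cancellative P.powerSeriesRing
    cancel-series {f} {g} fg≈0 f≉0 n = stable λ gₙ≉0 → f≉0 λ k → below gₙ≉0 (suc k) k (ℕ.n<1+n k)
      where
      below : ¬ g n ≈ 0# → ∀ m k → k ℕ.< m → f k ≈ 0#
      below gₙ≉0 (suc m) k (s≤s k≤m) = stable λ fₖ≉0 →
        gₙ≉0 (cancel-leading {f} k (λ i i<k → below gₙ≉0 m i (ℕ.<-≤-trans i<k k≤m)) fₖ≉0 {g} fg≈0 n)

module BivariatePolynomials {a ℓ} (𝔽 : Field a ℓ) where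
  private
    module F = RingTools (Field.commutativeRing 𝔽)
    open Field 𝔽 using (_≟_; invertible; 1≉0)
    module P = PowerSeries (Field.commutativeRing 𝔽)
    module T = RingTools P.powerSeriesRing
    module PP = PowerSeries P.powerSeriesRing

  bivariateRing : CommutativeRing a ℓ
  bivariateRing = PP.powerSeriesRing

  open RingTools bivariateRing

  IsPoly : Carrier → Set ℓ
  IsPoly = IsPolynomial F.rawRing

  private
    stable : Stable (Field.commutativeRing 𝔽)
    stable {x} ¬¬x≈0 with x ≟ F.0#
    ... | yes p = p
    ... | no  p = ⊥-elim (¬¬x≈0 p)

    cancel : Cancellative (Field.commutativeRing 𝔽)
    cancel {x} xy≈0 x≉0 = F.Unit-cancel-0 (invertible x x≉0) xy≈0

  cancel₂ : Cancellative bivariateRing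
  cancel₂ {f} {g} = SeriesDomain.cancel-series P.powerSeriesRing
    (λ {f} → SeriesDomain.stable-series (Field.commutativeRing 𝔽) stable {f})
    (λ {f} {g} → SeriesDomain.cancel-series (Field.commutativeRing 𝔽) stable cancel {f} {g}) {f} {g}

  module _ {a ℓ} (R : CommutativeRing a ℓ) where
    private module R = RingTools R

    product-degree : ∀ m n (f g : ℕ → R.Carrier) → (∀ i → m ℕ.≤ i → f i R.≈ R.0#) → (∀ i → n ℕ.≤ i → g i R.≈ R.0#) →
      ∀ k → m ℕ.+ n ℕ.≤ k → RawRing._*_ (powerSeries R.rawRing) f g k R.≈ R.0#
    product-degree m n f g f≈0 g≈0 k m+n≤k = R.sum-0 {suc k} λ i → term (toℕ i)
      where
      term : ∀ i → f i R.* g (k ∸ i) R.≈ R.0#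
      term i with m ℕ.≤? i
      ... | yes m≤i = R.trans (R.*-congʳ (f≈0 i m≤i)) (R.zeroˡ _)
      ... | no  m≰i = R.trans (R.*-congˡ (g≈0 (k ∸ i) (ℕ.m+n≤o⇒m≤o∸n n
        (ℕ.≤-trans (ℕ.+-monoʳ-≤ n (ℕ.<⇒≤ (ℕ.≰⇒> m≰i))) (ℕ.≤-trans (ℕ.≤-reflexive (ℕ.+-comm n m)) m+n≤k))))) (R.zeroʳ _)

  poly-+ : ∀ {f g} → IsPoly f → IsPoly g → IsPoly (f + g)
  poly-+ (m , p) (n , q) = m ℕ.⊔ n , λ k l →
    λ { (inj₁ h) → F.trans (F.+-cong (p k l (inj₁ (ℕ.≤-trans (ℕ.m≤m⊔n m n) h))) (q k l (inj₁ (ℕ.≤-trans (ℕ.m≤n⊔m m n) h)))) (F.+-identityˡ F.0#)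
      ; (inj₂ h) → F.trans (F.+-cong (p k l (inj₂ (ℕ.≤-trans (ℕ.m≤m⊔n m n) h))) (q k l (inj₂ (ℕ.≤-trans (ℕ.m≤n⊔m m n) h)))) (F.+-identityˡ F.0#) }

  poly-neg : ∀ {f} → IsPoly f → IsPoly (- f)
  poly-neg (m , p) = m , λ k l h → F.trans (F.-‿cong (p k l h)) F.-0#≈0#

  poly-* : ∀ {f g} → IsPoly f → IsPoly g → IsPoly (f * g)
  poly-* {f} {g} (m , p) (n , q) = m ℕ.+ n , λ k l →
    λ { (inj₁ h) → product-degree P.powerSeriesRing m n f g (λ i m≤i j → p i j (inj₁ m≤i)) (λ i n≤i j → q i j (inj₁ n≤i)) k h l
      ; (inj₂ h) → F.trans (P.sum-coefficient {suc k} (λ i → f (toℕ i) T.* g (k ∸ toℕ i)) l)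
          (F.sum-0 {suc k} λ i → product-degree (Field.commutativeRing 𝔽) m n (f (toℕ i)) (g (k ∸ toℕ i))
            (λ j m≤j → p (toℕ i) j (inj₂ m≤j)) (λ j n≤j → q (k ∸ toℕ i) j (inj₂ n≤j)) l h) }

  poly-0 : IsPoly 0#
  poly-0 = 0 , λ _ _ _ → F.refl

  poly-1 : IsPoly 1#
  poly-1 = 1 , λ { (suc k) n _ → F.refl ; zero (suc n) _ → F.refl ; zero zero (inj₁ ()) ; zero zero (inj₂ ()) }

  -- `IsPoly` carries a bound on both exponents, so only b × b coefficients have to be inspected.
  nonzero-coefficient? : ∀ {f} → IsPoly f → (∃[ k ] ∃[ n ] ¬ f k n F.≈ F.0#) ⊎ f ≈ 0#
  nonzero-coefficient? {f} (b , p) with Fin.any? {b} (λ k → Fin.any? {b} λ n → ¬? (f (toℕ k) (toℕ n) ≟ F.0#))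
  ... | yes (k , n , f≉0) = inj₁ (toℕ k , toℕ n , f≉0)
  ... | no  none          = inj₂ zeros
    where
    zeros : f ≈ 0#
    zeros k n with k ℕ.<? b | n ℕ.<? b
    ... | no k≮b  | _       = p k n (inj₁ (ℕ.≮⇒≥ k≮b))
    ... | yes _   | no n≮b  = p k n (inj₂ (ℕ.≮⇒≥ n≮b))
    ... | yes k<b | yes n<b with f k n ≟ F.0#
    ...   | yes q = q
    ...   | no  q = ⊥-elim (none (Fin.fromℕ< k<b , Fin.fromℕ< n<b , λ e → q
      (≡.subst₂ (λ i j → f i j F.≈ F.0#) (Fin.toℕ-fromℕ< k<b) (Fin.toℕ-fromℕ< n<b) e)))

  poly-zero? : ∀ {f} → IsPoly f → Dec (f ≈ 0#)
  poly-zero? p with nonzero-coefficient? p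
  ... | inj₁ (k , n , f≉0) = no λ f≈0 → f≉0 (f≈0 k n)
  ... | inj₂ f≈0           = yes f≈0

  subdomain : DecidableSubdomain bivariateRing ℓ
  subdomain = record
    { Member = IsPoly
    ; Member-+ = λ {f} {g} → poly-+ {f} {g} ; Member-* = λ {f} {g} → poly-* {f} {g} ; Member-neg = λ {f} → poly-neg {f}
    ; Member-0 = poly-0 ; Member-1 = poly-1 ; zero? = poly-zero?
    ; 1≉0 = λ e → 1≉0 (e 0 0) ; cancel = λ {f} {g} → cancel₂ {f} {g} }

-- The substitution z = tᵉ

module Ramification {a ℓ} (R : CommutativeRing a ℓ) (e : ℕ) .{{_ : NonZero e}} where
  open RingTools R
  open SetoidReasoning setoid
  private
    module P = PowerSeries R
    module T = RingTools P.powerSeriesRing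

  ⟪_⟫ : (ℕ → Carrier) → ℕ → Carrier
  ⟪ f ⟫ = ramify rawRing e f

  ramify-multiple : ∀ f m → ⟪ f ⟫ (m ℕ.* e) ≡ f m
  ramify-multiple f m with e ∣? m ℕ.* e
  ... | yes (divides k eq) = ≡.cong f (≡.sym (ℕ.*-cancelʳ-≡ m k e eq))
  ... | no  ¬e∣            = ⊥-elim (¬e∣ (divides m ≡.refl))

  ramify-other : ∀ f n → ¬ e ∣ n → ⟪ f ⟫ n ≡ 0#
  ramify-other f n ¬e∣n with e ∣? n
  ... | yes e∣n = ⊥-elim (¬e∣n e∣n)
  ... | no  _   = ≡.refl

  ramify-cong : ∀ {f g} → f T.≈ g → ⟪ f ⟫ T.≈ ⟪ g ⟫
  ramify-cong f≈g n with e ∣? n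
  ... | yes (divides m _) = f≈g m
  ... | no  _             = refl

  ramify-+ : ∀ f g → ⟪ f T.+ g ⟫ T.≈ ⟪ f ⟫ T.+ ⟪ g ⟫
  ramify-+ f g n with e ∣? n
  ... | yes (divides m _) = refl
  ... | no  _             = sym (+-identityˡ 0#)

  ramify-constant : ∀ x → ⟪ constant rawRing x ⟫ T.≈ constant rawRing x
  ramify-constant x n with e ∣? n
  ramify-constant x zero    | yes (divides zero    _) = refl
  ramify-constant x (suc n) | yes (divides (suc m) _) = refl
  ramify-constant x zero    | yes (divides (suc m) p) = ⊥-elim (ℕ.1+n≢0 (ℕ.m*n≡0⇒m≡0 (suc m) e (≡.sym p)))
  ramify-constant x zero    | no  ¬e∣0                = ⊥-elim (¬e∣0 (divides 0 ≡.refl))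
  ramify-constant x (suc n) | no  _                   = refl

  -- The substitution applied to f = f(0) + z · tail f.
  ramify-step : ∀ f → ⟪ f ⟫ T.≈ constant rawRing (f 0) T.+ P._↑_ ⟪ P.tail f ⟫ e
  ramify-step f n with n ℕ.<? e
  ramify-step f zero    | yes 0<e = begin
    ⟪ f ⟫ 0     ≈⟨ reflexive (ramify-multiple f 0) ⟩
    f 0         ≈⟨ +-identityʳ _ ⟨
    f 0 + 0#    ≈⟨ +-congˡ (P.↑-< e ⟪ P.tail f ⟫ 0<e) ⟨
    f 0 + P._↑_ ⟪ P.tail f ⟫ e 0 ∎
  ramify-step f (suc n) | yes n<e = begin
    ⟪ f ⟫ (suc n)     ≈⟨ reflexive (ramify-other f (suc n) λ e∣n → ℕ.<⇒≱ n<e (∣⇒≤ e∣n)) ⟩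
    0#                ≈⟨ +-identityʳ _ ⟨
    0# + 0#           ≈⟨ +-congˡ (P.↑-< e ⟪ P.tail f ⟫ n<e) ⟨
    0# + P._↑_ ⟪ P.tail f ⟫ e (suc n) ∎
  ramify-step f n | no n≮e = ≡.subst (λ k → ⟪ f ⟫ k ≈ constant rawRing (f 0) k + P._↑_ ⟪ P.tail f ⟫ e k)
    (ℕ.m+[n∸m]≡n (ℕ.≮⇒≥ n≮e)) (begin
      ⟪ f ⟫ (e ℕ.+ k)                   ≈⟨ shifted k ⟩
      ⟪ P.tail f ⟫ k                    ≈⟨ reflexive (≡.sym (P.↑-+ e ⟪ P.tail f ⟫ k)) ⟩
      P._↑_ ⟪ P.tail f ⟫ e (e ℕ.+ k)    ≈⟨ +-identityˡ _ ⟨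
      0# + P._↑_ ⟪ P.tail f ⟫ e (e ℕ.+ k) ≈⟨ +-congʳ (constant-> (e ℕ.+ k) (ℕ.<-≤-trans (ℕ.>-nonZero⁻¹ e) (ℕ.m≤m+n e k))) ⟨
      constant rawRing (f 0) (e ℕ.+ k) + P._↑_ ⟪ P.tail f ⟫ e (e ℕ.+ k) ∎)
    where
    k = n ∸ e
    constant-> : ∀ n → 0 ℕ.< n → constant rawRing (f 0) n ≈ 0#
    constant-> (suc n) _ = refl
    shifted : ∀ k → ⟪ f ⟫ (e ℕ.+ k) ≈ ⟪ P.tail f ⟫ k
    shifted k with e ∣? k
    ... | yes (divides m ≡.refl) = reflexive (ramify-multiple f (suc m))
    ... | no  ¬e∣k               = reflexive (ramify-other f (e ℕ.+ k) λ e∣ → ¬e∣k (∣m+n∣m⇒∣n e∣ ∣-refl))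

  -- Since e > 0, a shift by e makes coefficient n depend on strictly smaller indices; the induction
  -- in `ramify-*` rests on this.
  ↑-local : ∀ n {f g} → (∀ i → i ℕ.< n → f i ≈ g i) → P._↑_ f e n ≈ P._↑_ g e n
  ↑-local n {f} {g} f≈g with n ℕ.<? e
  ... | yes n<e = trans (P.↑-< e f n<e) (sym (P.↑-< e g n<e))
  ... | no  n≮e = ≡.subst (λ j → P._↑_ f e j ≈ P._↑_ g e j) e+k≡n
    (trans (reflexive (P.↑-+ e f k)) (trans (f≈g k (≡.subst (k ℕ.<_) e+k≡n (ℕ.m<n+m k (ℕ.>-nonZero⁻¹ e)))) (reflexive (≡.sym (P.↑-+ e g k)))))
    where
    k = n ∸ e
    e+k≡n = ℕ.m+[n∸m]≡n (ℕ.≮⇒≥ n≮e)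

  private
    C : Carrier → ℕ → Carrier
    C = constant rawRing

  -- Both sides satisfy h = f(0) ⟪ g ⟫ + Xᵉ (...).
  ramify-* : ∀ f g → ⟪ f T.* g ⟫ T.≈ ⟪ f ⟫ T.* ⟪ g ⟫
  ramify-* f g n = below (suc n) f g n (ℕ.n<1+n n)
    where
    left : ∀ f g → ⟪ f T.* g ⟫ T.≈ C (f 0) T.* ⟪ g ⟫ T.+ P._↑_ ⟪ P.tail f T.* g ⟫ e
    left f g = T.trans (ramify-step (f T.* g)) (T.trans
      (T.+-cong (T.trans (P.constant-cong (+-identityʳ _)) (P.constant-homo-* (f 0) (g 0)))
        (T.trans (P.↑-cong e (T.trans (ramify-cong {P.tail (f T.* g)} {C (f 0) T.* P.tail g T.+ P.tail f T.* g} λ k → +-congʳ (sym (P.constant-* (f 0) (P.tail g) k)))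
            (T.trans (ramify-+ (C (f 0) T.* P.tail g) (P.tail f T.* g)) (T.+-congʳ {⟪ P.tail f T.* g ⟫} scaled))))
          (P.↑≈X^* e (C (f 0) T.* ⟪ P.tail g ⟫ T.+ ⟪ P.tail f T.* g ⟫))))
      (T.trans (T.solve 5 (λ a b x u v → a T.:* b T.:+ x T.:* (a T.:* u T.:+ v) T.:= a T.:* (b T.:+ x T.:* u) T.:+ x T.:* v) T.refl
          (C (f 0)) (C (g 0)) (P.X T.^ e) ⟪ P.tail g ⟫ ⟪ P.tail f T.* g ⟫)
        (T.+-cong (T.*-congˡ {C (f 0)} (T.sym (T.trans (ramify-step g) (T.+-congˡ {C (g 0)} (P.↑≈X^* e ⟪ P.tail g ⟫)))))
          (T.sym (P.↑≈X^* e ⟪ P.tail f T.* g ⟫)))))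
      where
      scaled : ⟪ C (f 0) T.* P.tail g ⟫ T.≈ C (f 0) T.* ⟪ P.tail g ⟫
      scaled k = trans (ramify-cong {C (f 0) T.* P.tail g} {λ i → f 0 * g (suc i)} (P.constant-* (f 0) (P.tail g)) k)
        (trans (scale k) (sym (P.constant-* (f 0) ⟪ P.tail g ⟫ k)))
        where
        scale : ∀ k → ⟪ (λ i → f 0 * g (suc i)) ⟫ k ≈ f 0 * ⟪ P.tail g ⟫ k
        scale k with e ∣? k
        ... | yes (divides m _) = refl
        ... | no  _             = sym (zeroʳ (f 0))
    right : ∀ f g → ⟪ f ⟫ T.* ⟪ g ⟫ T.≈ C (f 0) T.* ⟪ g ⟫ T.+ P._↑_ (⟪ P.tail f ⟫ T.* ⟪ g ⟫) e
    right f g = T.trans (T.*-congʳ {⟪ g ⟫} (T.trans (ramify-step f) (T.+-congˡ {C (f 0)} (P.↑≈X^* e ⟪ P.tail f ⟫))))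
      (T.trans (T.solve 4 (λ a x u v → (a T.:+ x T.:* u) T.:* v T.:= a T.:* v T.:+ x T.:* (u T.:* v)) T.refl
          (C (f 0)) (P.X T.^ e) ⟪ P.tail f ⟫ ⟪ g ⟫)
        (T.+-congˡ {C (f 0) T.* ⟪ g ⟫} (T.sym (P.↑≈X^* e (⟪ P.tail f ⟫ T.* ⟪ g ⟫)))))
    below : ∀ m f g n → n ℕ.< m → ⟪ f T.* g ⟫ n ≈ (⟪ f ⟫ T.* ⟪ g ⟫) n
    below (suc m) f g n (s≤s n≤m) = trans (left f g n) (trans
      (+-congˡ (↑-local n {⟪ P.tail f T.* g ⟫} {⟪ P.tail f ⟫ T.* ⟪ g ⟫} λ i i<n → below m (P.tail f) g i (ℕ.<-≤-trans i<n n≤m)))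
      (sym (right f g n)))

-- Algebraic elements

module SeriesMap {a ℓ b ℓ₂} (R : CommutativeRing a ℓ) (S : CommutativeRing b ℓ₂)
  {φ : CommutativeRing.Carrier R → CommutativeRing.Carrier S}
  (φ-hom : IsRingHomomorphism (CommutativeRing.rawRing R) (CommutativeRing.rawRing S) φ) where
  private
    module R = RingTools R
    module S = RingTools S
    module PR = PowerSeries R
    module PS = PowerSeries S
    module TS = RingTools PS.powerSeriesRing
  open Homomorphism.Properties R S φ-hom

  mapSeries : (ℕ → R.Carrier) → ℕ → S.Carrier
  mapSeries f n = φ (f n)

  mapSeries-constant : ∀ x → mapSeries (constant R.rawRing x) TS.≈ constant S.rawRing (φ x)
  mapSeries-constant x zero    = S.refl
  mapSeries-constant x (suc n) = φ-0

  mapSeries-X : mapSeries PR.X TS.≈ PS.X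
  mapSeries-X zero          = φ-0
  mapSeries-X (suc zero)    = φ-1
  mapSeries-X (suc (suc n)) = φ-0

  mapSeries-hom : IsRingHomomorphism (CommutativeRing.rawRing PR.powerSeriesRing) (CommutativeRing.rawRing PS.powerSeriesRing) mapSeries
  mapSeries-hom = Homomorphism.ringHomomorphism PR.powerSeriesRing PS.powerSeriesRing mapSeries
    (λ p n → φ-cong (p n))
    (λ f g n → φ-+ (f n) (g n))
    (λ f g n → S.trans (φ-sum {suc n} (λ i → f (toℕ i) R.* g (n ∸ toℕ i))) (S.sum-cong {suc n} λ i → φ-* (f (toℕ i)) (g (n ∸ toℕ i))))
    (TS.trans (mapSeries-constant R.1#) (PS.constant-cong φ-1))

module _ {a ℓ} (R : CommutativeRing a ℓ) where
  private
    module P = PowerSeries R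

  constant-hom : IsRingHomomorphism (CommutativeRing.rawRing R) (CommutativeRing.rawRing P.powerSeriesRing) (constant (CommutativeRing.rawRing R))
  constant-hom = Homomorphism.ringHomomorphism R P.powerSeriesRing (constant (CommutativeRing.rawRing R))
    P.constant-cong P.constant-homo-+ P.constant-homo-* (CommutativeRing.refl P.powerSeriesRing)

-- Relations over A[z,u]

module Algebraicity {a ℓ b ℓ₂} (𝔽 : Field a ℓ) (L : CommutativeRing b ℓ₂)
  (tight : ∀ x → ¬ RingOps.Unit (CommutativeRing.rawRing L) x → CommutativeRing._≈_ L x (CommutativeRing.0# L))
  (1≉0 : ¬ CommutativeRing._≈_ L (CommutativeRing.1# L) (CommutativeRing.0# L))
  {ι : (ℕ → Field.Carrier 𝔽) → CommutativeRing.Carrier L}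
  (ι-hom : IsRingHomomorphism (powerSeries (Field.rawRing 𝔽)) (CommutativeRing.rawRing L) ι)
  (ι-unit : ∀ f n → ¬ Field._≈_ 𝔽 (f n) (Field.0# 𝔽) → RingOps.Unit (CommutativeRing.rawRing L) (ι f)) where

  private
    module A = RingTools (Field.commutativeRing 𝔽)
    module Az = PowerSeries (Field.commutativeRing 𝔽)
    module Z = RingTools Az.powerSeriesRing
    module B = BivariatePolynomials 𝔽
    module S = RingTools B.bivariateRing
    module L = RingTools L
    module P = PowerSeries L
  Ω : CommutativeRing b ℓ₂
  Ω = P.powerSeriesRing
  open RingTools Ω
  open SeriesMap Az.powerSeriesRing L ι-hom renaming (mapSeries to φ; mapSeries-hom to φ-hom; mapSeries-constant to φ-constant) public
  open Homomorphism.Properties B.bivariateRing Ω φ-hom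
  private
    module ι = Homomorphism.Properties Az.powerSeriesRing L ι-hom
    module const = Homomorphism.Properties L Ω (constant-hom L)

  open FiniteAlgebras B.bivariateRing B.subdomain Ω φ-hom

  const : L.Carrier → Carrier
  const = constant L.rawRing

  cst : (ℕ → A.Carrier) → S.Carrier
  cst = constant Z.rawRing

  *-const : ∀ x w j → (x * const w) j L.≈ x j L.* w
  *-const x w j = L.trans (*-comm x (const w) j) (L.trans (P.constant-* w x j) (L.*-comm w (x j)))

  coefficient : ℕ → Operator
  coefficient j = record
    { E      = λ x → const (x j)
    ; E-cong = λ x≈y → P.constant-cong (x≈y j)
    ; E-+    = λ x y → P.constant-homo-+ (x j) (y j)
    ; E-0    = const.φ-0
    ; E-φ    = λ { {f} (n , p) → cst (f j) , (suc n , λ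
        { zero    l (inj₂ h) → p j l (inj₂ (ℕ.≤-trans (ℕ.n≤1+n n) h))
        ; (suc k) l h        → A.refl }) , sym (φ-constant (f j)) } }

  const-commutes : ∀ w j → CommutesWith (coefficient j) (const w)
  const-commutes w j x = trans (P.constant-cong (*-const x w j)) (P.constant-homo-* (x j) w)

  z : L.Carrier
  z = ι Az.X

  ζ : Carrier
  ζ = const z

  cst-poly : ∀ f b → (∀ n → b ℕ.≤ n → f n A.≈ A.0#) → B.IsPoly (cst f)
  cst-poly f b p = suc b , λ
    { zero    l (inj₂ h) → p l (ℕ.≤-trans (ℕ.n≤1+n b) h)
    ; (suc k) l h        → A.refl }

  cstX-poly : B.IsPoly (cst Az.X)
  cstX-poly = cst-poly Az.X 2 λ { (suc (suc n)) _ → A.refl ; (suc zero) (s≤s ()) }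

  φ-X : φ (cst Az.X) ≈ ζ
  φ-X = φ-constant Az.X

  scalar-poly : ∀ x → B.IsPoly (cst (constant A.rawRing x))
  scalar-poly x = cst-poly (constant A.rawRing x) 1 λ { (suc n) _ → A.refl }

  -- A non-zero coefficient of f k would make the image of f k a unit, and this image is 0.
  φ-injective : ∀ {f} → φ f ≈ 0# → f S.≈ S.0#
  φ-injective {f} φf≈0 k n with Field._≟_ 𝔽 (f k n) A.0#
  ... | yes p = p
  ... | no  p = ⊥-elim (1≉0 (L.trans (L.sym (L.inverseʳ u)) (L.trans (L.*-congʳ (φf≈0 k)) (L.zeroˡ _))))
    where u = ι-unit (f k) n p

  no-zero-divisors : ∀ {x y} → x L.* y L.≈ L.0# → ¬ x L.≈ L.0# → y L.≈ L.0#
  no-zero-divisors = TightRing.no-zero-divisors L tight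

  -- The lowest non-zero coefficient of the relation is a multiple of x.
  unit-from-relation : ∀ n (α : Fin n → S.Carrier) → (∀ i → B.IsPoly (α i)) → (∃[ l ] ¬ α l S.≈ S.0#) →
    ∀ x → ¬ x L.≈ L.0# → sum (λ i → φ (α i) * const x ^ toℕ i) ≈ 0# → L.Unit x
  unit-from-relation (suc n) α α-poly nonzero x x≉0 relation = cases (B.nonzero-coefficient? (α-poly Fin.zero))
    where
    rest : Carrier
    rest = sum {n} (λ i → φ (α (Fin.suc i)) * const x ^ toℕ i)
    expand : φ (α Fin.zero) + const x * rest ≈ 0#
    expand = trans (+-cong (sym (*-identityʳ (φ (α Fin.zero)))) (trans (*-distribˡ-sum {n} (const x) (λ i → φ (α (Fin.suc i)) * const x ^ toℕ i))
      (sum-cong {n} λ i → x*yz≈y*xz (const x) (φ (α (Fin.suc i))) (const x ^ toℕ i)))) relation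
    expand-coefficient : ∀ k → ι (α Fin.zero k) L.+ x L.* rest k L.≈ L.0#
    expand-coefficient k = L.trans (L.+-congˡ (L.sym (P.constant-* x rest k))) (expand k)
    later : α Fin.zero S.≈ S.0# → (∃[ l ] ¬ α l S.≈ S.0#) → ∃[ l ] ¬ α (Fin.suc l) S.≈ S.0#
    later α₀≈0 (Fin.zero  , α₀≉0) = ⊥-elim (α₀≉0 α₀≈0)
    later α₀≈0 (Fin.suc l , αₗ≉0) = l , αₗ≉0
    cases : (∃[ k ] ∃[ m ] ¬ α Fin.zero k m A.≈ A.0#) ⊎ α Fin.zero S.≈ S.0# → L.Unit x
    cases (inj₁ (k , m , α≉0)) = L.Unit-factorˡ {x} {L.- rest k} (L.Unit-cong
      (L.trans (L.+-inverseˡ-unique _ _ (expand-coefficient k)) (L.-‿distribʳ-* x (rest k)))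
      (ι-unit (α Fin.zero k) m α≉0))
    -- The lowest coefficient is 0: one factor x is cancelled, and the shorter relation is still
    -- non-trivial.
    cases (inj₂ α₀≈0) = unit-from-relation n (α ∘ Fin.suc) (α-poly ∘ Fin.suc) (later α₀≈0 nonzero) x x≉0 λ k → no-zero-divisors
      (L.trans (L.sym (L.+-identityˡ _)) (L.trans (L.+-congʳ (L.sym (L.trans (ι.φ-cong (α₀≈0 k)) ι.φ-0))) (expand-coefficient k))) x≉0

  module Localisation (𝒜 : FiniteAlgebra coefficient) where
    open FiniteAlgebra 𝒜

    ζ∈T : T ζ
    ζ∈T = T-cong φ-X (T-φ cstX-poly)

    -- The algebra localised at z. The equation of a root w has leading coefficient -p_d z, so it is
    -- z w that satisfies a monic equation; w itself is reached only after dividing by z.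
    record 𝓛 (x : Carrier) : Set (a ⊔ ℓ ⊔ b ⊔ ℓ₂) where
      constructor _,_
      field
        power-of-ζ : ℕ
        scaled     : T (ζ ^ power-of-ζ * x)

    𝓛-cong : ∀ {x y} → x ≈ y → 𝓛 x → 𝓛 y
    𝓛-cong x≈y (m , t) = m , T-cong (*-congˡ {ζ ^ m} x≈y) t

    T⊆𝓛 : ∀ {x} → T x → 𝓛 x
    T⊆𝓛 {x} t = 0 , T-cong (sym (*-identityˡ x)) t

    rescale : ∀ k {m x} → T (ζ ^ m * x) → T (ζ ^ (k ℕ.+ m) * x)
    rescale k {m} {x} t = T-cong
      (trans (sym (*-assoc (ζ ^ k) (ζ ^ m) x)) (*-congʳ {x} (sym (^-homo-* ζ k m)))) (T-* (T-^ ζ∈T k) t)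

    𝓛-+ : ∀ {x y} → 𝓛 x → 𝓛 y → 𝓛 (x + y)
    𝓛-+ {x} {y} (m , s) (n , t) = m ℕ.+ n , T-cong (sym (distribˡ (ζ ^ (m ℕ.+ n)) x y))
      (T-+ (≡.subst (λ k → T (ζ ^ k * x)) (ℕ.+-comm n m) (rescale n {m} {x} s)) (rescale m {n} {y} t))

    𝓛-* : ∀ {x y} → 𝓛 x → 𝓛 y → 𝓛 (x * y)
    𝓛-* {x} {y} (m , s) (n , t) = m ℕ.+ n , T-cong
      (trans (*-interchange (ζ ^ m) x (ζ ^ n) y) (*-congʳ {x * y} (sym (^-homo-* ζ m n)))) (T-* s t)

    𝓛-φ : ∀ {f} → B.IsPoly f → 𝓛 (φ f)
    𝓛-φ p = T⊆𝓛 (T-φ p)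

    𝓛-neg : ∀ {x} → 𝓛 x → 𝓛 (- x)
    𝓛-neg {x} l = 𝓛-cong (trans (*-congʳ {x} (trans (φ-neg S.1#) (-‿cong φ-1))) (-1*x≈-x x))
      (𝓛-* (𝓛-φ (B.poly-neg {S.1#} B.poly-1)) l)

    𝓛-product : ∀ {n} (f : Fin n → Carrier) → (∀ i → 𝓛 (f i)) → 𝓛 (product f)
    𝓛-product {zero}  f t = T⊆𝓛 T-1
    𝓛-product {suc n} f t = 𝓛-* (t Fin.zero) (𝓛-product (f ∘ Fin.suc) (t ∘ Fin.suc))

    𝓛-ζ : ∀ {x} → 𝓛 (ζ * x) → 𝓛 x
    𝓛-ζ {x} (m , t) = suc m , T-cong (trans (sym (*-assoc (ζ ^ m) ζ x)) (*-congʳ {x} (*-comm (ζ ^ m) ζ))) t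

    ζ^≈ : ∀ m → const (z L.^ m) ≈ ζ ^ m
    ζ^≈ m = const.φ-^ z m

    𝓛-coefficient : ∀ {x} → 𝓛 x → ∀ j → 𝓛 (const (x j))
    𝓛-coefficient {x} (m , t) j = m , T-cong
      (trans (P.constant-cong (L.trans (*-congʳ {x} (sym (ζ^≈ m)) j) (P.constant-* (z L.^ m) x j)))
        (trans (P.constant-homo-* (z L.^ m) (x j)) (*-congʳ {const (x j)} (ζ^≈ m))))
      (T-E j t)

    z-unit : L.Unit z
    z-unit = ι-unit Az.X 1 (Field.1≉0 𝔽)

    𝓛-unit : ∀ {x} → 𝓛 (const x) → ¬ x L.≈ L.0# → L.Unit x
    𝓛-unit {x} (m , t) x≉0 = L.Unit-factorʳ {z L.^ m} {x} (unit-from-relation (suc rank) α α-poly nonzero y y≉0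
      (trans (sum-cong λ i → *-congˡ {φ (α i)} (sym (trans (*-congˡ {const y ^ toℕ i} (1^n≈1 (rank ∸ toℕ i))) (*-identityʳ (const y ^ toℕ i))))) relation))
      where
      y = z L.^ m L.* x
      y≉0 : ¬ y L.≈ L.0#
      y≉0 y≈0 = x≉0 (L.Unit-cancel-0 (L.Unit-^ z-unit m) y≈0)
      y∈T : T (const y)
      y∈T = T-cong (trans (*-congʳ {const x} (sym (ζ^≈ m))) (sym (P.constant-homo-* (z L.^ m) x))) t
      -- With 1 as second element the homogeneous relation becomes an ordinary one between the
      -- powers of y.
      hr = homogeneous-relation y∈T T-1
      α = proj₁ hr
      α-poly = proj₁ (proj₂ hr)
      nonzero = proj₁ (proj₂ (proj₂ hr))
      relation = proj₂ (proj₂ (proj₂ hr))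

    -- For x = f y a homogeneous relation between x and y is y^rank times a relation for f. The
    -- power of y is cancelled in the domain A[[z]][[u]], so y is never inverted.
    𝓛-algebraic : ∀ {f x y} → f S.* y S.≈ x → 𝓛 (φ x) → 𝓛 (φ y) → ¬ y S.≈ S.0# → Algebraic A.rawRing f
    𝓛-algebraic {f} {x} {y} fy≈x (m , s) (n , t) y≉0 = rank , α , α-poly , nonzero ,
      cancel-power rank (S.trans (S.*-distribˡ-sum (y′ S.^ rank) (λ i → α i S.* f S.^ toℕ i)) (S.trans (S.sum-cong term) S-relation))
      where
      M = m ℕ.+ n
      x′ y′ : S.Carrier
      x′ = cst Az.X S.^ M S.* x
      y′ = cst Az.X S.^ M S.* y
      φ-scaled : ∀ w → ζ ^ M * φ w ≈ φ (cst Az.X S.^ M S.* w)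
      φ-scaled w = sym (trans (φ-* (cst Az.X S.^ M) w) (*-congʳ {φ w} (trans (φ-^ (cst Az.X) M) (^-congˡ M φ-X))))
      fy′≈x′ : f S.* y′ S.≈ x′
      fy′≈x′ = S.trans (S.x*yz≈y*xz f (cst Az.X S.^ M) y) (S.*-congˡ {cst Az.X S.^ M} fy≈x)
      hr = homogeneous-relation
        (T-cong (φ-scaled x) (≡.subst (λ k → T (ζ ^ k * φ x)) (ℕ.+-comm n m) (rescale n {m} {φ x} s)))
        (T-cong (φ-scaled y) (rescale m {n} {φ y} t))
      α = proj₁ hr
      α-poly = proj₁ (proj₂ hr)
      nonzero = proj₁ (proj₂ (proj₂ hr))
      -- The relation is found over C((t)); `φ-injective` brings it back to A[[z]][[u]].
      S-relation : S.sum (λ i → α i S.* (x′ S.^ toℕ i S.* y′ S.^ (rank ∸ toℕ i))) S.≈ S.0#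
      S-relation = φ-injective (trans (φ-sum (λ i → α i S.* (x′ S.^ toℕ i S.* y′ S.^ (rank ∸ toℕ i))))
        (trans (sum-cong λ i → trans (φ-* (α i) (x′ S.^ toℕ i S.* y′ S.^ (rank ∸ toℕ i)))
            (*-congˡ {φ (α i)} (trans (φ-* (x′ S.^ toℕ i) (y′ S.^ (rank ∸ toℕ i))) (*-cong (φ-^ x′ (toℕ i)) (φ-^ y′ (rank ∸ toℕ i))))))
          (proj₂ (proj₂ (proj₂ hr)))))
      term : ∀ (i : Fin (suc rank)) → y′ S.^ rank S.* (α i S.* f S.^ toℕ i) S.≈ α i S.* (x′ S.^ toℕ i S.* y′ S.^ (rank ∸ toℕ i))
      term i = S.trans (S.*-congʳ {α i S.* f S.^ k} (S.trans (S.reflexive (≡.cong (y′ S.^_) (≡.sym (ℕ.m+[n∸m]≡n (ℕ.≤-pred (Fin.toℕ<n i))))))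
            (S.^-homo-* y′ k (rank ∸ k))))
        (S.trans (S.solve 4 (λ u v a w → (u S.:* v) S.:* (a S.:* w) S.:= a S.:* ((w S.:* u) S.:* v)) S.refl
            (y′ S.^ k) (y′ S.^ (rank ∸ k)) (α i) (f S.^ k))
          (S.*-congˡ {α i} (S.*-congʳ {y′ S.^ (rank ∸ k)} (S.trans (S.sym (S.^-distrib-* f y′ k)) (S.^-congˡ k fy′≈x′)))))
        where k = toℕ i
      X≉0 : ¬ cst Az.X S.≈ S.0#
      X≉0 e = Field.1≉0 𝔽 (e 0 1)
      cancel-scale : ∀ k {w} → cst Az.X S.^ k S.* w S.≈ S.0# → w S.≈ S.0#
      cancel-scale zero    {w} e = S.trans (S.sym (S.*-identityˡ w)) e
      cancel-scale (suc k) {w} e = cancel-scale k (B.cancel₂ {cst Az.X} {cst Az.X S.^ k S.* w} (S.trans (S.sym (S.*-assoc (cst Az.X) (cst Az.X S.^ k) w)) e) X≉0)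
      y′≉0 : ¬ y′ S.≈ S.0#
      y′≉0 e = y≉0 (cancel-scale M e)
      cancel-power : ∀ k {w} → y′ S.^ k S.* w S.≈ S.0# → w S.≈ S.0#
      cancel-power zero    {w} e = S.trans (S.sym (S.*-identityˡ w)) e
      cancel-power (suc k) {w} e = cancel-power k (B.cancel₂ {y′} {y′ S.^ k S.* w} (S.trans (S.sym (S.*-assoc y′ (y′ S.^ k) w)) e) y′≉0)

-- Walks and first falls

-- Weighted walks on ℕ with steps toℕ i - c of weight p i, killed below 0.
module Transfer {a ℓ} (A : CommutativeRing a ℓ) (c d : ℕ) (p : Fin (suc (c ℕ.+ d)) → CommutativeRing.Carrier A) where
  open RingTools A
  open SetoidReasoning setoid
  private
    module P = PowerSeries A
    module T = RingTools P.powerSeriesRing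
  open P using (_↑_) renaming (monomial to δ; monomial-≡ to δ-≡; monomial-≢ to δ-≢)

  -- Extension by 0. Applied to p it gives the coefficients of uᶜ P(u).
  extend : ∀ {n} → (Fin n → Carrier) → ℕ → Carrier
  extend {zero}  f m       = 0#
  extend {suc n} f zero    = f Fin.zero
  extend {suc n} f (suc m) = extend (f ∘ Fin.suc) m

  extend-toℕ : ∀ {n} (f : Fin n → Carrier) i → extend f (toℕ i) ≡ f i
  extend-toℕ f Fin.zero    = ≡.refl
  extend-toℕ f (Fin.suc i) = extend-toℕ (f ∘ Fin.suc) i

  extend-≥ : ∀ {n} (f : Fin n → Carrier) m → n ℕ.≤ m → extend f m ≡ 0#
  extend-≥ {zero}  f m       _         = ≡.refl
  extend-≥ {suc n} f (suc m) (s≤s n≤m) = extend-≥ (f ∘ Fin.suc) m n≤m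

  -- The target altitude is h + i - c. `g ↑ c` reads g there and is 0 when the subtraction would be
  -- negative, which kills walks going below 0.
  step : (ℕ → Carrier) → ℕ → Carrier
  step g h = sum λ i → p i * (g ↑ c) (h ℕ.+ toℕ i)

  ↑-pointwise : ∀ c {f g} m → (∀ h → c ℕ.+ h ≡ m → f h ≈ g h) → (f ↑ c) m ≈ (g ↑ c) m
  ↑-pointwise zero    m       e = e m ≡.refl
  ↑-pointwise (suc c) zero    e = refl
  ↑-pointwise (suc c) (suc m) e = ↑-pointwise c m λ h h≡ → e h (≡.cong suc h≡)

  step-pointwise : ∀ {f g} h → (∀ h′ → h′ ℕ.≤ h ℕ.+ d → f h′ ≈ g h′) → step f h ≈ step g h
  step-pointwise {f} {g} h e = sum-cong λ i → *-congˡ {p i} (↑-pointwise c (h ℕ.+ toℕ i) λ h′ c+h′≡ → e h′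
    (ℕ.+-cancelˡ-≤ c h′ (h ℕ.+ d) (≡.subst (ℕ._≤ c ℕ.+ (h ℕ.+ d)) (≡.sym c+h′≡)
      (≡.subst (h ℕ.+ toℕ i ℕ.≤_) (≡.trans (≡.sym (ℕ.+-assoc h c d)) (≡.trans (≡.cong (ℕ._+ d) (ℕ.+-comm h c)) (ℕ.+-assoc c h d)))
        (ℕ.+-monoʳ-≤ h (ℕ.≤-pred (Fin.toℕ<n i)))))))

  step-cong : ∀ {f g} h → (∀ h′ → f h′ ≈ g h′) → step f h ≈ step g h
  step-cong h e = step-pointwise h λ h′ _ → e h′

  ↑-0 : ∀ c m → ((λ _ → 0#) ↑ c) m ≈ 0#
  ↑-0 zero    m       = refl
  ↑-0 (suc c) zero    = refl
  ↑-0 (suc c) (suc m) = ↑-0 c m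

  ↑-+ : ∀ c f g m → ((λ h → f h + g h) ↑ c) m ≈ (f ↑ c) m + (g ↑ c) m
  ↑-+ zero    f g m       = refl
  ↑-+ (suc c) f g zero    = sym (+-identityˡ 0#)
  ↑-+ (suc c) f g (suc m) = ↑-+ c f g m

  ↑-scale : ∀ c x f m → ((λ h → x * f h) ↑ c) m ≈ x * (f ↑ c) m
  ↑-scale zero    x f m       = refl
  ↑-scale (suc c) x f zero    = sym (zeroʳ x)
  ↑-scale (suc c) x f (suc m) = ↑-scale c x f m

  step-0 : ∀ h → step (λ _ → 0#) h ≈ 0#
  step-0 h = sum-0 λ i → trans (*-congˡ {p i} (↑-0 c (h ℕ.+ toℕ i))) (zeroʳ (p i))

  step-+ : ∀ f g h → step (λ h′ → f h′ + g h′) h ≈ step f h + step g h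
  step-+ f g h = trans (sum-cong λ i → trans (*-congˡ {p i} (↑-+ c f g (h ℕ.+ toℕ i))) (distribˡ (p i) ((f ↑ c) (h ℕ.+ toℕ i)) ((g ↑ c) (h ℕ.+ toℕ i))))
    (∑-distrib-+ (λ i → p i * (f ↑ c) (h ℕ.+ toℕ i)) (λ i → p i * (g ↑ c) (h ℕ.+ toℕ i)))

  step-scale : ∀ x f h → step (λ h′ → x * f h′) h ≈ x * step f h
  step-scale x f h = trans (sum-cong λ i → trans (*-congˡ {p i} (↑-scale c x f (h ℕ.+ toℕ i))) (x*yz≈y*xz (p i) x ((f ↑ c) (h ℕ.+ toℕ i))))
    (sym (*-distribˡ-sum x (λ i → p i * (f ↑ c) (h ℕ.+ toℕ i))))

  step-sum : ∀ n (x : Fin n → Carrier) (f : Fin n → ℕ → Carrier) h →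
    step (λ h′ → sum (λ j → x j * f j h′)) h ≈ sum (λ j → x j * step (f j) h)
  step-sum zero    x f h = step-0 h
  step-sum (suc n) x f h = trans (step-+ (λ h′ → x Fin.zero * f Fin.zero h′) (λ h′ → sum (λ j → x (Fin.suc j) * f (Fin.suc j) h′)) h)
    (+-cong (step-scale (x Fin.zero) (f Fin.zero) h) (step-sum n (x ∘ Fin.suc) (f ∘ Fin.suc) h))

  -- fall h is the weight of a catastrophe at altitude h.
  firstFall : (ℕ → Carrier) → ℕ → ℕ → Carrier
  firstFall fall h zero          = 0#
  firstFall fall h (suc zero)    = fall h
  firstFall fall h (suc (suc n)) = step (λ h′ → firstFall fall h′ (suc n)) h

  record Walks (M : ℕ → ℕ → ℕ → Carrier) : Set ℓ where
    field
      initial : ∀ h k → M h k 0 ≈ δ h k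
      next  : ∀ h k n → M h k (suc n) ≈ step (λ h′ → M h′ k n) h

  module _ {M : ℕ → ℕ → ℕ → Carrier} (M-walks : Walks M) where
    open Walks M-walks

    private
      shifted-δ : ∀ c k m → ((λ h → δ h k) ↑ c) m ≈ δ m (c ℕ.+ k)
      shifted-δ zero    k m       = refl
      shifted-δ (suc c) k zero    = refl
      shifted-δ (suc c) k (suc m) = shifted-δ c k m

      *-δ : ∀ f h m → (f T.* δ h) m ≈ (f ↑ h) m
      *-δ f h = T.trans (T.*-congˡ {f} (P.↑≈X^* h T.1#)) (T.trans
        (T.solve 2 (λ f x → f T.:* (x T.:* T.:1) T.:= x T.:* f) T.refl f (P.X T.^ h)) (T.sym (P.↑≈X^* h f)))

      extend-δ : ∀ {n} (f : Fin n → Carrier) m → sum (λ i → f i * δ (toℕ i) m) ≈ extend f m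
      extend-δ {zero}  f m       = refl
      extend-δ {suc n} f zero    = trans (+-cong (*-identityʳ _) (sum-0 {n} λ i → zeroʳ (f (Fin.suc i)))) (+-identityʳ _)
      extend-δ {suc n} f (suc m) = trans (+-cong (zeroʳ _) (extend-δ (f ∘ Fin.suc) m)) (+-identityˡ _)

      extend-δ-shifted : ∀ h m → sum (λ i → p i * δ (h ℕ.+ toℕ i) m) ≈ (extend p ↑ h) m
      extend-δ-shifted zero    m       = extend-δ p m
      extend-δ-shifted (suc h) zero    = sum-0 λ i → zeroʳ (p i)
      extend-δ-shifted (suc h) (suc m) = extend-δ-shifted h m

    -- Words grow at the front, so the counts obey a recursion on the first step, whereas the kernel
    -- equation removes the last one. The two agree by induction on the length, since `step` is
    -- linear and commutes with the convolution in k.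
    last-step : ∀ n h k → M h k (suc n) ≈ (extend p T.* (λ k′ → M h k′ n)) (c ℕ.+ k)
    last-step zero    h k = begin
      M h k 1
        ≈⟨ next h k 0 ⟩
      step (λ h′ → M h′ k 0) h
        ≈⟨ step-cong h (λ h′ → initial h′ k) ⟩
      step (λ h′ → δ h′ k) h
        ≈⟨ sum-cong (λ i → *-congˡ {p i} (shifted-δ c k (h ℕ.+ toℕ i))) ⟩
      sum (λ i → p i * δ (h ℕ.+ toℕ i) (c ℕ.+ k))
        ≈⟨ extend-δ-shifted h (c ℕ.+ k) ⟩
      (extend p ↑ h) (c ℕ.+ k)
        ≈⟨ *-δ (extend p) h (c ℕ.+ k) ⟨
      (extend p T.* δ h) (c ℕ.+ k)
        ≈⟨ T.*-congˡ {extend p} (λ k′ → sym (initial h k′)) (c ℕ.+ k) ⟩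
      (extend p T.* (λ k′ → M h k′ 0)) (c ℕ.+ k) ∎
    last-step (suc n) h k = begin
      M h k (suc (suc n))
        ≈⟨ next h k (suc n) ⟩
      step (λ h′ → M h′ k (suc n)) h
        ≈⟨ step-cong h (λ h′ → last-step n h′ k) ⟩
      step (λ h′ → sum {suc (c ℕ.+ k)} (λ j → extend p (toℕ j) * M h′ (c ℕ.+ k ∸ toℕ j) n)) h
        ≈⟨ step-sum (suc (c ℕ.+ k)) (λ j → extend p (toℕ j)) (λ j h′ → M h′ (c ℕ.+ k ∸ toℕ j) n) h ⟩
      sum {suc (c ℕ.+ k)} (λ j → extend p (toℕ j) * step (λ h′ → M h′ (c ℕ.+ k ∸ toℕ j) n) h)
        ≈⟨ sum-cong {suc (c ℕ.+ k)} (λ j → *-congˡ {extend p (toℕ j)} (sym (next h (c ℕ.+ k ∸ toℕ j) n))) ⟩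
      (extend p T.* (λ k′ → M h k′ (suc n))) (c ℕ.+ k) ∎

    high : ∀ n h k → h ℕ.+ n ℕ.* d ℕ.< k → M h k n ≈ 0#
    high zero    h k h<k = trans (initial h k) (δ-≢ h k (ℕ.<⇒≢ (ℕ.≤-<-trans (ℕ.m≤m+n h 0) h<k)))
    high (suc n) h k h<k = trans (next h k n) (trans (step-pointwise h λ h′ h′≤h+d → high n h′ k
      (ℕ.≤-<-trans (≡.subst (h′ ℕ.+ n ℕ.* d ℕ.≤_) (ℕ.+-assoc h d (n ℕ.* d)) (ℕ.+-monoˡ-≤ (n ℕ.* d) h′≤h+d)) h<k)) (step-0 h))

    -- Without its final catastrophe the path is a walk from h to some altitude j. The sum is finite
    -- because `b` exceeds every altitude reachable in n steps.
    firstFall-sum : ∀ fall n h b → h ℕ.+ n ℕ.* d ℕ.< b → firstFall fall h (suc n) ≈ sum {b} (λ j → fall (toℕ j) * M h (toℕ j) n)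
    firstFall-sum fall zero    h b h<b = trans (sym (select b h fall (ℕ.≤-<-trans (ℕ.m≤m+n h 0) h<b)))
      (sum-cong {b} λ j → *-congˡ {fall (toℕ j)} (sym (initial h (toℕ j))))
      where
      select : ∀ b h (f : ℕ → Carrier) → h ℕ.< b → sum {b} (λ j → f (toℕ j) * δ h (toℕ j)) ≈ f h
      select (suc b) zero    f _         = trans (+-cong (*-identityʳ _) (sum-0 {b} λ j → zeroʳ (f (suc (toℕ j))))) (+-identityʳ _)
      select (suc b) (suc h) f (s≤s h<b) = trans (+-cong (zeroʳ _) (select b h (f ∘ suc) h<b)) (+-identityˡ _)
    firstFall-sum fall (suc n) h b h<b = begin
      step (λ h′ → firstFall fall h′ (suc n)) h
        ≈⟨ step-pointwise h (λ h′ h′≤h+d → firstFall-sum fall n h′ b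
             (ℕ.≤-<-trans (≡.subst (h′ ℕ.+ n ℕ.* d ℕ.≤_) (ℕ.+-assoc h d (n ℕ.* d)) (ℕ.+-monoˡ-≤ (n ℕ.* d) h′≤h+d)) h<b)) ⟩
      step (λ h′ → sum {b} (λ j → fall (toℕ j) * M h′ (toℕ j) n)) h
        ≈⟨ step-sum b (fall ∘ toℕ) (λ j h′ → M h′ (toℕ j) n) h ⟩
      sum {b} (λ j → fall (toℕ j) * step (λ h′ → M h′ (toℕ j) n) h)
        ≈⟨ sum-cong {b} (λ j → *-congˡ {fall (toℕ j)} (sym (next h (toℕ j) n))) ⟩
      sum {b} (λ j → fall (toℕ j) * M h (toℕ j) (suc n)) ∎

  -- The first step is either the catastrophe, which contributes fall h · B n, or a jump, after
  -- which the same convolution starts at the new altitude.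
  firstFall-* : ∀ fall (B : ℕ → Carrier) h n →
    (firstFall fall h T.* B) (suc n) ≈ step (λ h′ → (firstFall fall h′ T.* B) n) h + fall h * B n
  firstFall-* fall B h n = trans (+-congʳ (zeroˡ (B (suc n)))) (trans (+-identityˡ _)
    (trans (T.*-congʳ {B} tail-Q n) (trans (T.distribʳ B series (constant rawRing (fall h)) n)
      (+-cong series-* (P.constant-* (fall h) B n)))))
    where
    Q = firstFall fall
    series : ℕ → Carrier
    series m = step (λ h′ → Q h′ m) h
    tail-Q : P.tail (Q h) T.≈ series T.+ constant rawRing (fall h)
    tail-Q zero    = sym (trans (+-congʳ (step-0 h)) (+-identityˡ _))
    tail-Q (suc m) = sym (+-identityʳ _)
    series-* : (series T.* B) n ≈ step (λ h′ → (Q h′ T.* B) n) h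
    series-* = sym (trans
      (step-cong h λ h′ → sum-cong {suc n} λ j → *-comm (Q h′ (toℕ j)) (B (n ∸ toℕ j)))
      (trans (step-sum (suc n) (λ j → B (n ∸ toℕ j)) (λ j h′ → Q h′ (toℕ j)) h)
        (sum-cong {suc n} λ j → *-comm (B (n ∸ toℕ j)) (series (toℕ j)))))

  -- The start h varies because the first step changes it. Leaving G, N and B open covers both F,
  -- where what follows the catastrophe is again F, and D, where N is 0.
  first-fall-decomposition : ∀ fall (G N : ℕ → ℕ → Carrier) (B : ℕ → Carrier) →
    (∀ h → G h 0 ≈ N h 0) →
    (∀ h n → G h (suc n) ≈ step (λ h′ → G h′ n) h + fall h * B n) →
    (∀ h n → N h (suc n) ≈ step (λ h′ → N h′ n) h) →
    ∀ n h → G h n ≈ N h n + (firstFall fall h T.* B) n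
  first-fall-decomposition fall G N B G-0 G-suc N-suc zero    h = trans (G-0 h)
    (sym (trans (+-congˡ (trans (+-identityʳ _) (zeroˡ _))) (+-identityʳ _)))
  first-fall-decomposition fall G N B G-0 G-suc N-suc (suc n) h = begin
    G h (suc n)
      ≈⟨ G-suc h n ⟩
    step (λ h′ → G h′ n) h + fall h * B n
      ≈⟨ +-congʳ (step-cong h (first-fall-decomposition fall G N B G-0 G-suc N-suc n)) ⟩
    step (λ h′ → N h′ n + (firstFall fall h′ T.* B) n) h + fall h * B n
      ≈⟨ +-congʳ (step-+ (λ h′ → N h′ n) (λ h′ → (firstFall fall h′ T.* B) n) h) ⟩
    (step (λ h′ → N h′ n) h + step (λ h′ → (firstFall fall h′ T.* B) n) h) + fall h * B n
      ≈⟨ +-assoc _ _ _ ⟩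
    step (λ h′ → N h′ n) h + (step (λ h′ → (firstFall fall h′ T.* B) n) h + fall h * B n)
      ≈⟨ +-cong (sym (N-suc h n)) (sym (firstFall-* fall B h n)) ⟩
    N h (suc n) + (firstFall fall h T.* B) (suc n) ∎

-- Counting words

module PathCounting {a ℓ₁ ℓ₂} (R : OrderedField a ℓ₁ ℓ₂) (W : Weights R) where
  open RingTools (OrderedField.commutativeRing R)
  open OrderedField R using (_≟_)
  open Weights W
  open Paths R W
  open SetoidReasoning setoid
  private
    A = OrderedField.commutativeRing R
    module P = PowerSeries A
    module T = RingTools P.powerSeriesRing
  open P using (_↑_) renaming (monomial to δ; monomial-≡ to δ-≡; monomial-≢ to δ-≢)
  open Transfer A c d p public

  weightOf : ∀ {ℓ} {Q : Pred (List Step) ℓ} → Decidable Q → ℕ → Carrier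
  weightOf Q? n = totalWeight (filter Q? (words n))

  weightOf-≐ : ∀ {ℓ ℓ′} {Q : Pred (List Step) ℓ} {Q′ : Pred (List Step) ℓ′} (Q? : Decidable Q) (Q′? : Decidable Q′) →
    Q ≐ Q′ → ∀ n → weightOf Q? n ≈ weightOf Q′? n
  weightOf-≐ Q? Q′? Q≐Q′ n = reflexive (≡.cong totalWeight (List.filter-≐ Q? Q′? Q≐Q′ (words n)))

  weightOf-none : ∀ {ℓ} {Q : Pred (List Step) ℓ} (Q? : Decidable Q) → (∀ w → ¬ Q w) → ∀ n → weightOf Q? n ≈ 0#
  weightOf-none Q? none n = reflexive (≡.cong totalWeight (List.filter-none Q? (List.universal none (words n))))

  totalWeight-++ : ∀ xs ys → totalWeight (xs ++ ys) ≈ totalWeight xs + totalWeight ys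
  totalWeight-++ []       ys = sym (+-identityˡ _)
  totalWeight-++ (x ∷ xs) ys = trans (+-congˡ (totalWeight-++ xs ys)) (sym (+-assoc _ _ _))

  totalWeight-∷ : ∀ {ℓ} {Q : Pred (List Step) ℓ} (Q? : Decidable Q) s ws →
    totalWeight (filter Q? (map (s ∷_) ws)) ≈ weight s * totalWeight (filter (λ w → Q? (s ∷ w)) ws)
  totalWeight-∷ Q? s []       = sym (zeroʳ _)
  totalWeight-∷ Q? s (w ∷ ws) with Q? (s ∷ w)
  ... | yes _ = trans (+-congˡ (totalWeight-∷ Q? s ws)) (sym (distribˡ (weight s) _ _))
  ... | no  _ = totalWeight-∷ Q? s ws

  weightOf-suc : ∀ {ℓ} {Q : Pred (List Step) ℓ} (Q? : Decidable Q) n →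
    weightOf Q? (suc n) ≈ sum (λ i → p i * weightOf (λ w → Q? (jump i ∷ w)) n) + q * weightOf (λ w → Q? (catastrophe ∷ w)) n
  weightOf-suc Q? n = jumps id
    where
    -- The enumeration f is generalised because `tabulate` recurses through f ∘ suc.
    jumps : ∀ {m} (f : Fin m → Fin (suc (c ℕ.+ d))) →
      totalWeight (filter Q? (cartesianProductWith _∷_ (map jump (tabulate f) ++ [ catastrophe ]) (words n))) ≈
      sum (λ i → p (f i) * weightOf (λ w → Q? (jump (f i) ∷ w)) n) + q * weightOf (λ w → Q? (catastrophe ∷ w)) n
    jumps {zero}  f = begin
      totalWeight (filter Q? (map (catastrophe ∷_) (words n) ++ []))
        ≡⟨ ≡.cong (totalWeight ∘ filter Q?) (List.++-identityʳ (map (catastrophe ∷_) (words n))) ⟩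
      totalWeight (filter Q? (map (catastrophe ∷_) (words n)))
        ≈⟨ totalWeight-∷ Q? catastrophe (words n) ⟩
      q * weightOf (λ w → Q? (catastrophe ∷ w)) n
        ≈⟨ +-identityˡ _ ⟨
      0# + q * weightOf (λ w → Q? (catastrophe ∷ w)) n ∎
    jumps {suc m} f = begin
      totalWeight (filter Q? (map (s ∷_) (words n) ++ rest))
        ≡⟨ ≡.cong totalWeight (List.filter-++ Q? (map (s ∷_) (words n)) rest) ⟩
      totalWeight (filter Q? (map (s ∷_) (words n)) ++ filter Q? rest)
        ≈⟨ totalWeight-++ (filter Q? (map (s ∷_) (words n))) (filter Q? rest) ⟩
      totalWeight (filter Q? (map (s ∷_) (words n))) + totalWeight (filter Q? rest)
        ≈⟨ +-cong (totalWeight-∷ Q? s (words n)) (jumps (f ∘ Fin.suc)) ⟩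
      p (f Fin.zero) * weightOf (λ w → Q? (s ∷ w)) n +
        (sum (λ i → p (f (Fin.suc i)) * weightOf (λ w → Q? (jump (f (Fin.suc i)) ∷ w)) n) + q * weightOf (λ w → Q? (catastrophe ∷ w)) n)
        ≈⟨ +-assoc _ _ _ ⟨
      sum (λ i → p (f i) * weightOf (λ w → Q? (jump (f i) ∷ w)) n) + q * weightOf (λ w → Q? (catastrophe ∷ w)) n ∎
      where
      s = jump (f Fin.zero)
      rest = cartesianProductWith _∷_ (map jump (tabulate (f ∘ Fin.suc)) ++ [ catastrophe ]) (words n)

  target-jump : ∀ h i → target (jump i) (+ h) ≡ (h ℕ.+ toℕ i) ⊖ c
  target-jump h i = ≡.trans (ℤ.+-comm (+ h) (toℕ i ⊖ c)) (≡.trans (ℤ.distribˡ-⊖-+-pos h (toℕ i) c) (≡.cong (_⊖ c) (ℕ.+-comm (toℕ i) h)))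

  ↑-≥ : ∀ {c} f {m} → c ℕ.≤ m → (f ↑ c) m ≡ f (m ∸ c)
  ↑-≥ f z≤n       = ≡.refl
  ↑-≥ f (s≤s c≤m) = ↑-≥ f c≤m

  negative-target : ∀ {m} → m ℕ.< c → ¬ + 0 ℤ.≤ m ⊖ c
  negative-target {m} m<c 0≤ = ℕ.<⇒≱ m<c (ℕ.m∸n≡0⇒m≤n (ℕ.n≤0⇒n≡0 (ℤ.drop‿+≤+
    (≡.subst (ℤ._≤ + 0) (ℤ.neg-involutive (+ (c ∸ m))) (ℤ.neg-mono-≤ (≡.subst (+ 0 ℤ.≤_) (ℤ.⊖-< m<c) 0≤))))))

  -- A leading jump only moves the starting altitude. This isolates the common part of the
  -- recursions for all meanders, for those without catastrophe and for those ending in one.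
  record JumpClosed {ℓ} (Q : ℤ → Pred (List Step) ℓ) : Set (ℓ ⊔ ℓ₁) where
    field
      to   : ∀ {h i w} → Q h (jump i ∷ w) → (Allowed (jump i) h × + 0 ℤ.≤ target (jump i) h) × Q (target (jump i) h) w
      from : ∀ {h i w} → Allowed (jump i) h × + 0 ℤ.≤ target (jump i) h → Q (target (jump i) h) w → Q h (jump i ∷ w)

  weightOf-jumps : ∀ {ℓ} {Q : ℤ → Pred (List Step) ℓ} (Q? : ∀ h → Decidable (Q h)) → JumpClosed Q → ∀ n h →
    sum (λ i → p i * weightOf (λ w → Q? (+ h) (jump i ∷ w)) n) ≈ step (λ h′ → weightOf (Q? (+ h′)) n) h
  weightOf-jumps {Q = Q} Q? closed n h = sum-cong term
    where
    open JumpClosed closed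
    f : ℕ → Carrier
    f h′ = weightOf (Q? (+ h′)) n
    term : ∀ i → p i * weightOf (λ w → Q? (+ h) (jump i ∷ w)) n ≈ p i * (f ↑ c) (h ℕ.+ toℕ i)
    term i with p i ≟ 0#
    -- `Allowed` rejects a jump of weight 0 while `step` lists it; the factor p i makes both
    -- contributions vanish.
    ... | yes pᵢ≈0 = trans (*-congʳ pᵢ≈0) (trans (zeroˡ _) (sym (trans (*-congʳ pᵢ≈0) (zeroˡ _))))
    ... | no  pᵢ≉0 with c ℕ.≤? h ℕ.+ toℕ i
    ...   | yes c≤ = *-congˡ {p i} (trans
              (weightOf-≐ (λ w → Q? (+ h) (jump i ∷ w)) (Q? (+ (h ℕ.+ toℕ i ∸ c)))
                ( (λ {w} Qw → ≡.subst (λ t → Q t w) target≡ (proj₂ (to Qw)))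
                , (λ {w} Qw → from ((i , ≡.refl , pᵢ≉0) , ≡.subst (+ 0 ℤ.≤_) (≡.sym target≡) (ℤ.+≤+ z≤n))
                                (≡.subst (λ t → Q t w) (≡.sym target≡) Qw))) n)
              (reflexive (≡.sym (↑-≥ f c≤))))
      where
      target≡ : target (jump i) (+ h) ≡ + (h ℕ.+ toℕ i ∸ c)
      target≡ = ≡.trans (target-jump h i) (ℤ.⊖-≥ c≤)
    ...   | no  c≰ = *-congˡ {p i} (trans
              (weightOf-none (λ w → Q? (+ h) (jump i ∷ w)) (λ w Qw → negative-target (ℕ.≰⇒> c≰)
                (≡.subst (+ 0 ℤ.≤_) (target-jump h i) (proj₂ (proj₁ (to Qw))))) n)
              (sym (P.↑-< c f (ℕ.≰⇒> c≰))))

  fall : ℕ → Carrier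
  fall h with allowed? catastrophe (+ h)
  ... | yes _ = q
  ... | no  _ = 0#

  weightOf-fall : ∀ {ℓ ℓ′} {Q : Pred (List Step) ℓ} {Q′ : Pred (List Step) ℓ′} (Q? : Decidable Q) (Q′? : Decidable Q′) h →
    (∀ {w} → Q (catastrophe ∷ w) → Allowed catastrophe (+ h) × Q′ w) →
    (∀ {w} → Allowed catastrophe (+ h) → Q′ w → Q (catastrophe ∷ w)) →
    ∀ n → q * weightOf (λ w → Q? (catastrophe ∷ w)) n ≈ fall h * weightOf Q′? n
  weightOf-fall Q? Q′? h to from n with allowed? catastrophe (+ h)
  ... | yes ok = *-congˡ {q} (weightOf-≐ (λ w → Q? (catastrophe ∷ w)) Q′? ((λ Qw → proj₂ (to Qw)) , from ok) n)
  ... | no ¬ok = trans (*-congˡ {q} (weightOf-none (λ w → Q? (catastrophe ∷ w)) (λ w Qw → ¬ok (proj₁ (to Qw))) n))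
    (trans (zeroʳ q) (sym (zeroˡ _)))

  -- F from an arbitrary starting altitude h, as the recursion on the first step requires; F k is
  -- the case h = 0.
  Fall : ℕ → ℕ → ℕ → Carrier
  Fall k h = weightOf (meander? (+ k) (+ h))

  meander-closed : ∀ k → JumpClosed (Meander (+ k))
  meander-closed k = record { to = λ { (x ∷ y) → x , y } ; from = _∷_ }

  Fall-suc : ∀ k h n → Fall k h (suc n) ≈ step (λ h′ → Fall k h′ n) h + fall h * F k n
  Fall-suc k h n = trans (weightOf-suc (meander? (+ k) (+ h)) n)
    (+-cong (weightOf-jumps (meander? (+ k)) (meander-closed k) n h)
      (weightOf-fall (meander? (+ k) (+ h)) (meander? (+ k) (+ 0)) h
        (λ { ((ok , _) ∷ m) → ok , m }) (λ ok m → (ok , ℤ.≤-refl) ∷ m) n))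

  JumpMeander : ℕ → ℤ → Pred (List Step) ℓ₁
  JumpMeander k h w = Meander (+ k) h w × All IsJump w

  jumpMeander? : ∀ k h → Decidable (JumpMeander k h)
  jumpMeander? k h w = meander? (+ k) h w ×-dec List.all? isJump? w

  Mall : ℕ → ℕ → ℕ → Carrier
  Mall h k = weightOf (jumpMeander? k (+ h))

  jumpMeander-closed : ∀ k → JumpClosed (JumpMeander k)
  jumpMeander-closed k = record
    { to   = λ { (x ∷ y , _ ∷ jumps) → x , y , jumps }
    ; from = λ { x (y , jumps) → x ∷ y , tt ∷ jumps } }

  Mall-suc : ∀ h k n → Mall h k (suc n) ≈ step (λ h′ → Mall h′ k n) h
  Mall-suc h k n = trans (weightOf-suc (jumpMeander? k (+ h)) n)
    (trans (+-cong (weightOf-jumps (jumpMeander? k) (jumpMeander-closed k) n h)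
        (trans (*-congˡ {q} (weightOf-none (λ w → jumpMeander? k (+ h) (catastrophe ∷ w)) (λ { w (_ , () ∷ _) }) n)) (zeroʳ q)))
      (+-identityʳ _))

  empty-weight : ∀ {ℓ} {Q : Pred (List Step) ℓ} (Q? : Decidable Q) → Q [] → weightOf Q? 0 ≈ 1#
  empty-weight Q? Q[] with Q? []
  ... | yes _   = +-identityʳ 1#
  ... | no ¬Q[] = ⊥-elim (¬Q[] Q[])

  no-empty-weight : ∀ {ℓ} {Q : Pred (List Step) ℓ} (Q? : Decidable Q) → ¬ Q [] → weightOf Q? 0 ≈ 0#
  no-empty-weight Q? ¬Q[] with Q? []
  ... | yes Q[] = ⊥-elim (¬Q[] Q[])
  ... | no  _   = refl

  meander-[] : ∀ {k h} → Meander (+ k) (+ h) [] → h ≡ k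
  meander-[] [] = ≡.refl

  Mall-walks : Walks Mall
  Mall-walks = record { initial = initial ; next = Mall-suc }
    where
    initial : ∀ h k → Mall h k 0 ≈ δ h k
    initial h k with h ℕ.≟ k
    ... | yes ≡.refl = trans (empty-weight (jumpMeander? k (+ k)) ([] , [])) (sym (δ-≡ k))
    ... | no  h≢k    = trans (no-empty-weight (jumpMeander? k (+ h)) (λ m → h≢k (meander-[] (proj₁ m)))) (sym (δ-≢ h k h≢k))

  Fall-0 : ∀ k h → Fall k h 0 ≈ Mall h k 0
  Fall-0 k h with h ℕ.≟ k
  ... | yes ≡.refl = trans (empty-weight (meander? (+ k) (+ k)) []) (sym (empty-weight (jumpMeander? k (+ k)) ([] , [])))
  ... | no  h≢k    = trans (no-empty-weight (meander? (+ k) (+ h)) (h≢k ∘ meander-[]))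
    (sym (no-empty-weight (jumpMeander? k (+ h)) (λ m → h≢k (meander-[] (proj₁ m)))))

  -- `Any` excludes the empty path. With `All`, as in `D`, a leading jump could not be removed: the
  -- empty word qualifies, but a single jump does not.
  Catastrophic : ℤ → Pred (List Step) ℓ₁
  Catastrophic h w = Meander (+ 0) h w × MaybeAny.Any IsCatastrophe (last w)

  catastrophic? : ∀ h → Decidable (Catastrophic h)
  catastrophic? h w = meander? (+ 0) h w ×-dec MaybeAny.dec isCatastrophe? (last w)

  DPred : Pred (List Step) ℓ₁
  DPred w = Meander (+ 0) (+ 0) w × Maybe.All IsCatastrophe (last w)

  DPred? : Decidable DPred
  DPred? w = meander? (+ 0) (+ 0) w ×-dec Maybe.dec isCatastrophe? (last w)

  D⁺ : ℕ → ℕ → Carrier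
  D⁺ h = weightOf (catastrophic? (+ h))

  catastrophic-closed : JumpClosed Catastrophic
  catastrophic-closed = record { to = to ; from = λ { {w = []} x (y , ()) ; {w = _ ∷ _} x (y , l) → x ∷ y , l } }
    where
    to : ∀ {h i w} → Catastrophic h (jump i ∷ w) → (Allowed (jump i) h × + 0 ℤ.≤ target (jump i) h) × Catastrophic (target (jump i) h) w
    to {w = []}    (_ , MaybeAny.just ())
    to {w = _ ∷ _} (x ∷ y , l) = x , y , l

  any⇒all : ∀ {s} → MaybeAny.Any IsCatastrophe s → Maybe.All IsCatastrophe s
  any⇒all (MaybeAny.just x) = Maybe.just x

  all⇒any : ∀ s w → Maybe.All IsCatastrophe (last (s ∷ w)) → MaybeAny.Any IsCatastrophe (last (s ∷ w))
  all⇒any s []      (Maybe.just x) = MaybeAny.just x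
  all⇒any s (t ∷ w) l              = all⇒any t w l

  -- After a leading catastrophe the rest may be empty, hence `D` and not `D⁺` in the last term.
  D⁺-suc : ∀ h n → D⁺ h (suc n) ≈ step (λ h′ → D⁺ h′ n) h + fall h * D n
  D⁺-suc h n = trans (weightOf-suc (catastrophic? (+ h)) n)
    (+-cong (weightOf-jumps catastrophic? catastrophic-closed n h)
      (weightOf-fall (catastrophic? (+ h)) DPred? h to from n))
    where
    to : ∀ {w} → Catastrophic (+ h) (catastrophe ∷ w) → Allowed catastrophe (+ h) × DPred w
    to {[]}    ((ok , _) ∷ m , _)               = ok , m , Maybe.nothing
    to {_ ∷ w} ((ok , _) ∷ m , l)               = ok , m , any⇒all l
    from : ∀ {w} → Allowed catastrophe (+ h) → DPred w → Catastrophic (+ h) (catastrophe ∷ w)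
    from {[]}    ok (m , _) = (ok , ℤ.≤-refl) ∷ m , MaybeAny.just tt
    from {s ∷ w} ok (m , l) = (ok , ℤ.≤-refl) ∷ m , all⇒any s w l

  D-suc : ∀ n → D (suc n) ≈ D⁺ 0 (suc n)
  D-suc n = trans (weightOf-suc DPred? n) (trans
    (+-cong (sum-cong λ i → *-congˡ {p i} (same (jump i))) (*-congˡ {q} (same catastrophe)))
    (sym (weightOf-suc (catastrophic? (+ 0)) n)))
    where
    same : ∀ s → weightOf (λ w → DPred? (s ∷ w)) n ≈ weightOf (λ w → catastrophic? (+ 0) (s ∷ w)) n
    same s = weightOf-≐ (λ w → DPred? (s ∷ w)) (λ w → catastrophic? (+ 0) (s ∷ w))
      ((λ {w} (m , l) → m , all⇒any s w l) , (λ (m , l) → m , any⇒all l)) n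

  -- The combinatorial reading of Q: paths from 0 whose only catastrophe is their last step.
  Q₀ : ℕ → Carrier
  Q₀ = firstFall fall 0

  F-decomposition : ∀ k → F k T.≈ M k T.+ Q₀ T.* F k
  F-decomposition k n = first-fall-decomposition fall (λ h → Fall k h) (λ h → Mall h k) (F k)
    (Fall-0 k) (Fall-suc k) (λ h n → Mall-suc h k n) n 0

  D-decomposition : D T.≈ T.1# T.+ Q₀ T.* D
  D-decomposition zero    = trans (empty-weight DPred? ([] , Maybe.nothing))
    (sym (trans (+-congˡ (trans (+-identityʳ _) (zeroˡ _))) (+-identityʳ _)))
  D-decomposition (suc n) = trans (D-suc n) (first-fall-decomposition fall D⁺ (λ _ _ → 0#) D
    (λ h → no-empty-weight (catastrophic? (+ h)) λ { (_ , ()) }) D⁺-suc (λ h n → sym (step-0 h)) (suc n) 0)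

  -- The series Q and the total M(z,1)

  private
    module PP = PowerSeries P.powerSeriesRing
    module S = RingTools PP.powerSeriesRing

  sum-bounded : ∀ {m} (f : ℕ → Carrier) k → (∀ j → m ℕ.≤ j → f j ≈ 0#) → sum {k ℕ.+ m} (f ∘ toℕ) ≈ sum {m} (f ∘ toℕ)
  sum-bounded f zero    f≈0 = refl
  sum-bounded {m} f (suc k) f≈0 = trans (sum-last (k ℕ.+ m) f) (trans (+-cong (sum-bounded f k f≈0) (f≈0 (k ℕ.+ m) (ℕ.m≤n+m m k))) (+-identityʳ _))

  indicator : ℕ → Carrier
  indicator j with (ℤ.- + j) ∈𝒥?
  ... | yes _ = 1#
  ... | no  _ = 0#

  indicator-yes : ∀ j → (ℤ.- + j) ∈𝒥 → indicator j ≈ 1#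
  indicator-yes j x with (ℤ.- + j) ∈𝒥?
  ... | yes _ = refl
  ... | no ¬x = ⊥-elim (¬x x)

  indicator-no : ∀ j → ¬ (ℤ.- + j) ∈𝒥 → indicator j ≈ 0#
  indicator-no j ¬x with (ℤ.- + j) ∈𝒥?
  ... | yes x = ⊥-elim (¬x x)
  ... | no  _ = refl

  fall-0 : fall 0 ≈ 0#
  fall-0 with allowed? catastrophe (+ 0)
  ... | yes (ℤ.+<+ () , _)
  ... | no  _ = refl

  fall-suc : ∀ j → fall (suc j) ≈ q * (1# - indicator (suc j))
  fall-suc j with allowed? catastrophe (+ suc j) | (ℤ.- + suc j) ∈𝒥?
  ... | yes (_ , ¬j) | yes j = ⊥-elim (¬j j)
  ... | yes _        | no  _  = solve 1 (λ q → q := q :* (:1 :- :0)) refl q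
  ... | no  _        | yes _  = solve 1 (λ q → :0 := q :* (:1 :- :1)) refl q
  ... | no  ¬ok      | no ¬j  = ⊥-elim (¬ok (ℤ.+<+ (s≤s z≤n) , ¬j))

  -- No jump goes down by more than c, so the sum over all altitudes shrinks to the range 1, ..., c
  -- that occurs in `Q`.
  indicator-> : ∀ j → c ℕ.≤ j → indicator (suc j) ≈ 0#
  indicator-> j c≤j with (ℤ.- + suc j) ∈𝒥?
  ... | no  _           = refl
  ... | yes (i , e , _) = ⊥-elim (impossible (toℕ i) c c≤j e)
    where
    +≢- : ∀ {m n} → + m ≢ -[1+ n ]
    +≢- ()
    impossible : ∀ i c → c ℕ.≤ j → i ⊖ c ≢ -[1+ j ]
    impossible i c c≤j e with c ℕ.≤? i
    ... | yes c≤i = +≢- (≡.trans (≡.sym (ℤ.⊖-≥ c≤i)) e)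
    ... | no  c≰i = ℕ.<⇒≱ (s≤s c≤j) (ℕ.≤-trans (ℕ.≤-reflexive (≡.sym (ℤ.+-injective
      (≡.trans (≡.sym (ℤ.neg-involutive (+ (c ∸ i)))) (≡.cong ℤ.-_ (≡.trans (≡.sym (ℤ.⊖-< (ℕ.≰⇒> c≰i))) e)))))) (ℕ.m∸n≤m c i))

  filtered-sum : ∀ m (f : ℕ → ℕ) n →
    foldr T._+_ T.0# (map M (filter (λ j → (ℤ.- + j) ∈𝒥?) (applyUpTo f m))) n ≈ sum {m} (λ j → indicator (f (toℕ j)) * M (f (toℕ j)) n)
  filtered-sum zero    f n = refl
  filtered-sum (suc m) f n = cases ((ℤ.- + f 0) ∈𝒥?)
    where
    member? = λ j → (ℤ.- + j) ∈𝒥?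
    total : List ℕ → Carrier
    total js = foldr T._+_ T.0# (map M js) n
    cases : Dec ((ℤ.- + f 0) ∈𝒥) → total (filter member? (applyUpTo f (suc m))) ≈
      indicator (f 0) * M (f 0) n + sum {m} (λ j → indicator (f (suc (toℕ j))) * M (f (suc (toℕ j))) n)
    cases (yes j) = trans (reflexive (≡.cong total (List.filter-accept member? {xs = applyUpTo (f ∘ suc) m} j)))
      (+-cong (sym (trans (*-congʳ (indicator-yes (f 0) j)) (*-identityˡ _))) (filtered-sum m (f ∘ suc) n))
    cases (no ¬j) = trans (reflexive (≡.cong total (List.filter-reject member? {xs = applyUpTo (f ∘ suc) m} ¬j)))
      (trans (filtered-sum m (f ∘ suc) n) (sym (trans (+-congʳ (trans (*-congʳ (indicator-no (f 0) ¬j)) (zeroˡ _))) (+-identityˡ _))))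

  M-high : ∀ n k → suc (n ℕ.* d) ℕ.≤ k → M k n ≈ 0#
  M-high n k = high Mall-walks n 0 k

  -- The final catastrophe contributes z q; before it the path ends at any altitude except 0 and
  -- those j with -j in 𝒥, which are the terms subtracted from M(z,1).
  Q₀≈Q : Q₀ T.≈ Q
  Q₀≈Q zero    = sym (trans (T.*-assoc (variable′ rawRing) (constant rawRing q) body 0) (P.X* (constant rawRing q T.* body) 0))
    where
    body = M₁ T.- E T.- foldr T._+_ T.0# (map M (filter (λ j → (ℤ.- + j) ∈𝒥?) (applyUpTo suc c)))
  Q₀≈Q (suc n) = begin
    Q₀ (suc n)
      -- The bound n d + c + 1 is above the highest reachable altitude n d and also above c, so both
      -- the sum for M(z,1) and the one over 𝒥 fit below it.
      ≈⟨ firstFall-sum Mall-walks fall n 0 (suc (n ℕ.* d ℕ.+ c)) (s≤s (ℕ.m≤m+n _ c)) ⟩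
    fall 0 * m 0 + sum {N} (λ j → fall (suc (toℕ j)) * m (suc (toℕ j)))
      ≈⟨ +-cong (trans (*-congʳ fall-0) (zeroˡ _)) (trans
           (sum-cong {N} λ j → trans (*-congʳ {m (suc (toℕ j))} (fall-suc (toℕ j)))
             (solve 3 (λ q x y → q :* (:1 :- x) :* y := q :* y :+ (:- q) :* (x :* y)) refl q (indicator (suc (toℕ j))) (m (suc (toℕ j)))))
           (∑-distrib-+ {N} (λ j → q * m (suc (toℕ j))) (λ j → - q * (indicator (suc (toℕ j)) * m (suc (toℕ j)))))) ⟩
    0# + (sum {N} (λ j → q * m (suc (toℕ j))) + sum {N} (λ j → - q * (indicator (suc (toℕ j)) * m (suc (toℕ j)))))
      ≈⟨ +-congˡ (+-cong (*-distribˡ-sum {N} q (λ j → m (suc (toℕ j)))) (*-distribˡ-sum {N} (- q) (λ j → indicator (suc (toℕ j)) * m (suc (toℕ j))))) ⟨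
    0# + (q * sum {N} (λ j → m (suc (toℕ j))) + - q * sum {N} (λ j → indicator (suc (toℕ j)) * m (suc (toℕ j))))
      ≈⟨ solve 4 (λ q x y m → :0 :+ (q :* x :+ (:- q) :* y) := q :* ((m :+ x) :- m :- y)) refl q _ _ (m 0) ⟩
    q * ((m 0 + sum {N} (λ j → m (suc (toℕ j)))) - m 0 - sum {N} (λ j → indicator (suc (toℕ j)) * m (suc (toℕ j))))
      ≈⟨ *-congˡ (+-cong (+-congʳ all) (-‿cong (trans
           (sum-bounded (λ j → indicator (suc j) * m (suc j)) (n ℕ.* d) (λ j c≤j → trans (*-congʳ (indicator-> j c≤j)) (zeroˡ _)))
           (sym (filtered-sum c suc n))))) ⟩
    q * body n
      ≈⟨ P.constant-* q body n ⟨
    (constant rawRing q T.* body) n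
      ≈⟨ P.X* (constant rawRing q T.* body) (suc n) ⟨
    (variable′ rawRing T.* (constant rawRing q T.* body)) (suc n)
      ≈⟨ T.*-assoc (variable′ rawRing) (constant rawRing q) body (suc n) ⟨
    Q (suc n) ∎
    where
    N = n ℕ.* d ℕ.+ c
    m : ℕ → Carrier
    m k = M k n
    body = M₁ T.- E T.- foldr T._+_ T.0# (map M (filter (λ j → (ℤ.- + j) ∈𝒥?) (applyUpTo suc c)))
    all : m 0 + sum {N} (λ j → m (suc (toℕ j))) ≈ M₁ n
    all = trans (reflexive (≡.cong (λ k → sum {suc k} (m ∘ toℕ)) (ℕ.+-comm (n ℕ.* d) c)))
      (trans (reflexive (≡.cong (λ k → sum {k} (m ∘ toℕ)) (≡.sym (ℕ.+-suc c (n ℕ.* d))))) (sum-bounded m c (M-high n)))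

  D*[1-Q]≈1 : D T.* (T.1# T.- Q) T.≈ T.1#
  D*[1-Q]≈1 = T.trans (T.solve 2 (λ d q → d T.:* (T.:1 T.:- q) T.:= d T.:- q T.:* d) T.refl D Q)
    (T.trans (T.+-cong {D} {T.1# T.+ Q₀ T.* D} D-decomposition (T.-‿cong (T.*-congʳ {D} (T.sym Q₀≈Q))))
      (T.solve 1 (λ x → T.:1 T.:+ x T.:- x T.:= T.:1) T.refl (Q₀ T.* D)))

  F≈D*M : ∀ k → F k T.≈ D T.* M k
  F≈D*M k = T.trans (T.sym (T.*-identityˡ (F k))) (T.trans (T.*-congʳ {F k} (T.sym D*[1-Q]≈1))
    (T.trans (T.*-assoc D (T.1# T.- Q) (F k)) (T.*-congˡ {D} (T.trans
      (T.solve 2 (λ f q → (T.:1 T.:- q) T.:* f T.:= f T.:- q T.:* f) T.refl (F k) Q)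
      (T.trans (T.+-cong {F k} {M k T.+ Q₀ T.* F k} (F-decomposition k) (T.-‿cong (T.*-congʳ {F k} (T.sym Q₀≈Q))))
        (T.solve 2 (λ m x → m T.:+ x T.:- x T.:= m) T.refl (M k) (Q₀ T.* F k)))))))

  -- uᶜ P(u), with coefficients constant in z.
  steps : ℕ → ℕ → Carrier
  steps i = constant rawRing (extend p i)

  steps*M : ∀ j n → (steps S.* M) j n ≈ (extend p T.* (λ k → M k n)) j
  steps*M j n = trans (P.sum-coefficient {suc j} (λ i → steps (toℕ i) T.* M (j ∸ toℕ i)) n)
    (sum-cong {suc j} λ i → P.constant-* (extend p (toℕ i)) (M (j ∸ toℕ i)) n)

  -- The index c + k keeps only the coefficients from uᶜ on; those below belong to last jumps ending
  -- under altitude 0.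
  M-last-step : ∀ k → M k T.≈ (S.1# k) T.+ P.X T.* (steps S.* M) (c ℕ.+ k)
  M-last-step k zero    = trans (Walks.initial Mall-walks 0 k) (sym (trans (+-congˡ (P.X* ((steps S.* M) (c ℕ.+ k)) 0)) (trans (+-identityʳ _) (δ₀ k))))
    where
    δ₀ : ∀ k → S.1# k 0 ≈ δ 0 k
    δ₀ zero    = refl
    δ₀ (suc k) = refl
  M-last-step k (suc n) = trans (last-step Mall-walks n 0 k) (sym (trans (+-cong (δ₀ k) (trans (P.X* ((steps S.* M) (c ℕ.+ k)) (suc n)) (steps*M (c ℕ.+ k) n))) (+-identityˡ _)))
    where
    δ₀ : ∀ k → S.1# k (suc n) ≈ 0#
    δ₀ zero    = refl
    δ₀ (suc k) = refl

  -- Evaluation at u = 1 is multiplicative on polynomials.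
  sum-* : ∀ a b (f g : ℕ → Carrier) → (∀ i → a ℕ.≤ i → f i ≈ 0#) → (∀ i → b ℕ.≤ i → g i ≈ 0#) →
    sum {a ℕ.+ b} ((f T.* g) ∘ toℕ) ≈ sum {a} (f ∘ toℕ) * sum {b} (g ∘ toℕ)
  sum-* zero    b f g f≈0 g≈0 = trans (sum-0 {b} λ j → sum-0 {suc (toℕ j)} λ i → trans (*-congʳ {g (toℕ j ∸ toℕ i)} (f≈0 (toℕ i) z≤n)) (zeroˡ (g (toℕ j ∸ toℕ i)))) (sym (zeroˡ _))
  sum-* (suc a) b f g f≈0 g≈0 = begin
    (f 0 * g 0 + 0#) + sum {a ℕ.+ b} (λ j → f 0 * g (suc (toℕ j)) + (P.tail f T.* g) (toℕ j))
      ≈⟨ +-cong (+-identityʳ _) (∑-distrib-+ {a ℕ.+ b} (λ j → f 0 * g (suc (toℕ j))) ((P.tail f T.* g) ∘ toℕ)) ⟩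
    f 0 * g 0 + (sum {a ℕ.+ b} (λ j → f 0 * g (suc (toℕ j))) + sum {a ℕ.+ b} ((P.tail f T.* g) ∘ toℕ))
      ≈⟨ +-assoc _ _ _ ⟨
    (f 0 * g 0 + sum {a ℕ.+ b} (λ j → f 0 * g (suc (toℕ j)))) + sum {a ℕ.+ b} ((P.tail f T.* g) ∘ toℕ)
      ≈⟨ +-cong (sym (*-distribˡ-sum {suc (a ℕ.+ b)} (f 0) (g ∘ toℕ))) (sum-* a b (P.tail f) g (λ i a≤i → f≈0 (suc i) (s≤s a≤i)) g≈0) ⟩
    f 0 * sum {suc a ℕ.+ b} (g ∘ toℕ) + sum {a} (P.tail f ∘ toℕ) * sum {b} (g ∘ toℕ)
      ≈⟨ +-congʳ (*-congˡ (sum-bounded g (suc a) g≈0)) ⟩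
    f 0 * sum {b} (g ∘ toℕ) + sum {a} (P.tail f ∘ toℕ) * sum {b} (g ∘ toℕ)
      ≈⟨ distribʳ _ _ _ ⟨
    sum {suc a} (f ∘ toℕ) * sum {b} (g ∘ toℕ) ∎

  sum-split : ∀ a b (f : ℕ → Carrier) → sum {a ℕ.+ b} (f ∘ toℕ) ≈ sum {a} (f ∘ toℕ) + sum {b} (λ j → f (a ℕ.+ toℕ j))
  sum-split zero    b f = sym (+-identityˡ _)
  sum-split (suc a) b f = trans (+-congˡ (sum-split a b (f ∘ suc))) (sym (+-assoc _ _ _))

  -- The value P(1).
  σ : Carrier
  σ = sum p

  -- The last-jump equation at u = 1. The sum on the right removes the jumps that would end below 0
  -- and involves only M_0, ..., M_(c-1); so M(z,1) is obtained from finitely many coefficients of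
  -- M.
  M₁-equation : (T.1# T.- P.X T.* constant rawRing σ) T.* M₁ T.≈ T.1# T.- P.X T.* T.sum {c} (λ j → (steps S.* M) (toℕ j))
  M₁-equation = T.trans
    (T.solve 3 (λ x s m → (T.:1 T.:- x T.:* s) T.:* m T.:= m T.:- x T.:* (s T.:* m)) T.refl P.X (constant rawRing σ) M₁)
    (λ n → trans (+-congˡ (-‿cong (P.X* (constant rawRing σ T.* M₁) n))) (trans (equation n) (+-congˡ (-‿cong (sym (P.X* boundary n))))))
    where
    boundary : ℕ → Carrier
    boundary = T.sum {c} (λ j → (steps S.* M) (toℕ j))
    equation : ∀ n → M₁ n - ((constant rawRing σ T.* M₁) ↑ 1) n ≈ T.1# n - (boundary ↑ 1) n
    equation zero    = +-congʳ (trans (+-identityʳ _) (Walks.initial Mall-walks 0 0))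
    equation (suc n) = begin
      M₁ (suc n) - (constant rawRing σ T.* M₁) n
        ≈⟨ +-cong total (-‿cong (P.constant-* σ M₁ n)) ⟩
      sum {b} (λ k → g (c ℕ.+ toℕ k)) - σ * M₁ n
        ≈⟨ solve 3 (λ x y s → y :- s := (x :+ y) :- s :- x) refl (sum {c} (g ∘ toℕ)) _ _ ⟩
      (sum {c} (g ∘ toℕ) + sum {b} (λ k → g (c ℕ.+ toℕ k))) - σ * M₁ n - sum {c} (g ∘ toℕ)
        ≈⟨ +-congʳ (trans (+-congʳ (trans (sym (sum-split c b g)) whole)) (-‿inverseʳ _)) ⟩
      0# - sum {c} (g ∘ toℕ)
        ≈⟨ +-congˡ (-‿cong (trans (P.sum-coefficient {c} (λ j → (steps S.* M) (toℕ j)) n) (sum-cong {c} λ j → steps*M (toℕ j) n))) ⟨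
      0# - boundary n ∎
      where
      m : ℕ → Carrier
      m k = M k n
      g : ℕ → Carrier
      g = extend p T.* m
      -- One term more than length n + 1 calls for, so that c + b is (c + d + 1) + (n d + 1), the
      -- sum of the degree bounds of the two factors in `sum-*`.
      b = suc (suc (d ℕ.+ n ℕ.* d))
      total : M₁ (suc n) ≈ sum {b} (λ k → g (c ℕ.+ toℕ k))
      total = trans (sym (sum-bounded (λ k → M k (suc n)) 1 (M-high (suc n)))) (sum-cong {b} λ k → last-step Mall-walks n 0 (toℕ k))
      size : c ℕ.+ b ≡ suc (c ℕ.+ d) ℕ.+ suc (n ℕ.* d)
      size = ≡.trans (ℕ.+-suc c (suc (d ℕ.+ n ℕ.* d))) (≡.cong suc (≡.trans (≡.cong (c ℕ.+_) (≡.sym (ℕ.+-suc d (n ℕ.* d)))) (≡.sym (ℕ.+-assoc c d (suc (n ℕ.* d))))))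
      whole : sum {c ℕ.+ b} (g ∘ toℕ) ≈ σ * M₁ n
      whole = trans (reflexive (≡.cong (λ k → sum {k} (g ∘ toℕ)) size)) (trans
        (sum-* (suc (c ℕ.+ d)) (suc (n ℕ.* d)) (extend p) m (λ i h → reflexive (extend-≥ p i h)) (M-high n))
        (*-congʳ (sum-cong λ i → reflexive (extend-toℕ p i))))

  F≈constant-D*M : F S.≈ constant T.rawRing D S.* M
  F≈constant-D*M k = T.trans (F≈D*M k) (T.sym (PP.constant-* D M k))

-- The kernel equation

module RingLemmas {a ℓ} (L : CommutativeRing a ℓ) where
  open RingTools L
  open SetoidReasoning setoid

  power-⊖ : ∀ {w v} → w * v ≈ 1# → ∀ c i → w ^ c * power w v (i ⊖ c) ≈ w ^ i
  power-⊖ wv≈1 zero    i       = *-identityˡ _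
  power-⊖ {w} {v} wv≈1 (suc c) zero    = trans (sym (^-distrib-* w v (suc c))) (trans (^-congˡ (suc c) wv≈1) (1^n≈1 (suc c)))
  power-⊖ {w} {v} wv≈1 (suc c) (suc i) = begin
    w ^ suc c * power w v (suc i ⊖ suc c) ≡⟨ ≡.cong (λ j → w ^ suc c * power w v j) (ℤ.[1+m]⊖[1+n]≡m⊖n i c) ⟩
    w ^ suc c * power w v (i ⊖ c)         ≈⟨ *-assoc _ _ _ ⟩
    w * (w ^ c * power w v (i ⊖ c))       ≈⟨ *-congˡ (power-⊖ wv≈1 c i) ⟩
    w ^ suc i ∎

  -- Multiplying by w^c turns the integer powers into natural ones. The ring is arbitrary, as the
  -- identity serves both for a root in C((t)) and for u in C((t))((u)).
  clear-kernel : ∀ {w v} → w * v ≈ 1# → ∀ c {n} (s : Fin n → Carrier) z →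
    w ^ c * (1# - z * sum (λ i → s i * power w v (toℕ i ⊖ c))) ≈ w ^ c - z * sum (λ i → s i * w ^ toℕ i)
  clear-kernel {w} {v} wv≈1 c s z = begin
    w ^ c * (1# - z * sum (λ i → s i * power w v (toℕ i ⊖ c)))
      ≈⟨ solve 3 (λ w z s → w :* (:1 :- z :* s) := w :- z :* (w :* s)) refl (w ^ c) z (sum (λ i → s i * power w v (toℕ i ⊖ c))) ⟩
    w ^ c - z * (w ^ c * sum (λ i → s i * power w v (toℕ i ⊖ c)))
      ≈⟨ +-congˡ (-‿cong (*-congˡ (trans (*-distribˡ-sum (w ^ c) (λ i → s i * power w v (toℕ i ⊖ c)))
           (sum-cong λ i → trans (x*yz≈y*xz (w ^ c) (s i) (power w v (toℕ i ⊖ c))) (*-congˡ (power-⊖ wv≈1 c (toℕ i))))))) ⟩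
    w ^ c - z * sum (λ i → s i * w ^ toℕ i) ∎

  -- ∏≢ keeps its factors in a where clause, out of reach; t names them.
  ∏≢-factors : ∀ {n} (i : Fin n) (f : (j : Fin n) → j ≢ i → Carrier) → Σ[ t ∈ (Fin n → Carrier) ] ∏≢ i f ≡ product t
  ∏≢-factors i f = _ , ≡.refl

  ∏≢-factor-≡ : ∀ {n} (i : Fin n) f → proj₁ (∏≢-factors i f) i ≡ 1#
  ∏≢-factor-≡ i f with i Fin.≟ i
  ... | yes _  = ≡.refl
  ... | no i≢i = ⊥-elim (i≢i ≡.refl)

  -- The decision inside ∏≢ yields its own proof of j ≢ i, on which the value of f may depend; hence
  -- the existential.
  ∏≢-factor-≢ : ∀ {n} (i : Fin n) f j → j ≢ i → Σ[ j≢i ∈ j ≢ i ] proj₁ (∏≢-factors i f) j ≡ f j j≢i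
  ∏≢-factor-≢ i f j j≢i with j Fin.≟ i
  ... | yes j≡i = ⊥-elim (j≢i j≡i)
  ... | no j≢i′ = j≢i′ , ≡.refl

  product-1 : ∀ {n} (f : Fin n → Carrier) → (∀ i → f i ≈ 1#) → product f ≈ 1#
  product-1 {zero}  f p = refl
  product-1 {suc n} f p = trans (*-cong (p Fin.zero) (product-1 (f ∘ Fin.suc) (p ∘ Fin.suc))) (*-identityˡ 1#)

  product-* : ∀ {n} (f g : Fin n → Carrier) → product (λ i → f i * g i) ≈ product f * product g
  product-* = Product.∑-distrib-+

  -- Passes from the product over j ≢ i in the theorem to the product over `punchIn i` on which the
  -- interpolation is built.
  ∏≢-inverse : ∀ {n} (i : Fin (suc n)) f (g : Fin (suc n) → Carrier) → (∀ j j≢i → f j j≢i * g j ≈ 1#) →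
    ∏≢ i f * product (λ j → g (punchIn i j)) ≈ 1#
  ∏≢-inverse {n} i f g fg≈1 = begin
    ∏≢ i f * product (λ j → g (punchIn i j))
      ≈⟨ *-congʳ (Product.sum-remove {i = i} t) ⟩
    t i * product (removeAt t i) * product (λ j → g (punchIn i j))
      ≈⟨ *-congʳ (trans (*-congʳ (reflexive (∏≢-factor-≡ i f))) (*-identityˡ _)) ⟩
    product (removeAt t i) * product (λ j → g (punchIn i j))
      ≈⟨ product-* (removeAt t i) (λ j → g (punchIn i j)) ⟨
    product (λ j → t (punchIn i j) * g (punchIn i j))
      ≈⟨ product-1 (λ j → t (punchIn i j) * g (punchIn i j)) (λ j → inverse (punchIn i j) (Fin.punchInᵢ≢i i j)) ⟩
    1# ∎
    where
    t = proj₁ (∏≢-factors i f)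
    inverse : ∀ j → j ≢ i → t j * g j ≈ 1#
    inverse j j≢i = let q , e = ∏≢-factor-≢ i f j j≢i in trans (*-congʳ (reflexive e)) (fg≈1 j q)

module PartialFractionExpansion {a ℓ} (L : CommutativeRing a ℓ)
  (tight : ∀ x → ¬ RingOps.Unit (CommutativeRing.rawRing L) x → CommutativeRing._≈_ L x (CommutativeRing.0# L)) where
  open RingTools L
  open Polynomials L
  open RingLemmas L

  K*expansion : ∀ {d} → 1 ℕ.≤ d → (v : Fin d → Carrier) (units : ∀ l → Unit (v l)) → (∀ l j → v l ≈ v j → l ≡ j) →
    (Δ : ∀ l j → j ≢ l → Unit (v l - v j)) → ∀ c₀ K → DegreeBelow (suc (d ℕ.+ c₀)) K → (∀ l → eval (suc (d ℕ.+ c₀)) K (v l) ≈ 0#) →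
    let S = λ k → sum λ l → (units l ⁻¹) ^ suc k * ∏≢ l (λ j j≢l → Δ l j j≢l ⁻¹) in
    (K PR.* S) c₀ ≈ - K (d ℕ.+ c₀) × (∀ j → c₀ ℕ.< j → (K PR.* S) j ≈ 0#)
  K*expansion {suc d} _ v units distinct Δ c₀ K K-degree K-roots =
    trans (PR.*-congˡ {K} S≈ c₀) K*partialFractions-c₀ ,
    λ j c₀<j → trans (PR.*-congˡ {K} S≈ j) (K*partialFractions-> j c₀<j)
    where
    coefficient : Fin (suc d) → Carrier
    coefficient l = ∏≢ l (λ j j≢l → Δ l j j≢l ⁻¹)
    open TightRing.Lagrange L tight v units distinct coefficient
      (λ l → ∏≢-inverse l (λ j j≢l → Δ l j j≢l ⁻¹) (λ j → v l - v j) (λ j j≢l → inverseˡ (Δ l j j≢l)))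
    open PartialFractions c₀ K K-degree K-roots
    S≈ : (λ k → sum λ l → (units l ⁻¹) ^ suc k * coefficient l) PR.≈ partialFractions
    S≈ k = sum-cong λ l → *-comm ((units l ⁻¹) ^ suc k) (coefficient l)

-- The kernel polynomial and its roots

module KernelEquation {a ℓ₁ ℓ₂ b ℓ₃ ℓᵥ} {R : OrderedField a ℓ₁ ℓ₂} (W : Weights R) (L : CommutativeRing b ℓ₃)
  (tight : ∀ x → ¬ RingOps.Unit (CommutativeRing.rawRing L) x → CommutativeRing._≈_ L x (CommutativeRing.0# L))
  (1≉0 : ¬ CommutativeRing._≈_ L (CommutativeRing.1# L) (CommutativeRing.0# L))
  {ι : (ℕ → OrderedField.Carrier R) → CommutativeRing.Carrier L}
  (ι-hom : IsRingHomomorphism (powerSeries (OrderedField.rawRing R)) (CommutativeRing.rawRing L) ι)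
  (ι-unit : ∀ f n → ¬ OrderedField._≈_ R (f n) (OrderedField.0# R) → RingOps.Unit (CommutativeRing.rawRing L) (ι f))
  (𝒱 : Valuation L ℓᵥ) (ι-integral : ∀ f → Valuation.Integral 𝒱 (ι f)) where

  open Weights W
  open Paths R W using (F; M; D; Q; M₁; E)
  private
    A = OrderedField.commutativeRing R
    𝔽 = OrderedField.isField R
    module A = RingTools A
    module Az = PowerSeries A
    module Z = RingTools Az.powerSeriesRing
    module Azu = PowerSeries Az.powerSeriesRing
    module B = BivariatePolynomials 𝔽
    module S = RingTools B.bivariateRing
    module Count = PathCounting R W
    module ι = Homomorphism.Properties Az.powerSeriesRing L ι-hom
    module Alg = Algebraicity 𝔽 L tight 1≉0 ι-hom ι-unit
  open Algebraicity 𝔽 L tight 1≉0 ι-hom ι-unit using (φ; φ-hom; φ-constant; z; cst)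
  open Homomorphism.Properties B.bivariateRing (PowerSeries.powerSeriesRing L) φ-hom
  open RingTools L
  open Polynomials L
  open KernelMethod L tight 𝒱
  open SetoidReasoning setoid

  scalarz : A.Carrier → ℕ → A.Carrier
  scalarz = constant A.rawRing

  scalar : A.Carrier → Carrier
  scalar x = ι (scalarz x)

  -- K = uᶜ (1 - z P(u)).
  K : S.Carrier
  K = Azu.X S.^ c S.- cst Az.X S.* Count.steps

  K-coefficient : ∀ k → K k Z.≈ Azu.monomial c k Z.- Az.X Z.* Count.steps k
  K-coefficient k = Z.+-cong (Azu.X^≈monomial c k) (Z.-‿cong (Azu.constant-* Az.X Count.steps k))

  K-≢ : ∀ k → c ≢ k → K k Z.≈ Z.- (Az.X Z.* Count.steps k)
  K-≢ k c≢k = Z.trans (K-coefficient k) (Z.trans (Z.+-congʳ {Z.- (Az.X Z.* Count.steps k)} (Azu.monomial-≢ c k c≢k)) (Z.+-identityˡ _))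

  K-degree : ∀ k → c ℕ.+ d ℕ.< k → K k Z.≈ Z.0#
  K-degree k c+d<k = Z.trans (K-≢ k (ℕ.<⇒≢ (ℕ.≤-<-trans (ℕ.m≤m+n c d) c+d<k)))
    (Z.trans (Z.-‿cong (Z.trans (Z.*-congˡ {Az.X} (Z.trans (Az.constant-cong (A.reflexive (Count.extend-≥ p k c+d<k)))
      (λ { zero → A.refl ; (suc _) → A.refl }))) (Z.zeroʳ Az.X))) Z.-0#≈0#)

  K-lead : K (c ℕ.+ d) Z.≈ Z.- (Az.X Z.* scalarz p-d)
  K-lead = Z.trans (K-≢ (c ℕ.+ d) (ℕ.<⇒≢ (ℕ.m<m+n c 1≤d)))
    (Z.-‿cong (Z.*-congˡ {Az.X} (Az.constant-cong (A.reflexive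
      (≡.trans (≡.cong (Count.extend p) (≡.sym (Fin.toℕ-fromℕ (c ℕ.+ d)))) (Count.extend-toℕ p (fromℕ (c ℕ.+ d))))))))

  K-0 : K 0 Z.≈ Z.- (Az.X Z.* scalarz (p Fin.zero))
  K-0 = K-≢ 0 (ℕ.<⇒≢ 1≤c ∘ ≡.sym)

  -- The last-jump equation times uᶜ: from uᶜ on only the empty path remains, so K M is monic of
  -- degree c. Its lower coefficients are the boundary terms that the small roots determine.
  K*M : ∀ k → (K S.* M) (c ℕ.+ k) Z.≈ S.1# k
  K*M k = Z.trans (expand (c ℕ.+ k)) (Z.trans
    (Z.+-cong (Z.trans (Z.reflexive (Azu.↑-+ c M k)) (Count.M-last-step k)) (Z.refl {Z.- (Az.X Z.* (Count.steps S.* M) (c ℕ.+ k))}))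
    (Z.solve 2 (λ x y → (x Z.:+ y) Z.:- y Z.:= x) Z.refl (S.1# k) (Az.X Z.* (Count.steps S.* M) (c ℕ.+ k))))
    where
    expand : ∀ j → (K S.* M) j Z.≈ Azu._↑_ M c j Z.- Az.X Z.* (Count.steps S.* M) j
    expand j = Z.trans (S.solve 4 (λ u x s m → (u S.:- x S.:* s) S.:* m S.:= u S.:* m S.:- x S.:* (s S.:* m)) S.refl (Azu.X S.^ c) (cst Az.X) Count.steps M j)
      (Z.+-cong (Z.sym (Azu.↑≈X^* c M j)) (Z.-‿cong (Azu.constant-* Az.X (Count.steps S.* M) j)))

  φK*φM : ∀ j → (φ K PR.* φ M) j ≈ ι ((K S.* M) j)
  φK*φM j = sym (φ-* K M j)

  φN-degree : DegreeBelow (suc c) (φ K PR.* φ M)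
  φN-degree j c<j = ≡.subst (λ j → (φ K PR.* φ M) j ≈ 0#) (≡.trans (ℕ.+-suc c (j ∸ suc c)) (ℕ.m+[n∸m]≡n c<j))
    (trans (φK*φM (c ℕ.+ suc (j ∸ suc c))) (trans (ι.φ-cong (K*M (suc (j ∸ suc c)))) ι.φ-0))

  φN-monic : (φ K PR.* φ M) c ≈ 1#
  φN-monic = ≡.subst (λ j → (φ K PR.* φ M) j ≈ 1#) (ℕ.+-identityʳ c)
    (trans (φK*φM (c ℕ.+ 0)) (trans (ι.φ-cong (K*M 0)) ι.φ-1))

  φK-degree : DegreeBelow (suc (c ℕ.+ d)) (φ K)
  φK-degree k c+d<k = trans (ι.φ-cong (K-degree k c+d<k)) ι.φ-0

  z-unit : Unit z
  z-unit = ι-unit Az.X 1 (OrderedField.1≉0 R)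

  scalar-unit : ∀ {x} → ¬ x A.≈ A.0# → Unit (scalar x)
  scalar-unit {x} x≉0 = ι-unit (scalarz x) 0 x≉0

  φK-lead : φ K (c ℕ.+ d) ≈ - (scalar p-d * z)
  φK-lead = trans (ι.φ-cong K-lead) (trans (ι.φ-neg _) (-‿cong (trans (ι.φ-* Az.X (scalarz p-d)) (*-comm z (scalar p-d)))))

  φK-0 : φ K 0 ≈ - (z * scalar (p Fin.zero))
  φK-0 = trans (ι.φ-cong K-0) (trans (ι.φ-neg _) (-‿cong (ι.φ-* Az.X (scalarz (p Fin.zero)))))

  φK₀-unit : Unit (φ K 0)
  φK₀-unit = Unit-cong (sym φK-0) (Unit-neg (Unit-* z-unit (scalar-unit p₋c≉0)))

  -- The pole order is 0 because every M_k is a power series in z.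
  φM-bounded : Bounded (φ M)
  φM-bounded = 0 , λ k → Valuation.Integral-cong 𝒱 (sym (*-identityˡ (ι (M k)))) (ι-integral (M k))

  u : Series
  u = P.X

  steps-expansion : PR.sum (λ i → const (scalar (p i)) PR.* u PR.^ toℕ i) PR.≈ φ Count.steps
  steps-expansion = expand p
    where
    expand : ∀ {n} (s : Fin n → A.Carrier) → PR.sum (λ i → const (scalar (s i)) PR.* u PR.^ toℕ i) PR.≈ λ k → scalar (Count.extend s k)
    expand {zero}  s k = sym (trans (ι.φ-cong (λ { zero → A.refl ; (suc _) → A.refl })) ι.φ-0)
    expand {suc n} s = PR.trans
      (PR.+-cong {const (scalar (s Fin.zero)) PR.* PR.1#} {const (scalar (s Fin.zero))} (PR.*-identityʳ _)
        (PR.trans (PR.sum-cong {n} λ i → PR.x*yz≈y*xz (const (scalar (s (Fin.suc i)))) u (u PR.^ toℕ i))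
          (PR.sym (PR.*-distribˡ-sum {n} u (λ i → const (scalar (s (Fin.suc i))) PR.* u PR.^ toℕ i)))))
      λ { zero    → trans (+-congˡ (P.X* rest 0)) (+-identityʳ _)
        ; (suc k) → trans (+-identityˡ _) (trans (P.X* rest (suc k)) (expand (s ∘ Fin.suc) k)) }
      where
      rest : Series
      rest = PR.sum (λ i → const (scalar (s (Fin.suc i))) PR.* u PR.^ toℕ i)

  φK-expansion : φ K PR.≈ u PR.^ c PR.- const z PR.* φ Count.steps
  φK-expansion = PR.trans (φ-minus (Azu.X S.^ c) (cst Az.X S.* Count.steps)) (PR.+-cong
    (PR.trans (φ-^ Azu.X c) (PR.^-congˡ c φ-u))
    (PR.-‿cong (PR.trans (φ-* (cst Az.X) Count.steps) (PR.*-congʳ {φ Count.steps} (φ-constant Az.X)))))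
    where
    φ-u : φ Azu.X PR.≈ u
    φ-u zero          = ι.φ-0
    φ-u (suc zero)    = ι.φ-1
    φ-u (suc (suc n)) = ι.φ-0

  record KernelRoot (w : Carrier) : Set (b ⊔ ℓ₃) where
    field
      invertible : Unit w
      root       : 1# - z * sum (λ i → scalar (p i) * power w (invertible ⁻¹) (jumpSize i)) ≈ 0#

  kernelRoot-eval : ∀ {w} → KernelRoot w → eval (suc (c ℕ.+ d)) (φ K) w ≈ 0#
  kernelRoot-eval {w} r = begin
    eval N (φ K) w
      ≈⟨ eval-cong N w φK-expansion ⟩
    eval N (u PR.^ c PR.- const z PR.* φ Count.steps) w
      ≈⟨ trans (eval-+ N (u PR.^ c) (PR.- (const z PR.* φ Count.steps)) w)
           (+-congˡ (trans (eval-neg N (const z PR.* φ Count.steps) w) (-‿cong (eval-const* N z (φ Count.steps) w)))) ⟩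
    eval N (u PR.^ c) w - z * eval N (φ Count.steps) w
      ≈⟨ +-cong (trans (eval-cong N w (P.X^≈monomial c)) (eval-monomial N c w (s≤s (ℕ.m≤m+n c d))))
           (-‿cong (*-congˡ (sum-cong λ i → *-congʳ {w ^ toℕ i} (ι.φ-cong (Az.constant-cong (A.reflexive (Count.extend-toℕ p i))))))) ⟩
    w ^ c - z * sum (λ i → scalar (p i) * w ^ toℕ i)
      ≈⟨ RingLemmas.clear-kernel L (inverseʳ invertible) c (λ i → scalar (p i)) z ⟨
    w ^ c * (1# - z * sum (λ i → scalar (p i) * power w (invertible ⁻¹) (jumpSize i)))
      ≈⟨ trans (*-congˡ root) (zeroʳ _) ⟩
    0# ∎
    where
    open KernelRoot r
    N = suc (c ℕ.+ d)

  module SmallRoots (w : Fin c → Carrier) (w-root : ∀ i → KernelRoot (w i)) (w-distinct : ∀ i j → w i ≈ w j → i ≡ j)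
    (w-small : ∀ i → ∃[ y ] Valuation.Integral 𝒱 y × w i ≈ Valuation.τ 𝒱 * y) where

    private
      smallRoot : ∀ i → SmallRoot (φ K) (c ℕ.+ d) (w i)
      smallRoot i = record
        { invertible = KernelRoot.invertible (w-root i) ; w/τ = proj₁ (w-small i) ; integral = proj₁ (proj₂ (w-small i))
        ; w≈ = proj₂ (proj₂ (w-small i)) ; root = kernelRoot-eval (w-root i) }

    φK*φM≈rootProduct : φ K PR.* φ M PR.≈ rootProduct w
    φK*φM≈rootProduct = kernel-factor φK-degree w smallRoot w-distinct {φ M} φM-bounded φN-degree φN-monic

    φM-unique : ∀ {Y} → Bounded Y → DegreeBelow (suc c) (φ K PR.* Y) → (φ K PR.* Y) c ≈ 1# → φ M PR.≈ Y
    φM-unique {Y} Y-bounded = kernel-unique φK-degree w smallRoot w-distinct φK₀-unit {φ M} {Y} φM-bounded Y-bounded φN-degree φN-monic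

  open FiniteAlgebras B.bivariateRing B.subdomain P.powerSeriesRing φ-hom
    using (FiniteAlgebra; IntegralConstant; adjoin; Operator)
  private
    module const = Homomorphism.Properties L P.powerSeriesRing (constant-hom L)

  poly-X : B.IsPoly Azu.X
  poly-X = 2 , λ
    { zero          _       (inj₁ ())
    ; zero          (suc n) _ → A.refl
    ; zero          zero    (inj₂ ())
    ; (suc zero)    _       (inj₁ (s≤s ()))
    ; (suc zero)    (suc n) (inj₂ _) → A.refl
    ; (suc (suc k)) _       _ → A.refl }

  poly-^ : ∀ {f} → B.IsPoly f → ∀ n → B.IsPoly (f S.^ n)
  poly-^ pf zero    = B.poly-1
  poly-^ {f} pf (suc n) = B.poly-* {f} {f S.^ n} pf (poly-^ {f} pf n)

  poly-steps : B.IsPoly Count.steps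
  poly-steps = suc (c ℕ.+ d) , λ
    { k zero    (inj₁ h) → A.reflexive (Count.extend-≥ p k h)
    ; k (suc n) _        → A.refl }

  poly-K : B.IsPoly K
  poly-K = B.poly-+ {Azu.X S.^ c} {S.- (cst Az.X S.* Count.steps)} (poly-^ {Azu.X} poly-X c)
    (B.poly-neg {cst Az.X S.* Count.steps} (B.poly-* {cst Az.X} {Count.steps} Alg.cstX-poly poly-steps))

  poly-coefficient : ∀ {f} → B.IsPoly f → ∀ j → B.IsPoly (cst (f j))
  poly-coefficient {f} pf j = proj₁ (proj₂ (Operator.E-φ (Alg.coefficient j) {f} pf))

  -- K(w) = 0 has leading term -p_d z w^(c+d). Multiplied by z^(c+d-1) / p_d it becomes a monic
  -- equation for z w with coefficients in A[z], since each remaining w^i still finds a factor z^i.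
  kernelRoot-integral : ∀ {w} → KernelRoot w → IntegralConstant {Alg.coefficient} (const (z * w))
  kernelRoot-integral {w} r = record
    { degree   = e
    ; κ        = κ
    ; κ-member = λ i → B.poly-* {cst (scalarz pd⁻¹)} {cst (K (toℕ i)) S.* cst Az.X S.^ (e ∸ toℕ i)} (Alg.scalar-poly pd⁻¹)
        (B.poly-* {cst (K (toℕ i))} {cst Az.X S.^ (e ∸ toℕ i)} (poly-coefficient {K} poly-K (toℕ i)) (poly-^ {cst Az.X} Alg.cstX-poly (e ∸ toℕ i)))
    ; integral = PR.trans (PR.sym (const.φ-^ (z * w) (suc e))) (PR.trans (P.constant-cong integral)
        (PR.trans (const.φ-sum {suc e} (λ i → k (toℕ i) * (z * w) ^ toℕ i)) (PR.sum-cong {suc e} λ i →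
          PR.trans (P.constant-homo-* (k (toℕ i)) ((z * w) ^ toℕ i)) (PR.*-cong {const (k (toℕ i))} {φ (κ i)} (φκ i) (const.φ-^ (z * w) (toℕ i))))))
    ; commutes = Alg.const-commutes (z * w)
    }
    where
    open KernelRoot r
    e = ℕ.pred (c ℕ.+ d)
    e+1 : suc e ≡ c ℕ.+ d
    e+1 = ℕ.suc-pred (c ℕ.+ d) {{ℕ.>-nonZero (ℕ.≤-trans 1≤c (ℕ.m≤m+n c d))}}
    pd-unit : A.Unit p-d
    pd-unit = OrderedField.invertible R p-d p-d≉0
    pd⁻¹ = pd-unit A.⁻¹
    s = scalar p-d
    s⁻¹ = scalar pd⁻¹
    s*s⁻¹ : s * s⁻¹ ≈ 1#
    s*s⁻¹ = trans (sym (ι.φ-* (scalarz p-d) (scalarz pd⁻¹))) (trans (ι.φ-cong (Z.trans (Z.sym (Az.constant-homo-* p-d pd⁻¹))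
      (Az.constant-cong (A.inverseʳ pd-unit)))) ι.φ-1)
    κ : Fin (suc e) → S.Carrier
    κ i = cst (scalarz pd⁻¹) S.* (cst (K (toℕ i)) S.* cst Az.X S.^ (e ∸ toℕ i))
    k : ℕ → Carrier
    k i = s⁻¹ * (φ K i * z ^ (e ∸ i))
    φκ : ∀ i → const (k (toℕ i)) PR.≈ φ (κ i)
    φκ i = PR.sym (PR.trans (φ-* (cst (scalarz pd⁻¹)) (cst (K (toℕ i)) S.* cst Az.X S.^ (e ∸ toℕ i)))
      (PR.trans (PR.*-cong {φ (cst (scalarz pd⁻¹))} {const s⁻¹} (φ-constant (scalarz pd⁻¹))
          (PR.trans (φ-* (cst (K (toℕ i))) (cst Az.X S.^ (e ∸ toℕ i)))
            (PR.trans (PR.*-cong {φ (cst (K (toℕ i)))} {const (φ K (toℕ i))} (φ-constant (K (toℕ i)))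
                (PR.trans (φ-^ (cst Az.X) (e ∸ toℕ i)) (PR.trans (PR.^-congˡ (e ∸ toℕ i) (φ-constant Az.X)) (PR.sym (const.φ-^ z (e ∸ toℕ i))))))
              (PR.sym (P.constant-homo-* (φ K (toℕ i)) (z ^ (e ∸ toℕ i)))))))
        (PR.sym (P.constant-homo-* s⁻¹ (φ K (toℕ i) * z ^ (e ∸ toℕ i))))))
    leading-term : s * z * w ^ suc e ≈ eval (suc e) (φ K) w
    leading-term = begin
      s * z * w ^ suc e
        ≈⟨ solve 2 (λ x y → x := (y :+ x) :- y) refl (s * z * w ^ suc e) (eval (suc e) (φ K) w) ⟩
      (eval (suc e) (φ K) w + s * z * w ^ suc e) - eval (suc e) (φ K) w
        ≈⟨ solve 3 (λ y x w → (y :+ x :* w) :- y := :- (y :+ (:- x) :* w) :+ y) refl (eval (suc e) (φ K) w) (s * z) (w ^ suc e) ⟩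
      - (eval (suc e) (φ K) w + - (s * z) * w ^ suc e) + eval (suc e) (φ K) w
        ≈⟨ +-congʳ (-‿cong (+-congˡ (*-congʳ (≡.subst (λ j → - (s * z) ≈ φ K j) (≡.sym e+1) (sym φK-lead))))) ⟩
      - (eval (suc e) (φ K) w + φ K (suc e) * w ^ suc e) + eval (suc e) (φ K) w
        ≈⟨ +-congʳ (-‿cong (trans (sym (eval-last (suc e) (φ K) w)) (≡.subst (λ j → eval (suc j) (φ K) w ≈ 0#) (≡.sym e+1) (kernelRoot-eval r)))) ⟩
      - 0# + eval (suc e) (φ K) w
        ≈⟨ solve 1 (λ y → :- :0 :+ y := y) refl (eval (suc e) (φ K) w) ⟩
      eval (suc e) (φ K) w ∎
    integral : (z * w) ^ suc e ≈ sum {suc e} (λ i → k (toℕ i) * (z * w) ^ toℕ i)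
    integral = begin
      (z * w) ^ suc e
        ≈⟨ ^-distrib-* z w (suc e) ⟩
      z * z ^ e * w ^ suc e
        ≈⟨ *-identityˡ _ ⟨
      1# * (z * z ^ e * w ^ suc e)
        ≈⟨ *-congʳ s*s⁻¹ ⟨
      s * s⁻¹ * (z * z ^ e * w ^ suc e)
        ≈⟨ solve 5 (λ s t z y w → s :* t :* (z :* y :* w) := t :* y :* (s :* z :* w)) refl s s⁻¹ z (z ^ e) (w ^ suc e) ⟩
      s⁻¹ * z ^ e * (s * z * w ^ suc e)
        ≈⟨ *-congˡ leading-term ⟩
      s⁻¹ * z ^ e * eval (suc e) (φ K) w
        ≈⟨ *-distribˡ-sum {suc e} (s⁻¹ * z ^ e) (λ i → φ K (toℕ i) * w ^ toℕ i) ⟩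
      sum {suc e} (λ i → s⁻¹ * z ^ e * (φ K (toℕ i) * w ^ toℕ i))
        ≈⟨ sum-cong {suc e} (λ i → term (toℕ i) (ℕ.≤-pred (Fin.toℕ<n i))) ⟩
      sum {suc e} (λ i → k (toℕ i) * (z * w) ^ toℕ i) ∎
      where
      term : ∀ i → i ℕ.≤ e → s⁻¹ * z ^ e * (φ K i * w ^ i) ≈ k i * (z * w) ^ i
      term i i≤e = begin
        s⁻¹ * z ^ e * (φ K i * w ^ i)
          ≈⟨ *-congʳ (*-congˡ (trans (reflexive (≡.cong (z ^_) (≡.sym (ℕ.m∸n+n≡m i≤e)))) (^-homo-* z (e ∸ i) i))) ⟩
        s⁻¹ * (z ^ (e ∸ i) * z ^ i) * (φ K i * w ^ i)
          ≈⟨ solve 5 (λ s x y k w → s :* (x :* y) :* (k :* w) := s :* (k :* x) :* (y :* w)) refl s⁻¹ (z ^ (e ∸ i)) (z ^ i) (φ K i) (w ^ i) ⟩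
        k i * (z ^ i * w ^ i)
          ≈⟨ *-congˡ (^-distrib-* z w i) ⟨
        k i * (z * w) ^ i ∎

  -- Instantiated with the small roots to prove F algebraic, and with the large roots to invert
  -- their differences.
  module KernelAlgebra {n} (w : Fin n → Carrier) (w-root : ∀ i → KernelRoot (w i)) where
    private
      algebra : Σ[ 𝒜 ∈ FiniteAlgebra Alg.coefficient ] ∀ i → FiniteAlgebra.T 𝒜 (const (z * w i))
      algebra = adjoin (λ i → const (z * w i)) (λ i → kernelRoot-integral (w-root i))

    open Alg.Localisation (proj₁ algebra) public

    𝓛-root : ∀ i → 𝓛 (const (w i))
    𝓛-root i = 𝓛-ζ (𝓛-cong (P.constant-homo-* z (w i)) (T⊆𝓛 (proj₂ algebra i)))

    root-difference-unit : ∀ i j → ¬ w i ≈ w j → Unit (w i - w j)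
    root-difference-unit i j wᵢ≉wⱼ = 𝓛-unit
      (𝓛-cong (PR.sym (const.φ-minus (w i) (w j))) (𝓛-+ (𝓛-root i) (𝓛-neg (𝓛-root j))))
      (wᵢ≉wⱼ ∘ x-y≈0⇒x≈y)

  cst-homo-* : ∀ f g → cst (f Z.* g) S.≈ cst f S.* cst g
  cst-homo-* = Azu.constant-homo-*

  F≈cstD*M : F S.≈ cst D S.* M
  F≈cstD*M k = Z.trans (Count.F≈D*M k) (Z.sym (Azu.constant-* D M k))

  -- 1 - z P(1).
  K₁ : ℕ → A.Carrier
  K₁ = Z.1# Z.- Az.X Z.* scalarz Count.σ

  -- Algebraicity of F

  module AlgebraicSeries (w : Fin c → Carrier) (w-root : ∀ i → KernelRoot (w i))
    (factorisation : φ K PR.* φ M PR.≈ rootProduct w) where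
    open KernelAlgebra w w-root

    𝓛c : (ℕ → A.Carrier) → Set _
    𝓛c f = 𝓛 (const (ι f))

    𝓛c-cong : ∀ {f g} → f Z.≈ g → 𝓛c f → 𝓛c g
    𝓛c-cong f≈g = 𝓛-cong (P.constant-cong (ι.φ-cong f≈g))

    𝓛c-+ : ∀ {f g} → 𝓛c f → 𝓛c g → 𝓛c (f Z.+ g)
    𝓛c-+ {f} {g} s t = 𝓛-cong (PR.sym (PR.trans (P.constant-cong (ι.φ-+ f g)) (P.constant-homo-+ (ι f) (ι g)))) (𝓛-+ s t)

    𝓛c-* : ∀ {f g} → 𝓛c f → 𝓛c g → 𝓛c (f Z.* g)
    𝓛c-* {f} {g} s t = 𝓛-cong (PR.sym (PR.trans (P.constant-cong (ι.φ-* f g)) (P.constant-homo-* (ι f) (ι g)))) (𝓛-* s t)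

    𝓛c-cst : ∀ {f} → B.IsPoly (cst f) → 𝓛c f
    𝓛c-cst {f} pf = 𝓛-cong (φ-constant f) (𝓛-φ pf)

    𝓛c-0 : 𝓛c Z.0#
    𝓛c-0 = 𝓛c-cong (λ { zero → A.refl ; (suc n) → A.refl }) (𝓛c-cst (Alg.scalar-poly A.0#))

    𝓛c-1 : 𝓛c Z.1#
    𝓛c-1 = 𝓛c-cst (Alg.scalar-poly A.1#)

    𝓛c-X : 𝓛c Az.X
    𝓛c-X = 𝓛c-cst Alg.cstX-poly

    𝓛c-scalar : ∀ x → 𝓛c (scalarz x)
    𝓛c-scalar x = 𝓛c-cst (Alg.scalar-poly x)

    𝓛c-neg : ∀ {f} → 𝓛c f → 𝓛c (Z.- f)
    𝓛c-neg {f} t = 𝓛-cong (PR.sym (PR.trans (P.constant-cong (ι.φ-neg f)) (const.φ-neg (ι f)))) (𝓛-neg t)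

    𝓛c-sum : ∀ {n} (f : Fin n → ℕ → A.Carrier) → (∀ i → 𝓛c (f i)) → 𝓛c (Z.sum f)
    𝓛c-sum {zero}  f t = 𝓛c-0
    𝓛c-sum {suc n} f t = 𝓛c-+ (t Fin.zero) (𝓛c-sum (f ∘ Fin.suc) (t ∘ Fin.suc))

    𝓛-N : 𝓛 (φ K PR.* φ M)
    𝓛-N = 𝓛-cong (PR.sym factorisation) (𝓛-product (λ i → linear (w i))
      λ i → 𝓛-+ (𝓛-cong (SeriesMap.mapSeries-X Az.powerSeriesRing L ι-hom) (𝓛-φ poly-X)) (𝓛-neg (𝓛-root i)))

    𝓛c-K : ∀ j → 𝓛c (K j)
    𝓛c-K j = 𝓛c-cst (poly-coefficient {K} poly-K j)

    𝓛c-N : ∀ j → 𝓛c ((K S.* M) j)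
    𝓛c-N j = 𝓛-cong (P.constant-cong (φK*φM j)) (𝓛-coefficient 𝓛-N j)

    private
      p₀-unit : A.Unit (p Fin.zero)
      p₀-unit = OrderedField.invertible R (p Fin.zero) p₋c≉0
      p₀ p₀⁻¹ : ℕ → A.Carrier
      p₀ = scalarz (p Fin.zero)
      p₀⁻¹ = scalarz (p₀-unit A.⁻¹)
      p₀*p₀⁻¹ : p₀ Z.* p₀⁻¹ Z.≈ Z.1#
      p₀*p₀⁻¹ = Z.trans (Z.sym (Az.constant-homo-* (p Fin.zero) (p₀-unit A.⁻¹))) (Az.constant-cong (A.inverseʳ p₀-unit))

      later : ℕ → ℕ → A.Carrier
      later zero    = Z.0#
      later (suc j) = (Azu.tail K S.* M) j

      N-split : ∀ j → (K S.* M) j Z.≈ K 0 Z.* M j Z.+ later j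
      N-split zero    = Z.refl
      N-split (suc j) = Z.refl

      -- K M = ∏ (u - uᵢ) is a triangular system for the M_j. Its diagonal entry is -z p₋c: p₋c is
      -- inverted in the field and z by the localisation, so 𝓛 is not left.
      divide : ∀ j → 𝓛c (later j) → 𝓛c (M j)
      divide j t = 𝓛-ζ (𝓛-cong (PR.trans (P.constant-cong (ι.φ-* Az.X (M j))) (P.constant-homo-* z (ι (M j))))
        (𝓛c-cong X*M (𝓛c-* (𝓛c-scalar (p₀-unit A.⁻¹)) (𝓛c-+ t (𝓛c-neg (𝓛c-N j))))))
        where
        X*M : p₀⁻¹ Z.* (later j Z.- (K S.* M) j) Z.≈ Az.X Z.* M j
        X*M = Z.trans (Z.*-congˡ {p₀⁻¹} (Z.+-congˡ {later j} (Z.-‿cong (Z.trans (N-split j) (Z.+-congʳ {later j} (Z.*-congʳ {M j} K-0))))))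
          (Z.trans (Z.solve 5 (λ q l x p m → q Z.:* (l Z.:- ((Z.:- (x Z.:* p)) Z.:* m Z.:+ l)) Z.:= (p Z.:* q) Z.:* (x Z.:* m)) Z.refl
              p₀⁻¹ (later j) Az.X p₀ (M j))
            (Z.trans (Z.*-congʳ {Az.X Z.* M j} p₀*p₀⁻¹) (Z.*-identityˡ (Az.X Z.* M j))))

      M-below : ∀ m j → j ℕ.< m → 𝓛c (M j)
      M-below (suc m) zero    _         = divide 0 𝓛c-0
      M-below (suc m) (suc j) (s≤s j<m) = divide (suc j) (𝓛c-sum {suc j} (λ i → K (suc (toℕ i)) Z.* M (j ∸ toℕ i))
        λ i → 𝓛c-* (𝓛c-K (suc (toℕ i))) (M-below m (j ∸ toℕ i) (ℕ.≤-<-trans (ℕ.m∸n≤m j (toℕ i)) j<m)))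

    𝓛c-M : ∀ j → 𝓛c (M j)
    𝓛c-M j = M-below (suc j) j (ℕ.n<1+n j)

    𝓛c-K₁ : 𝓛c K₁
    𝓛c-K₁ = 𝓛c-+ 𝓛c-1 (𝓛c-neg (𝓛c-* 𝓛c-X (𝓛c-scalar Count.σ)))

    -- Solving for M(z,1) would introduce the denominator 1 - z P(1), which is not a power of z; the
    -- factor K₁ is kept and ends up in `denominator`.
    𝓛c-K₁*M₁ : 𝓛c (K₁ Z.* M₁)
    𝓛c-K₁*M₁ = 𝓛c-cong (Z.sym Count.M₁-equation) (𝓛c-+ 𝓛c-1 (𝓛c-neg (𝓛c-* 𝓛c-X
      (𝓛c-sum {c} (λ j → (Count.steps S.* M) (toℕ j)) λ j → 𝓛c-sum {suc (toℕ j)} (λ i → Count.steps (toℕ i) Z.* M (toℕ j ∸ toℕ i))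
        λ i → 𝓛c-* (𝓛c-scalar (Count.extend p (toℕ i))) (𝓛c-M (toℕ j ∸ toℕ i))))))

    𝓛c-M-sum : ∀ js → 𝓛c (foldr Z._+_ Z.0# (map M js))
    𝓛c-M-sum []       = 𝓛c-0
    𝓛c-M-sum (j ∷ js) = 𝓛c-+ (𝓛c-M j) (𝓛c-M-sum js)

    private
      jumpsTo0 : List ℕ
      jumpsTo0 = filter (λ j → (ℤ.- + j) ∈𝒥?) (applyUpTo suc c)

      M-sum : ℕ → A.Carrier
      M-sum = foldr Z._+_ Z.0# (map M jumpsTo0)

    𝓛c-K₁*[1-Q] : 𝓛c (K₁ Z.* (Z.1# Z.- Q))
    𝓛c-K₁*[1-Q] = 𝓛c-cong
      (Z.solve 6 (λ k x q m e s → k Z.:- x Z.:* q Z.:* (k Z.:* m Z.:- k Z.:* e Z.:- k Z.:* s) Z.:= k Z.:* (Z.:1 Z.:- x Z.:* q Z.:* (m Z.:- e Z.:- s)))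
        Z.refl K₁ Az.X (scalarz q) M₁ E M-sum)
      (𝓛c-+ 𝓛c-K₁ (𝓛c-neg (𝓛c-* (𝓛c-* 𝓛c-X (𝓛c-scalar q))
        (𝓛c-+ (𝓛c-+ 𝓛c-K₁*M₁ (𝓛c-neg (𝓛c-* 𝓛c-K₁ (𝓛c-M 0)))) (𝓛c-neg (𝓛c-* 𝓛c-K₁ (𝓛c-M-sum jumpsTo0)))))))

    private
      -- F = M / (1 - Q) enlarged by K and K₁: K turns M into the product over the small roots, and
      -- K₁ clears the denominator of M(z,1) in 1 - Q.
      numerator denominator : S.Carrier
      numerator   = cst K₁ S.* (K S.* M)
      denominator = K S.* cst (K₁ Z.* (Z.1# Z.- Q))

      cancel-D : cst D S.* cst (K₁ Z.* (Z.1# Z.- Q)) S.≈ cst K₁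
      cancel-D = S.trans (S.sym (cst-homo-* D (K₁ Z.* (Z.1# Z.- Q)))) (Azu.constant-cong
        (Z.trans (Z.x*yz≈y*xz D K₁ (Z.1# Z.- Q)) (Z.trans (Z.*-congˡ {K₁} Count.D*[1-Q]≈1) (Z.*-identityʳ K₁))))

      F*denominator : F S.* denominator S.≈ numerator
      F*denominator = S.trans (S.*-congʳ {denominator} F≈cstD*M) (S.trans
        (S.solve 4 (λ d m k x → (d S.:* m) S.:* (k S.:* x) S.:= (d S.:* x) S.:* (k S.:* m)) S.refl (cst D) M K (cst (K₁ Z.* (Z.1# Z.- Q))))
        (S.*-congʳ {K S.* M} cancel-D))

      -- The coefficient of u⁰z¹ is -p₋c, since K 0 = -z p₋c and K₁ has constant term 1.
      K*K₁≉0 : ¬ K S.* cst K₁ S.≈ S.0#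
      K*K₁≉0 e = p₋c≉0 (A.trans (A.sym (A.-‿involutive (p Fin.zero))) (A.trans (A.-‿cong (A.trans (A.sym value) (e 0 1))) A.-0#≈0#))
        where
        value : (K S.* cst K₁) 0 1 A.≈ A.- p Fin.zero
        value = A.trans (Z.trans (Z.+-identityʳ (K 0 Z.* K₁)) (Z.trans (Z.*-congʳ {K₁} K-0)
            (Z.solve 3 (λ x p k → (Z.:- (x Z.:* p)) Z.:* k Z.:= x Z.:* (Z.:- (p Z.:* k))) Z.refl Az.X p₀ K₁)) 1)
          (A.trans (Az.X* (Z.- (p₀ Z.* K₁)) 1) (A.-‿cong (A.trans (Az.constant-* (p Fin.zero) K₁ 0)
            (A.trans (A.*-congˡ (A.trans (A.+-congˡ (A.-‿cong (Az.X* (scalarz Count.σ) 0))) (A.trans (A.+-congˡ A.-0#≈0#) (A.+-identityʳ A.1#))))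
              (A.*-identityʳ (p Fin.zero))))))

      denominator≉0 : ¬ denominator S.≈ S.0#
      denominator≉0 e = K*K₁≉0 (S.trans (S.*-congˡ {K} (S.sym cancel-D)) (S.trans
        (S.x*yz≈y*xz K (cst D) (cst (K₁ Z.* (Z.1# Z.- Q)))) (S.trans (S.*-congˡ {cst D} e) (S.zeroʳ (cst D)))))

    F-algebraic : Algebraic A.rawRing F
    F-algebraic = 𝓛-algebraic {F} {numerator} {denominator} F*denominator
      (𝓛-cong (PR.sym (PR.trans (φ-* (cst K₁) (K S.* M)) (PR.*-cong {φ (cst K₁)} {const (ι K₁)} (φ-constant K₁) (φ-* K M))))
        (𝓛-* 𝓛c-K₁ 𝓛-N))
      (𝓛-cong (PR.sym (PR.trans (φ-* K (cst (K₁ Z.* (Z.1# Z.- Q)))) (PR.*-congˡ {φ K} (φ-constant (K₁ Z.* (Z.1# Z.- Q))))))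
        (𝓛-* (𝓛-φ poly-K) 𝓛c-K₁*[1-Q]))
      denominator≉0

  -- Expansion in the large roots

  module LargeRoots (v : Fin d → Carrier) (v-root : ∀ l → KernelRoot (v l)) (v-distinct : ∀ l j → v l ≈ v j → l ≡ j)
    (v⁻¹-integral : ∀ l → Valuation.Integral 𝒱 (KernelRoot.invertible (v-root l) ⁻¹)) where

    large-difference : ∀ l j → j ≢ l → Unit (v l - v j)
    large-difference l j j≢l = KernelAlgebra.root-difference-unit v v-root l j λ e → j≢l (≡.sym (v-distinct l j e))

    residue : Fin d → Carrier
    residue l = ∏≢ l (λ j j≢l → large-difference l j j≢l ⁻¹)

    partialFractions : Series
    partialFractions k = sum λ l → (KernelRoot.invertible (v-root l) ⁻¹) ^ suc k * residue l

    -- By the partial fraction expansion K * `partialFractions` has leading coefficient p_d z, the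
    -- negative of that of K. Dividing by it makes K * Y monic, which is the origin of 1 / (p_d z).
    pz-unit : Unit (scalar p-d * z)
    pz-unit = Unit-* (scalar-unit p-d≉0) z-unit

    private
      d+c : suc (c ℕ.+ d) ≡ suc (d ℕ.+ c)
      d+c = ≡.cong suc (ℕ.+-comm c d)

      K*S : (φ K PR.* partialFractions) c ≈ - φ K (d ℕ.+ c) × (∀ j → c ℕ.< j → (φ K PR.* partialFractions) j ≈ 0#)
      K*S = PartialFractionExpansion.K*expansion L tight 1≤d v (KernelRoot.invertible ∘ v-root) v-distinct large-difference c (φ K)
        (≡.subst (λ n → DegreeBelow n (φ K)) d+c φK-degree)
        (λ l → ≡.subst (λ n → eval n (φ K) (v l) ≈ 0#) d+c (kernelRoot-eval (v-root l)))

      Y : Series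
      Y = const (pz-unit ⁻¹) PR.* partialFractions

      K*Y : ∀ j → (φ K PR.* Y) j ≈ pz-unit ⁻¹ * (φ K PR.* partialFractions) j
      K*Y j = trans (PR.x*yz≈y*xz (φ K) (const (pz-unit ⁻¹)) partialFractions j) (P.constant-* (pz-unit ⁻¹) (φ K PR.* partialFractions) j)

      Y-degree : DegreeBelow (suc c) (φ K PR.* Y)
      Y-degree j c<j = trans (K*Y j) (trans (*-congˡ (proj₂ K*S j c<j)) (zeroʳ _))

      Y-monic : (φ K PR.* Y) c ≈ 1#
      Y-monic = trans (K*Y c) (trans (*-congˡ (trans (proj₁ K*S) (trans (-‿cong (≡.subst (λ j → φ K j ≈ - (scalar p-d * z)) (ℕ.+-comm c d) φK-lead))
        (-‿involutive _)))) (inverseˡ pz-unit))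

      -- The powers of 1 / v l are integral because the large roots tend to ∞, so only the d
      -- residues have poles, and finitely many poles have a common bound.
      S-bounded : Bounded partialFractions
      S-bounded = pole-order , λ k → Integral-cong
        (trans (sum-cong λ l → x*yz≈y*xz ((KernelRoot.invertible (v-root l) ⁻¹) ^ suc k) (τ ^ pole-order) (residue l))
          (sym (*-distribˡ-sum (τ ^ pole-order) (λ l → (KernelRoot.invertible (v-root l) ⁻¹) ^ suc k * residue l))))
        (Integral-sum (λ l → (KernelRoot.invertible (v-root l) ⁻¹) ^ suc k * (τ ^ pole-order * residue l))
          λ l → Integral-* (Integral-^ (v⁻¹-integral l) (suc k)) (proj₂ (pole-finite residue) l))
        where
        open Valuation 𝒱
        pole-order = proj₁ (pole-finite residue)

      Y-bounded : Bounded Y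
      Y-bounded = Bounded-* {const (pz-unit ⁻¹)} {partialFractions} (Bounded-polynomial {1} (λ { (suc i) _ → refl })) S-bounded

    module _ (w : Fin c → Carrier) (w-root : ∀ i → KernelRoot (w i)) (w-distinct : ∀ i j → w i ≈ w j → i ≡ j)
      (w-small : ∀ i → ∃[ y ] Valuation.Integral 𝒱 y × w i ≈ Valuation.τ 𝒱 * y) where

      M-partialFractions : ∀ k → ι (M k) ≈ pz-unit ⁻¹ * partialFractions k
      M-partialFractions k = trans (SmallRoots.φM-unique w w-root w-distinct w-small {Y} Y-bounded Y-degree Y-monic k)
        (P.constant-* (pz-unit ⁻¹) partialFractions k)

  -- The product formula in C((t))((u))

  module LaurentKernel {b′ ℓ′} (Lu : CommutativeRing b′ ℓ′) {j : Series → CommutativeRing.Carrier Lu}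
    (j-hom : IsRingHomomorphism (CommutativeRing.rawRing P.powerSeriesRing) (CommutativeRing.rawRing Lu) j) where
    private module Lu = RingTools Lu
    open Homomorphism.Properties P.powerSeriesRing Lu j-hom
      renaming (φ-cong to j-cong; φ-* to j-*; φ-^ to j-^; φ-sum to j-sum; φ-minus to j-minus; φ-product to j-product; φ-Unit to j-Unit) using ()

    module _ {u⁻¹ : Lu.Carrier} (uu⁻¹≈1 : j u Lu.* u⁻¹ Lu.≈ Lu.1#) where

      kernel : Lu.Carrier
      kernel = Lu.1# Lu.- j (const z) Lu.* Lu.sum (λ i → j (const (scalar (p i))) Lu.* Lu.power (j u) u⁻¹ (jumpSize i))

      jφK≈ : j (φ K) Lu.≈ j u Lu.^ c Lu.* kernel
      jφK≈ = Lu.trans (j-cong φK-expansion) (Lu.trans (j-minus (u PR.^ c) (const z PR.* φ Count.steps))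
        (Lu.trans (Lu.+-cong (j-^ u c) (Lu.-‿cong (Lu.trans (j-* (const z) (φ Count.steps)) (Lu.*-congˡ
            (Lu.trans (j-cong (PR.sym steps-expansion)) (Lu.trans (j-sum (λ i → const (scalar (p i)) PR.* u PR.^ toℕ i))
              (Lu.sum-cong λ i → Lu.trans (j-* (const (scalar (p i))) (u PR.^ toℕ i)) (Lu.*-congˡ (j-^ u (toℕ i))))))))))
          (Lu.sym (RingLemmas.clear-kernel Lu uu⁻¹≈1 c (λ i → j (const (scalar (p i)))) (j (const z))))))

      -- uᶜ (1 - z P(u)) is the image of the power series K, which is invertible because its
      -- constant term in u, -z p₋c, is a unit.
      kernel-unit : Lu.Unit (j u Lu.^ c Lu.* kernel)
      kernel-unit = Lu.Unit-cong jφK≈ (j-Unit (P.powerSeries-unit {φ K} φK₀-unit))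

      module _ (w : Fin c → Carrier) (factorisation : φ K PR.* φ M PR.≈ rootProduct w) where

        jφM≈ : j (φ M) Lu.≈ Lu.product (λ i → j (linear (w i))) Lu.* kernel-unit Lu.⁻¹
        jφM≈ = Lu.Unit-cancel kernel-unit (Lu.trans (Lu.*-congʳ (Lu.sym jφK≈)) (Lu.trans (Lu.sym (j-* (φ K) (φ M)))
          (Lu.trans (Lu.trans (j-cong factorisation) (j-product (λ i → linear (w i)))) (Lu.trans (Lu.sym (Lu.*-identityʳ _))
            (Lu.trans (Lu.*-congˡ (Lu.sym (Lu.inverseʳ kernel-unit))) (Lu.x*yz≈y*xz _ _ _))))))

        jφF≈ : j (φ F) Lu.≈ j (const (ι D)) Lu.* (Lu.product (λ i → j (linear (w i))) Lu.* kernel-unit Lu.⁻¹)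
        jφF≈ = Lu.trans (j-cong (PR.trans (φ-cong F≈cstD*M) (PR.trans (φ-* (cst D) M) (PR.*-congʳ {φ M} (φ-constant D)))))
          (Lu.trans (j-* (const (ι D)) (φ M)) (Lu.*-congˡ jφM≈))

-- Puiseux series

module LaurentEmbedding {a ℓ} (L : CommutativeRing a ℓ) where
  private
    module P = PowerSeries L
  Lu : CommutativeRing a ℓ
  Lu = LaurentSeries.laurentRing L
  private module Lu = RingTools Lu

  series : (ℕ → CommutativeRing.Carrier L) → Lu.Carrier
  series f = f /X^ 0

  series-hom : IsRingHomomorphism (CommutativeRing.rawRing P.powerSeriesRing) (CommutativeRing.rawRing Lu) series
  series-hom = Homomorphism.ringHomomorphism P.powerSeriesRing Lu series id
    (λ f g → Lu.refl {series f Lu.+ series g}) (λ f g → Lu.refl {series f Lu.* series g}) (Lu.refl {Lu.1#})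

  X-inverse : series P.X Lu.* (constant (CommutativeRing.rawRing L) (CommutativeRing.1# L) /X^ 1) Lu.≈ Lu.1#
  X-inverse = T.trans (T.*-identityʳ P.X) λ { zero → L.refl ; (suc zero) → L.refl ; (suc (suc n)) → L.refl }
    where
    module T = CommutativeRing P.powerSeriesRing
    module L = CommutativeRing L

module PuiseuxEmbedding {a ℓ₁ ℓ₂ b ℓ₃} (R : OrderedField a ℓ₁ ℓ₂) (C : FieldExtension R b ℓ₃) (W : Weights R) (e : ℕ) .{{_ : NonZero e}} where
  private
    module A = RingTools (OrderedField.commutativeRing R)
    module Az = PowerSeries (OrderedField.commutativeRing R)
    module C = RingTools (FieldExtension.commutativeRing C)
    module Ct = PowerSeries (FieldExtension.commutativeRing C)
    module T = RingTools Ct.powerSeriesRing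
    module Ram = Ramification (FieldExtension.commutativeRing C) e
    module LF = LaurentField (FieldExtension.isField C)
    module Emb = SeriesMap (OrderedField.commutativeRing R) (FieldExtension.commutativeRing C) (FieldExtension.isHomomorphism C)
    module emb = Homomorphism.Properties (OrderedField.commutativeRing R) (FieldExtension.commutativeRing C) (FieldExtension.isHomomorphism C)
    module mapped = Homomorphism.Properties Az.powerSeriesRing Ct.powerSeriesRing Emb.mapSeries-hom
  open Kernel R C W e using (ι)

  L : CommutativeRing b ℓ₃
  L = LF.laurentRing
  private
    module L = RingTools L

  ι-hom : IsRingHomomorphism (powerSeries A.rawRing) L.rawRing ι
  ι-hom = Homomorphism.ringHomomorphism Az.powerSeriesRing L ι
    (λ f≈g → Ram.ramify-cong λ n → emb.φ-cong (f≈g n))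
    (λ f g → T.trans (Ram.ramify-cong (mapped.φ-+ f g)) (Ram.ramify-+ (Emb.mapSeries f) (Emb.mapSeries g)))
    (λ f g → T.trans (Ram.ramify-cong (mapped.φ-* f g)) (Ram.ramify-* (Emb.mapSeries f) (Emb.mapSeries g)))
    (T.trans (Ram.ramify-cong mapped.φ-1) (Ram.ramify-constant C.1#))

  1≉0 : ¬ L.1# L.≈ L.0#
  1≉0 1≈0 = FieldExtension.1≉0 C (1≈0 0)

  ι-unit : ∀ f n → ¬ f n A.≈ A.0# → L.Unit (ι f)
  -- Under z = tᵉ the coefficient of index n moves to index n e.
  ι-unit f n fₙ≉0 = LF.coefficient-unit (ramify C.rawRing e (Emb.mapSeries f)) 0 (n ℕ.* e)
    λ e≈0 → FieldExtension.1≉0 C (C.trans (C.sym (C.inverseʳ u)) (C.trans (C.*-congʳ (C.trans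
      (C.reflexive (≡.sym (Ram.ramify-multiple (Emb.mapSeries f) n))) e≈0)) (C.zeroˡ _)))
    where u = emb.φ-Unit (OrderedField.invertible R (f n) fₙ≉0)

  ι-integral : ∀ f → Valuation.Integral LF.valuation (ι f)
  ι-integral f = ramify C.rawRing e (Emb.mapSeries f) , L.refl {ι f}

commutativeRing : ∀ {a ℓ} (raw : RawRing a ℓ) → let open RawRing raw in
  IsCommutativeRing _≈_ _+_ _*_ -_ 0# 1# → CommutativeRing a ℓ
commutativeRing raw isCommutativeRing = record { isCommutativeRing = isCommutativeRing }

-- Stated over raw rings, so that at puiseux and puiseux[u] the conclusions are
-- syntactically those of the theorem and no Laurent series is ever unfolded.
module OverRawRings {a ℓ₁ ℓ₂ b ℓ₃ ℓᵥ b′ ℓ′} {R : OrderedField a ℓ₁ ℓ₂} (W : Weights R)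
  (rawL : RawRing b ℓ₃)
  (isL : IsCommutativeRing (RawRing._≈_ rawL) (RawRing._+_ rawL) (RawRing._*_ rawL) (RawRing.-_ rawL) (RawRing.0# rawL) (RawRing.1# rawL))
  (tight : ∀ x → ¬ RingOps.Unit rawL x → RawRing._≈_ rawL x (RawRing.0# rawL))
  (1≉0 : ¬ RawRing._≈_ rawL (RawRing.1# rawL) (RawRing.0# rawL))
  (ι : (ℕ → OrderedField.Carrier R) → RawRing.Carrier rawL)
  (ι-hom : IsRingHomomorphism (powerSeries (OrderedField.rawRing R)) rawL ι)
  (ι-unit : ∀ f n → ¬ OrderedField._≈_ R (f n) (OrderedField.0# R) → RingOps.Unit rawL (ι f))
  (𝒱 : Valuation (commutativeRing rawL isL) ℓᵥ) (ι-integral : ∀ f → Valuation.Integral 𝒱 (ι f))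
  (rawLu : RawRing b′ ℓ′)
  (isLu : IsCommutativeRing (RawRing._≈_ rawLu) (RawRing._+_ rawLu) (RawRing._*_ rawLu) (RawRing.-_ rawLu) (RawRing.0# rawLu) (RawRing.1# rawLu))
  (j : (ℕ → RawRing.Carrier rawL) → RawRing.Carrier rawLu)
  (j-hom : IsRingHomomorphism (powerSeries rawL) rawLu j)
  (u⁻¹ : RawRing.Carrier rawLu)
  (uu⁻¹≈1 : RawRing._≈_ rawLu (RawRing._*_ rawLu (j (variable′ rawL)) u⁻¹) (RawRing.1# rawLu)) where

  open Weights W
  open Paths R W
  private
    module L  = RingOps rawL
    module Lu = RingOps rawLu
    A = OrderedField.rawRing R
    Lring : CommutativeRing b ℓ₃
    Lring = commutativeRing rawL isL
    Luring : CommutativeRing b′ ℓ′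
    Luring = commutativeRing rawLu isLu
    module LT = RingTools Lring
    module LuT = RingTools Luring
    module Eq = KernelEquation W Lring tight 1≉0 ι-hom ι-unit 𝒱 ι-integral
    module Val = Valuation 𝒱

  z : L.Carrier
  z = ι (variable′ A)

  scalar : OrderedField.Carrier R → L.Carrier
  scalar x = ι (constant A x)

  constᵤ : L.Carrier → Lu.Carrier
  constᵤ x = j (constant rawL x)

  u : Lu.Carrier
  u = j (variable′ rawL)

  kernelAt : L.Carrier → L.Carrier → L.Carrier
  kernelAt w w⁻¹ = L.1# L.- z L.* L.sum λ i → scalar (p i) L.* L.power w w⁻¹ (jumpSize i)

  kernel : Lu.Carrier
  kernel = Lu.1# Lu.- constᵤ z Lu.* Lu.sum λ i → constᵤ (scalar (p i)) Lu.* Lu.power u u⁻¹ (jumpSize i)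

  module WithRoots
    (small : Fin c → L.Carrier) (small-unit : ∀ i → L.Unit (small i))
    (small-root : ∀ i → kernelAt (small i) (small-unit i L.⁻¹) L.≈ L.0#)
    (small-distinct : ∀ i j → small i L.≈ small j → i ≡ j)
    (small-τ : ∀ i → ∃[ y ] Val.Integral y × small i L.≈ Val.τ L.* y)
    (large : Fin d → L.Carrier) (large-unit : ∀ l → L.Unit (large l))
    (large-root : ∀ l → kernelAt (large l) (large-unit l L.⁻¹) L.≈ L.0#)
    (large-distinct : ∀ l j → large l L.≈ large j → l ≡ j)
    (large⁻¹-integral : ∀ l → Val.Integral (large-unit l L.⁻¹)) where

    private
      small-roots : ∀ i → Eq.KernelRoot (small i)
      small-roots i = record { invertible = small-unit i ; root = small-root i }

      large-roots : ∀ l → Eq.KernelRoot (large l)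
      large-roots l = record { invertible = large-unit l ; root = large-root l }

      open Eq.SmallRoots small small-roots small-distinct small-τ using (φK*φM≈rootProduct)
      module Large = Eq.LargeRoots large large-roots large-distinct large⁻¹-integral

    algebraic : Algebraic A F
    algebraic = Eq.AlgebraicSeries.F-algebraic small small-roots φK*φM≈rootProduct

    product-formula : Σ[ K ∈ Lu.Unit (u Lu.^ c Lu.* kernel) ]
      j (λ k → ι (F k)) Lu.≈ constᵤ (ι D) Lu.* (Lu.product (λ i → u Lu.- constᵤ (small i)) Lu.* K Lu.⁻¹)
    product-formula = LK.kernel-unit uu⁻¹≈1 , LuT.trans (LK.jφF≈ uu⁻¹≈1 small φK*φM≈rootProduct)
      (LuT.*-congˡ (LuT.*-congʳ (LuT.product-cong λ i → Homomorphism.Properties.φ-minus (PowerSeries.powerSeriesRing Lring) Luring j-hom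
        (variable′ rawL) (constant rawL (small i)))))
      where module LK = Eq.LaurentKernel Luring j-hom

    large-formula : Σ[ pz ∈ L.Unit (scalar p-d L.* z) ]
      Σ[ Δ ∈ (∀ l j → j ≢ l → L.Unit (large l L.- large j)) ]
        ∀ k → ι (F k) L.≈ ι D L.* (pz L.⁻¹ L.*
          L.sum (λ l → L.power (large l) (large-unit l L.⁻¹) -[1+ k ] L.* L.∏≢ l (λ j j≢l → Δ l j j≢l L.⁻¹)))
    large-formula = Large.pz-unit , Large.large-difference , λ k →
      LT.trans (ι-homomorphism.φ-cong (Count.F≈D*M k)) (LT.trans (ι-homomorphism.φ-* D (M k))
        (LT.*-congˡ (Large.M-partialFractions small small-roots small-distinct small-τ k)))
      where
      module Count = PathCounting R W
      module ι-homomorphism = Homomorphism.Properties (PowerSeries.powerSeriesRing (OrderedField.commutativeRing R)) Lring ι-hom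

module Theorem {a ℓ₁ ℓ₂ b ℓ₃} (R : OrderedField a ℓ₁ ℓ₂) (C : FieldExtension R b ℓ₃) (W : Weights R) (e : ℕ) .{{_ : NonZero e}} where
  open Kernel R C W e
  private module LF = LaurentField (FieldExtension.isField C)
  open PuiseuxEmbedding R C W e using (ι-hom; 1≉0; ι-unit; ι-integral) renaming (L to Lring)
  open LaurentEmbedding Lring using (Lu; series; series-hom; X-inverse)
  private
    module O = OverRawRings W puiseux (CommutativeRing.isCommutativeRing Lring) LF.tight 1≉0 ι ι-hom ι-unit LF.valuation ι-integral
      puiseux[u] (CommutativeRing.isCommutativeRing Lu) series series-hom u⁻¹ X-inverse

  private
    module L = RingOps puiseux
    module Lu = RingOps puiseux[u]

  module _ (roots : Kernel.Roots R C W e) where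
    open Weights W
    open Paths R W
    open Roots roots

    small-unit : ∀ i → L.Unit (small i)
    small-unit i = IsKernelRoot.unit (small-root i)

    large-unit : ∀ l → L.Unit (large l)
    large-unit l = IsKernelRoot.unit (large-root l)

    small-kernel : ∀ i → O.kernelAt (small i) (small-unit i L.⁻¹) L.≈ L.0#
    small-kernel i = IsKernelRoot.root (small-root i)

    large-kernel : ∀ l → O.kernelAt (large l) (large-unit l L.⁻¹) L.≈ L.0#
    large-kernel l = IsKernelRoot.root (large-root l)

    small-τ : ∀ i → ∃[ y ] LF.Integral y × small i L.≈ LF.τ L.* y
    small-τ i = LF.small (small i) (small-0 i)

    large⁻¹ : ∀ l → LF.Integral (large-unit l L.⁻¹)
    large⁻¹ l = LF.inverse-integral (large l) (large-∞ l) (proj₂ (proj₂ (large-unit l)))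

    private
      module Roots′ = O.WithRoots small small-unit small-kernel small-distinct small-τ
        large large-unit large-kernel large-distinct large⁻¹

    algebraic : Algebraic (OrderedField.rawRing R) F
    algebraic = Roots′.algebraic

    ProductFormula : (x f δ π : Lu.Carrier) → Set _
    ProductFormula x f δ π = Σ[ K ∈ Lu.Unit x ] f Lu.≈ δ Lu.* (π Lu.* K Lu.⁻¹)

    -- The two denominators and the two products are definitionally equal, but comparing
    -- them inside the formula makes Agda multiply out Laurent series; hence subst.
    denominator≡ : O.u Lu.^ c Lu.* O.kernel ≡ u Lu.^ c Lu.* kernel
    denominator≡ = ≡.cong₂ Lu._*_ {O.u Lu.^ c} {u Lu.^ c} {O.kernel} {kernel} ≡.refl ≡.refl

    product≡ : Lu.product (λ i → O.u Lu.- O.constᵤ (small i)) ≡ Lu.product (λ i → u Lu.- constᵤ (small i))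
    product≡ = ≡.refl

    product-formula : ProductFormula (u Lu.^ c Lu.* kernel) (ιᵤ F) (constᵤ (ι D)) (Lu.product (λ i → u Lu.- constᵤ (small i)))
    product-formula = ≡.subst (ProductFormula (u Lu.^ c Lu.* kernel) (ιᵤ F) (constᵤ (ι D))) product≡
      (≡.subst (λ x → ProductFormula x (series (λ k → ι (F k))) (O.constᵤ (ι D)) (Lu.product (λ i → O.u Lu.- O.constᵤ (small i))))
        denominator≡ Roots′.product-formula)

    large-formula : Σ[ pz ∈ L.Unit (scalar p-d L.* z) ]
      Σ[ Δ ∈ (∀ l j → j ≢ l → L.Unit (large l L.- large j)) ]
        ∀ k → ι (F k) L.≈ ι D L.* (pz L.⁻¹ L.*
          L.sum (λ l → large-power l -[1+ k ] L.* L.∏≢ l (λ j j≢l → Δ l j j≢l L.⁻¹)))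
    large-formula = Roots′.large-formula

theorem2p1 : ∀ {a ℓ₁ ℓ₂ b ℓ₃} (R : OrderedField a ℓ₁ ℓ₂) (C : FieldExtension R b ℓ₃)
    (W : Weights R) (e : ℕ) .{{_ : NonZero e}} (roots : Kernel.Roots R C W e) →
    let open Weights W
        open Paths R W
        open Kernel R C W e
        open Roots roots
        A = OrderedField.rawRing R
        module Rz  = RingOps (powerSeries A)
        module Rzu = RingOps (powerSeries (powerSeries A))
        module L   = RingOps puiseux
        module Lu  = RingOps puiseux[u]
    in
    Algebraic A F
    × D Rz.* (Rz.1# Rz.- Q) Rz.≈ Rz.1#
    × F Rzu.≈ constant (powerSeries A) D Rzu.* M
    × (Σ[ K ∈ Lu.Unit (u Lu.^ c Lu.* kernel) ]
        ιᵤ F Lu.≈ constᵤ (ι D) Lu.* (Lu.product (λ i → u Lu.- constᵤ (small i)) Lu.* K Lu.⁻¹))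
    × (∀ k → F k Rz.≈ D Rz.* M k)
    × (Σ[ pz ∈ L.Unit (scalar p-d L.* z) ]
       Σ[ Δ ∈ (∀ l j → j ≢ l → L.Unit (large l L.- large j)) ]
        ∀ k → ι (F k) L.≈ ι D L.* (pz L.⁻¹ L.*
          L.sum (λ l → large-power l -[1+ k ] L.* L.∏≢ l (λ j j≢l → Δ l j j≢l L.⁻¹))))
theorem2p1 R C W e roots =
    Theorem.algebraic R C W e roots
  , PathCounting.D*[1-Q]≈1 R W
  , PathCounting.F≈constant-D*M R W
  , Theorem.product-formula R C W e roots
  , PathCounting.F≈D*M R W
  , Theorem.large-formula R C W e roots
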